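{- Let $n\ge 1$ and let $A_n$ be the group of permutations of $[n+1]=\{1,\dots,n+1\}$, with Coxeter generators $s_i=(i,i+1)$, $1\le i\le n$. Let $\pi,\rho\in A_n$ be two boolean permutations such that $\pi\le\rho$ in the Bruhat order. Then the ordinary Kazhdan--Lusztig polynomial is $$P_{\pi,\rho}(q)=(1+q)^{\#A_{\pi,\rho}},$$ where $$A_{\pi,\rho}=\{i\in[n] : i\in \mathrm{NFix}(\rho),\ i+1\in\mathrm{NFix}(\rho),\ i+1\in\mathrm{Fix}(\pi)\}.$$
   Context: $[m]=\{1,\dots,m\}$. For $\sigma\in A_n$: $\mathrm{Fix}(\sigma)=\{i\in[n] : \sigma([i])=[i]\}$ and $\mathrm{NFix}(\sigma)=\{i\in[n]\setminus\mathrm{Fix}(\sigma) : \sigma(i+1)=i+1\}$. A boolean reflection in a Coxeter system $(W,S)$ is a reflection having a reduced expression $r_1\cdots r_{k-1}r_kr_{k-1}\cdots r_1$ with $r_1,\dots,r_k\in S$ pairwise distinct; an element is boolean if it is below some boolean reflection in Bruhat order. In $A_n$ this is equivalent to being $\le$ the transposition $(1,n+1)=s_1\cdots s_{n-1}s_ns_{n-1}\cdots s_1$. -}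

module Defs where

open import Algebra.Bundles using (Group)
open import Data.Fin.Base as Fin using (Fin; inject₁; toℕ)
import Data.Fin.Properties as Fin
import Data.Fin.Permutation as Perm
open Perm using (Permutation′; _⟨$⟩ʳ_; _∘ₚ_; flip; transpose)
open import Data.Integer.Base as ℤ using (ℤ; 0ℤ; 1ℤ; -1ℤ)
open import Data.List.Base as List using (List; []; _∷_; _++_; map; length; reverse; applyUpTo)
import Data.List.Membership.Setoid as Membership
import Data.List.Relation.Unary.Unique.Setoid as UniqueSetoid
import Data.List.Relation.Unary.Unique.Propositional as UniquePropositional
open import Data.Nat.Base as ℕ using (ℕ; zero; suc; _∸_; ⌊_/2⌋)
import Data.Nat.Properties as ℕ
open import Data.Product.Base using (∃; ∃-syntax; _×_; _,_)
import Data.Vec.Base as Vec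
open import Function.Bundles using (_⇔_; mk⇔; Equivalence)
open import Level using (_⊔_; 0ℓ)
open import Relation.Binary.PropositionalEquality
  using (_≡_; refl; sym; trans; cong)
open import Relation.Nullary.Decidable using (Dec; _×-dec_; _→-dec_; ¬?; map′)
open import Relation.Nullary.Negation using (¬_)

------------------------------------------------------------------------
-- Polynomials in q over ℤ

-- Coefficient lists, constant term first.  Trailing zeros are allowed, so the
-- equality of polynomials is _≋_ and not _≡_.
Poly : Set
Poly = List ℤ

coeff : Poly → ℕ → ℤ
coeff []      _       = 0ℤ
coeff (a ∷ _) zero    = a
coeff (_ ∷ p) (suc k) = coeff p k

infix 4 _≋_
_≋_ : Poly → Poly → Set
p ≋ r = ∀ k → coeff p k ≡ coeff r k

0ₚ 1ₚ q q-1 1+q : Poly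
0ₚ  = []
1ₚ  = 1ℤ ∷ []
q   = 0ℤ ∷ 1ℤ ∷ []
q-1 = -1ℤ ∷ 1ℤ ∷ []
1+q = 1ℤ ∷ 1ℤ ∷ []

infixl 6 _+ₚ_
infixl 7 _*ₚ_
infixr 8 _^ₚ_

_+ₚ_ : Poly → Poly → Poly
[]      +ₚ r       = r
(a ∷ p) +ₚ []      = a ∷ p
(a ∷ p) +ₚ (b ∷ r) = (a ℤ.+ b) ∷ (p +ₚ r)

_*ₚ_ : Poly → Poly → Poly
[]      *ₚ r = []
(a ∷ p) *ₚ r = map (a ℤ.*_) r +ₚ (0ℤ ∷ (p *ₚ r))

_^ₚ_ : Poly → ℕ → Poly
p ^ₚ zero  = 1ₚ
p ^ₚ suc k = p *ₚ (p ^ₚ k)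

sumₚ : List Poly → Poly
sumₚ = List.foldr _+ₚ_ 0ₚ

deg_≤_ : Poly → ℕ → Set
deg p ≤ d = ∀ k → d ℕ.< k → coeff p k ≡ 0ℤ

-- q^m p(q⁻¹).  This is the intended polynomial only when deg p ≤ m: terms of
-- higher degree are dropped.
reciprocal : ℕ → Poly → Poly
reciprocal m p = applyUpTo (λ k → coeff p (m ∸ k)) (suc m)

------------------------------------------------------------------------
-- Coxeter systems

-- The definitions make sense for any group W with a family s of elements; they
-- carry their usual meaning when (W , s) is a Coxeter system with the
-- generators s i pairwise distinct.
module Coxeter {c ℓ} (W : Group c ℓ) {I : Set} (s : I → Group.Carrier W) where

  open Group W
  open Membership setoid using (_∈_)
  open UniqueSetoid setoid using (Unique)

  eval : List I → Carrier
  eval = List.foldr (λ i w → s i ∙ w) ε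

  -- The Coxeter length, as a relation: k is the least length of a word
  -- in the generators representing w.
  _HasLength_ : Carrier → ℕ → Set ℓ
  w HasLength k =
    (∃[ is ] eval is ≈ w × length is ≡ k) ×
    (∀ is → eval is ≈ w → k ℕ.≤ length is)

  Reduced : List I → Set ℓ
  Reduced is = eval is HasLength length is

  _Shorter_ : Carrier → Carrier → Set ℓ
  u Shorter v = ∃[ a ] ∃[ b ] u HasLength a × v HasLength b × a ℕ.< b

  Reflection : Carrier → Set (c ⊔ ℓ)
  Reflection t = ∃[ w ] ∃[ i ] t ≈ w ∙ s i ∙ w ⁻¹

  infix 4 _≤ᴮ_ _<ᴮ_

  data _≤ᴮ_ (u v : Carrier) : Set (c ⊔ ℓ) where
    done : u ≈ v → u ≤ᴮ v
    step : ∀ {t} → Reflection t → u Shorter (u ∙ t) → u ∙ t ≤ᴮ v → u ≤ᴮ v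

  _<ᴮ_ : Carrier → Carrier → Set (c ⊔ ℓ)
  u <ᴮ v = u ≤ᴮ v × ¬ u ≈ v

  BooleanReflection : Carrier → Set (c ⊔ ℓ)
  BooleanReflection t = Reflection t ×
    (∃[ rs ] ∃[ r ]
       UniquePropositional.Unique (r ∷ rs) ×
       Reduced (rs ++ r ∷ reverse rs) ×
       eval (rs ++ r ∷ reverse rs) ≈ t)

  Boolean : Carrier → Set (c ⊔ ℓ)
  Boolean w = ∃[ t ] BooleanReflection t × w ≤ᴮ t

  _∈D_ : I → Carrier → Set ℓ
  i ∈D w = (w ∙ s i) Shorter w

  EnumeratesInterval : List Carrier → Carrier → Carrier → Set (c ⊔ ℓ)
  EnumeratesInterval as u v =
    Unique as × (∀ a → a ∈ as ⇔ (u ≤ᴮ a × a ≤ᴮ v))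

  -- In a Coxeter system there is exactly one family (up to _≋_) satisfying
  -- IsRFamily, and likewise for IsKLFamily below.
  record IsRFamily (R : Carrier → Carrier → Poly) : Set (c ⊔ ℓ) where
    field
      R-cong    : ∀ {u u′ v v′} → u ≈ u′ → v ≈ v′ → R u v ≋ R u′ v′
      R-zero    : ∀ {u v} → ¬ u ≤ᴮ v → R u v ≋ 0ₚ
      R-one     : ∀ {u} → R u u ≋ 1ₚ
      R-descent : ∀ {u v i} → i ∈D v → i ∈D u →
                  R u v ≋ R (u ∙ s i) (v ∙ s i)
      R-ascent  : ∀ {u v i} → i ∈D v → ¬ i ∈D u →
                  R u v ≋ q *ₚ R (u ∙ s i) (v ∙ s i) +ₚ q-1 *ₚ R u (v ∙ s i)

  record IsKLFamily (P : Carrier → Carrier → Poly) : Set (c ⊔ ℓ) where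
    field
      R         : Carrier → Carrier → Poly
      isRFamily : IsRFamily R
      P-cong    : ∀ {u u′ v v′} → u ≈ u′ → v ≈ v′ → P u v ≋ P u′ v′
      P-zero    : ∀ {u v} → ¬ u ≤ᴮ v → P u v ≋ 0ₚ
      P-one     : ∀ {u} → P u u ≋ 1ₚ
      P-degree  : ∀ {u v a b} → u <ᴮ v → u HasLength a → v HasLength b →
                  deg P u v ≤ ⌊ b ∸ a ∸ 1 /2⌋
      P-dual    : ∀ {u v a b as} → u ≤ᴮ v → u HasLength a → v HasLength b →
                  EnumeratesInterval as u v →
                  reciprocal (b ∸ a) (P u v) ≋ sumₚ (map (λ x → R u x *ₚ P x v) as)

------------------------------------------------------------------------
-- The Coxeter system Aₙ

-- Fin.zero plays the role of 1.  Products are composed as functions,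
-- (u ∙ v)(i) = u(v(i)), whereas u ∘ₚ v applies u first.
symmetricGroup : ℕ → Group 0ℓ 0ℓ
symmetricGroup m = record
  { Carrier = Permutation′ m
  ; _≈_     = Perm._≈_
  ; _∙_     = λ u v → v ∘ₚ u
  ; ε       = Perm.id
  ; _⁻¹     = flip
  ; isGroup = record
    { isMonoid = record
      { isSemigroup = record
        { isMagma = record
          { isEquivalence = record
            { refl  = λ _ → refl
            ; sym   = λ p i → sym (p i)
            ; trans = λ p r i → trans (p i) (r i)
            }
          ; ∙-cong = λ {u} {_} {_} {v′} p r i →
              trans (cong (u ⟨$⟩ʳ_) (r i)) (p (v′ ⟨$⟩ʳ i))
          }
        ; assoc = λ _ _ _ _ → refl
        }
      ; identity = (λ _ _ → refl) , (λ _ _ → refl)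
      }
    ; inverse = (λ u _ → Perm.inverseˡ u) , (λ u _ → Perm.inverseʳ u)
    ; ⁻¹-cong = λ {u} {v} p i →
        trans (cong (flip u ⟨$⟩ʳ_) (sym (trans (p _) (Perm.inverseʳ v))))
              (Perm.inverseˡ u)
    }
  }

-- i : Fin n stands for the index toℕ i + 1 ∈ [n].
simpleTransposition : ∀ n → Fin n → Permutation′ (suc n)
simpleTransposition n i = transpose (inject₁ i) (Fin.suc i)

module A (n : ℕ) = Coxeter (symmetricGroup (suc n)) (simpleTransposition n)

module _ {n : ℕ} where

  infix 4 _∈[_]

  -- x ∈ [i] ⊆ [n+1], in the 1-based numbering.
  _∈[_] : Fin (suc n) → Fin n → Set
  x ∈[ i ] = toℕ x ℕ.≤ toℕ i

  Fix : Permutation′ (suc n) → Fin n → Set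
  Fix σ i = ∀ y → (∃[ x ] x ∈[ i ] × σ ⟨$⟩ʳ x ≡ y) ⇔ y ∈[ i ]

  NFix : Permutation′ (suc n) → Fin n → Set
  NFix σ i = ¬ Fix σ i × σ ⟨$⟩ʳ Fin.suc i ≡ Fin.suc i

  -- j is i + 1; the existential enforces i + 1 ∈ [n].
  𝒜 : Permutation′ (suc n) → Permutation′ (suc n) → Fin n → Set
  𝒜 π ρ i = NFix ρ i × (∃[ j ] toℕ j ≡ suc (toℕ i) × NFix ρ j × Fix π j)

  fix? : ∀ σ i → Dec (Fix σ i)
  fix? σ i = Fin.all? λ y →
    let image? = Fin.any? λ x → (toℕ x ℕ.≤? toℕ i) ×-dec (σ ⟨$⟩ʳ x Fin.≟ y)
        y∈[i]? = toℕ y ℕ.≤? toℕ i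
    in map′ (λ (f , g) → mk⇔ f g)
            (λ e → Equivalence.to e , Equivalence.from e)
            ((image? →-dec y∈[i]?) ×-dec (y∈[i]? →-dec image?))

  nFix? : ∀ σ i → Dec (NFix σ i)
  nFix? σ i = ¬? (fix? σ i) ×-dec (σ ⟨$⟩ʳ Fin.suc i Fin.≟ Fin.suc i)

  𝒜? : ∀ π ρ i → Dec (𝒜 π ρ i)
  𝒜? π ρ i = nFix? ρ i ×-dec
    Fin.any? λ j → (toℕ j ℕ.≟ suc (toℕ i)) ×-dec nFix? ρ j ×-dec fix? π j

  #𝒜 : Permutation′ (suc n) → Permutation′ (suc n) → ℕ
  #𝒜 π ρ = Vec.count (𝒜? π ρ) (Vec.allFin n)

{-# OPTIONS --safe #-}
module Submission where

-- Kazhdan–Lusztig polynomials P(·, ρ) are determined by their degree bound and by the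
-- duality, which says that C_ρ = Σ P(u, ρ) T_u is bar-invariant up to a power of q.  So
-- it suffices to check both for f_ρ(u) = (1+q)^#𝒜(u, ρ) if u ≤ ρ, and 0 otherwise.
--
-- Products with C_s = 1 + T_s keep bar-invariance.  A boolean ρ lies below a
-- transposition, hence it is s x, x s or s x s for the first generator s occurring in
-- ρ and a boolean x in the subgroup generated by the later ones.  Then f_ρ comes from
-- C_s C_x, C_x C_s and C_s C_x C_s respectively, except that in the last case, if the
-- next generator s′ occurs only once in x = s′ z or x = z s′, the term q C_s C_z has to
-- be subtracted.  If s′ occurs twice, nothing is subtracted, and the coefficients at
-- u = y and u = s y, for y ≤ x in which s′ does not occur, keep a factor 1 + q: this is
-- the new element of 𝒜.

open import Defs
open import Algebra.Bundles using (CommutativeRing; Group)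
open import Data.Bool.Base using (if_then_else_)
open import Data.Fin.Base as Fin using (Fin; fromℕ<; inject₁; toℕ; _<_)
import Data.Fin.Induction as Fin
open import Data.Fin.Permutation as Perm using (Permutation′; flip; transpose; _⟨$⟩ʳ_; _⟨$⟩ˡ_)
import Data.Fin.Properties as Fin
open import Data.Integer.Base as ℤ using (ℤ; 0ℤ; 1ℤ)
import Data.Integer.Properties as ℤ
open import Data.Integer.Tactic.RingSolver using () renaming (solve-∀ to solveℤ)
open import Data.List.Base using (List; []; _∷_; _++_; applyUpTo; concatMap; deduplicate; filter; foldr; length; map)
import Data.List.Membership.Setoid as Membership
import Data.List.Membership.Setoid.Properties as ∈ₚ
import Data.List.Properties as List
open import Data.List.Relation.Unary.All as All using (All; []; _∷_)
import Data.List.Relation.Unary.All.Properties as All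
open import Data.List.Relation.Unary.AllPairs using ([]; _∷_)
open import Data.List.Relation.Unary.Any using (any?; here; there)
import Data.List.Relation.Unary.Unique.DecSetoid.Properties as !ₚ
import Data.List.Relation.Unary.Unique.Setoid as Unique
import Data.List.Relation.Unary.Unique.Setoid.Properties as !ₚ
open import Data.Maybe.Base as Maybe using (Maybe; just; nothing)
open import Data.Nat.Base as ℕ using (ℕ; zero; suc; _+_; _∸_; _≤_; ⌊_/2⌋; s≤s; z≤n)
import Data.Nat.Properties as ℕ
open import Data.Nat.Tactic.RingSolver using () renaming (solve-∀ to solveℕ)
open import Data.Product.Base using (∃-syntax; _×_; _,_; map₁; map₂; proj₁; proj₂)
open import Data.Sum.Base as Sum using (_⊎_; inj₁; inj₂)
import Data.Vec.Base as Vec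
open import Function.Base using (_∘_; case_of_)
open import Function.Bundles using (_⇔_; mk⇔; Equivalence)
open import Induction.WellFounded using (Acc; acc)
open import Level using (0ℓ)
open import Relation.Binary.Bundles using (DecSetoid; Setoid)
open import Relation.Binary.Definitions using (tri<; tri≈; tri>)
open import Relation.Binary.PropositionalEquality hiding (decSetoid; resp; setoid)
import Relation.Binary.Reasoning.Setoid as SetoidReasoning
open import Relation.Nullary.Decidable using (Dec; yes; no; dec-false; dec-true; does; map′; _×-dec_; _→-dec_)
open import Relation.Nullary.Negation using (¬_; contradiction)
open import Relation.Unary using (Decidable; Pred)
open import Tactic.RingSolver using (solve-∀)
open import Tactic.RingSolver.Core.AlmostCommutativeRing using (AlmostCommutativeRing; fromCommutativeRing)
open import Algebra.Properties.CommutativeMonoid.Sum ℕ.+-0-commutativeMonoid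
  using (sum; sum-cong-≗; sum-permute; sum-replicate-zero; ∑-comm; ∑-distrib-+)

-- For boolean ρ, `Fix ρ i` says that s_i does not occur in ρ, and `NFix ρ i` that it occurs twice.
-- So 𝒜 counts the places where s_i and s_(i+1) both occur twice in ρ while s_(i+1) is absent from
-- π.
--
-- The factor 1 + q comes from elements u commuting with s: T_u is reached in C_s C_x C_s both from
-- T_u and from T_s T_u T_s, with weights 1 and q. If s′ occurs only once, say x = s′ z, this is too
-- much: the coefficient at s z is 1 + q, although the length gap to s x s is only 2. If s′ occurs
-- twice, u omits both occurrences and the gap leaves room for one more degree; the induction for
-- the degree bound has to remember this room.
--
-- The Bruhat steps and the recursion for R multiply on the right only. Left multiplication by s is
-- therefore handled just for elements of the subgroup of later generators, where induction over
-- right factors reaches it. Half-integral powers of q are avoided by comparing coefficients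
-- directly, with a length L carried along as a parameter.

-- The commutative ring of polynomials

-- _≋_ wrapped in a record, so that Agda can infer the polynomials from it.
infix 4 _≃_
record _≃_ (p r : Poly) : Set where
  constructor pointwise
  field at : p ≋ r
open _≃_ public

polySetoid : Setoid 0ℓ 0ℓ
polySetoid = record
  { Carrier       = Poly
  ; _≈_           = _≃_
  ; isEquivalence = record
    { refl  = pointwise λ _ → refl
    ; sym   = λ p≃r → pointwise λ k → sym (at p≃r k)
    ; trans = λ p≃r r≃t → pointwise λ k → trans (at p≃r k) (at r≃t k)
    }
  }

open Setoid polySetoid using ()
  renaming (refl to ≃-refl; sym to ≃-sym; trans to ≃-trans) public

-ₚ_ : Poly → Poly
-ₚ p = map ℤ.-_ p

coeff-+ : ∀ p r k → coeff (p +ₚ r) k ≡ coeff p k ℤ.+ coeff r k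
coeff-+ []      r       k       = sym (ℤ.+-identityˡ _)
coeff-+ (a ∷ p) []      k       = sym (ℤ.+-identityʳ _)
coeff-+ (a ∷ p) (b ∷ r) zero    = refl
coeff-+ (a ∷ p) (b ∷ r) (suc k) = coeff-+ p r k

coeff-map-* : ∀ a p k → coeff (map (a ℤ.*_) p) k ≡ a ℤ.* coeff p k
coeff-map-* a []      k       = sym (ℤ.*-zeroʳ a)
coeff-map-* a (b ∷ p) zero    = refl
coeff-map-* a (b ∷ p) (suc k) = coeff-map-* a p k

coeff-neg : ∀ p k → coeff (-ₚ p) k ≡ ℤ.- coeff p k
coeff-neg []      k       = refl
coeff-neg (b ∷ p) zero    = refl
coeff-neg (b ∷ p) (suc k) = coeff-neg p k

coeff-* : ∀ a p r k →
          coeff ((a ∷ p) *ₚ r) k ≡ a ℤ.* coeff r k ℤ.+ coeff (0ℤ ∷ (p *ₚ r)) k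
coeff-* a p r k = trans (coeff-+ (map (a ℤ.*_) r) _ k)
                        (cong (ℤ._+ coeff (0ℤ ∷ (p *ₚ r)) k) (coeff-map-* a r k))

+-cong≃ : ∀ {p p′ r r′} → p ≃ p′ → r ≃ r′ → p +ₚ r ≃ p′ +ₚ r′
+-cong≃ {p} {p′} {r} {r′} e f = pointwise λ k → begin
  coeff (p +ₚ r) k         ≡⟨ coeff-+ p r k ⟩
  coeff p k ℤ.+ coeff r k   ≡⟨ cong₂ ℤ._+_ (at e k) (at f k) ⟩
  coeff p′ k ℤ.+ coeff r′ k ≡⟨ coeff-+ p′ r′ k ⟨
  coeff (p′ +ₚ r′) k       ∎
  where open ≡-Reasoning

+-congˡ≃ : ∀ p {r r′} → r ≃ r′ → p +ₚ r ≃ p +ₚ r′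
+-congˡ≃ p = +-cong≃ {p} {p} ≃-refl

shift-cong : ∀ {p r} → p ≃ r → 0ℤ ∷ p ≃ 0ℤ ∷ r
shift-cong e = pointwise λ { zero → refl ; (suc k) → at e k }

+-assoc≃ : ∀ p r t → (p +ₚ r) +ₚ t ≃ p +ₚ (r +ₚ t)
+-assoc≃ p r t = pointwise λ k → begin
  coeff ((p +ₚ r) +ₚ t) k                   ≡⟨ coeff-+ (p +ₚ r) t k ⟩
  coeff (p +ₚ r) k ℤ.+ coeff t k            ≡⟨ cong (ℤ._+ coeff t k) (coeff-+ p r k) ⟩
  coeff p k ℤ.+ coeff r k ℤ.+ coeff t k     ≡⟨ ℤ.+-assoc (coeff p k) _ _ ⟩
  coeff p k ℤ.+ (coeff r k ℤ.+ coeff t k)   ≡⟨ cong (λ z → coeff p k ℤ.+ z) (coeff-+ r t k) ⟨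
  coeff p k ℤ.+ coeff (r +ₚ t) k            ≡⟨ coeff-+ p (r +ₚ t) k ⟨
  coeff (p +ₚ (r +ₚ t)) k                   ∎
  where open ≡-Reasoning

+-comm≃ : ∀ p r → p +ₚ r ≃ r +ₚ p
+-comm≃ p r = pointwise λ k →
  trans (coeff-+ p r k) (trans (ℤ.+-comm (coeff p k) _) (sym (coeff-+ r p k)))

+-identityʳ≃ : ∀ p → p +ₚ 0ₚ ≃ p
+-identityʳ≃ p = +-comm≃ p 0ₚ

+-inverseʳ≃ : ∀ p → p +ₚ (-ₚ p) ≃ 0ₚ
+-inverseʳ≃ p = pointwise λ k →
  trans (coeff-+ p (-ₚ p) k)
        (trans (cong (λ z → coeff p k ℤ.+ z) (coeff-neg p k)) (ℤ.+-inverseʳ (coeff p k)))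

neg-cong≃ : ∀ {p r} → p ≃ r → -ₚ p ≃ -ₚ r
neg-cong≃ {p} {r} e = pointwise λ k →
  trans (coeff-neg p k) (trans (cong ℤ.-_ (at e k)) (sym (coeff-neg r k)))

*-congˡ≃ : ∀ p {r r′} → r ≃ r′ → p *ₚ r ≃ p *ₚ r′
*-congˡ≃ []      e = ≃-refl
*-congˡ≃ (a ∷ p) {r} {r′} e = pointwise λ k →
  trans (coeff-* a p r k)
        (trans (cong₂ (λ x y → a ℤ.* x ℤ.+ y) (at e k) (at (shift-cong (*-congˡ≃ p e)) k))
               (sym (coeff-* a p r′ k)))

*-zeroʳ≃ : ∀ p → p *ₚ 0ₚ ≃ 0ₚ
*-zeroʳ≃ []      = ≃-refl
*-zeroʳ≃ (a ∷ p) = pointwise λ { zero → refl ; (suc k) → at (*-zeroʳ≃ p) k }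

private
  swap-lemma : ∀ a b c d → a ℤ.* b ℤ.+ (c ℤ.+ d) ≡ c ℤ.+ (a ℤ.* b ℤ.+ d)
  swap-lemma = solveℤ

*-∷ʳ : ∀ r a p → r *ₚ (a ∷ p) ≃ map (a ℤ.*_) r +ₚ (0ℤ ∷ (r *ₚ p))
*-∷ʳ []      a p = pointwise λ { zero → refl ; (suc k) → refl }
*-∷ʳ (b ∷ r) a p = pointwise λ
  { zero    → cong (ℤ._+ 0ℤ) (ℤ.*-comm b a)
  ; (suc k) → begin
      coeff ((b ∷ r) *ₚ (a ∷ p)) (suc k)
        ≡⟨ coeff-* b r (a ∷ p) (suc k) ⟩
      b ℤ.* coeff p k ℤ.+ coeff (r *ₚ (a ∷ p)) k
        ≡⟨ cong (λ z → b ℤ.* coeff p k ℤ.+ z)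
             (trans (at (*-∷ʳ r a p) k) (coeff-+ (map (a ℤ.*_) r) (0ℤ ∷ (r *ₚ p)) k)) ⟩
      b ℤ.* coeff p k ℤ.+ (coeff (map (a ℤ.*_) r) k ℤ.+ coeff (0ℤ ∷ (r *ₚ p)) k)
        ≡⟨ swap-lemma b (coeff p k) (coeff (map (a ℤ.*_) r) k) _ ⟩
      coeff (map (a ℤ.*_) r) k ℤ.+ (b ℤ.* coeff p k ℤ.+ coeff (0ℤ ∷ (r *ₚ p)) k)
        ≡⟨ cong (λ z → coeff (map (a ℤ.*_) r) k ℤ.+ z) (coeff-* b r p k) ⟨
      coeff (map (a ℤ.*_) r) k ℤ.+ coeff ((b ∷ r) *ₚ p) k
        ≡⟨ coeff-+ (map (a ℤ.*_) (b ∷ r)) (0ℤ ∷ ((b ∷ r) *ₚ p)) (suc k) ⟨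
      coeff (map (a ℤ.*_) (b ∷ r) +ₚ (0ℤ ∷ ((b ∷ r) *ₚ p))) (suc k) ∎
  }
  where open ≡-Reasoning

*-comm≃ : ∀ p r → p *ₚ r ≃ r *ₚ p
*-comm≃ []      r = ≃-sym (*-zeroʳ≃ r)
*-comm≃ (a ∷ p) r = ≃-trans (+-cong≃ ≃-refl (shift-cong (*-comm≃ p r))) (≃-sym (*-∷ʳ r a p))

*-cong≃ : ∀ {p p′ r r′} → p ≃ p′ → r ≃ r′ → p *ₚ r ≃ p′ *ₚ r′
*-cong≃ {p} {p′} {r} {r′} e f =
  ≃-trans (*-congˡ≃ p f) (≃-trans (*-comm≃ p r′) (≃-trans (*-congˡ≃ r′ e) (*-comm≃ r′ p′)))

*-congʳ≃ : ∀ r {p p′} → p ≃ p′ → p *ₚ r ≃ p′ *ₚ r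
*-congʳ≃ r e = *-cong≃ e (≃-refl {r})

private
  distrib-lemma : ∀ a b x y z → (a ℤ.+ b) ℤ.* x ℤ.+ (y ℤ.+ z) ≡ a ℤ.* x ℤ.+ y ℤ.+ (b ℤ.* x ℤ.+ z)
  distrib-lemma = solveℤ

*-distribʳ≃ : ∀ t p r → (p +ₚ r) *ₚ t ≃ p *ₚ t +ₚ r *ₚ t
*-distribʳ≃ t []      r       = ≃-refl
*-distribʳ≃ t (a ∷ p) []      = ≃-sym (+-identityʳ≃ _)
*-distribʳ≃ t (a ∷ p) (b ∷ r) = pointwise λ k → begin
  coeff (((a ℤ.+ b) ∷ (p +ₚ r)) *ₚ t) k
    ≡⟨ coeff-* (a ℤ.+ b) (p +ₚ r) t k ⟩
  (a ℤ.+ b) ℤ.* coeff t k ℤ.+ coeff (0ℤ ∷ ((p +ₚ r) *ₚ t)) k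
    ≡⟨ cong (λ z → (a ℤ.+ b) ℤ.* coeff t k ℤ.+ z)
         (trans (at (shift-cong (*-distribʳ≃ t p r)) k)
                (coeff-+ (0ℤ ∷ (p *ₚ t)) (0ℤ ∷ (r *ₚ t)) k)) ⟩
  (a ℤ.+ b) ℤ.* coeff t k ℤ.+ (coeff (0ℤ ∷ (p *ₚ t)) k ℤ.+ coeff (0ℤ ∷ (r *ₚ t)) k)
    ≡⟨ distrib-lemma a b (coeff t k) _ _ ⟩
  a ℤ.* coeff t k ℤ.+ coeff (0ℤ ∷ (p *ₚ t)) k ℤ.+ (b ℤ.* coeff t k ℤ.+ coeff (0ℤ ∷ (r *ₚ t)) k)
    ≡⟨ cong₂ ℤ._+_ (coeff-* a p t k) (coeff-* b r t k) ⟨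
  coeff ((a ∷ p) *ₚ t) k ℤ.+ coeff ((b ∷ r) *ₚ t) k
    ≡⟨ coeff-+ ((a ∷ p) *ₚ t) ((b ∷ r) *ₚ t) k ⟨
  coeff ((a ∷ p) *ₚ t +ₚ (b ∷ r) *ₚ t) k ∎
  where open ≡-Reasoning

shift-* : ∀ p r → (0ℤ ∷ p) *ₚ r ≃ 0ℤ ∷ (p *ₚ r)
shift-* p r = pointwise λ k →
  trans (coeff-* 0ℤ p r k) (ℤ.+-identityˡ _)

scale-* : ∀ a p r → map (a ℤ.*_) p *ₚ r ≃ map (a ℤ.*_) (p *ₚ r)
scale-* a []      r = ≃-refl
scale-* a (b ∷ p) r = pointwise λ k → begin
  coeff (((a ℤ.* b) ∷ map (a ℤ.*_) p) *ₚ r) k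
    ≡⟨ coeff-* (a ℤ.* b) (map (a ℤ.*_) p) r k ⟩
  a ℤ.* b ℤ.* coeff r k ℤ.+ coeff (0ℤ ∷ (map (a ℤ.*_) p *ₚ r)) k
    ≡⟨ cong₂ ℤ._+_ (ℤ.*-assoc a b _) (trans (at (shift-cong (scale-* a p r)) k) (push k)) ⟩
  a ℤ.* (b ℤ.* coeff r k) ℤ.+ a ℤ.* coeff (0ℤ ∷ (p *ₚ r)) k
    ≡⟨ ℤ.*-distribˡ-+ a _ _ ⟨
  a ℤ.* (b ℤ.* coeff r k ℤ.+ coeff (0ℤ ∷ (p *ₚ r)) k)
    ≡⟨ cong (λ z → a ℤ.* z) (coeff-* b p r k) ⟨
  a ℤ.* coeff ((b ∷ p) *ₚ r) k
    ≡⟨ coeff-map-* a ((b ∷ p) *ₚ r) k ⟨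
  coeff (map (a ℤ.*_) ((b ∷ p) *ₚ r)) k ∎
  where
  open ≡-Reasoning
  push : ∀ k → coeff (0ℤ ∷ map (a ℤ.*_) (p *ₚ r)) k ≡ a ℤ.* coeff (0ℤ ∷ (p *ₚ r)) k
  push zero    = sym (ℤ.*-zeroʳ a)
  push (suc k) = coeff-map-* a (p *ₚ r) k

*-assoc≃ : ∀ p r t → (p *ₚ r) *ₚ t ≃ p *ₚ (r *ₚ t)
*-assoc≃ []      r t = ≃-refl
*-assoc≃ (a ∷ p) r t = begin
  (map (a ℤ.*_) r +ₚ (0ℤ ∷ (p *ₚ r))) *ₚ t
    ≈⟨ *-distribʳ≃ t (map (a ℤ.*_) r) (0ℤ ∷ (p *ₚ r)) ⟩
  map (a ℤ.*_) r *ₚ t +ₚ (0ℤ ∷ (p *ₚ r)) *ₚ t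
    ≈⟨ +-cong≃ (scale-* a r t) (≃-trans (shift-* (p *ₚ r) t) (shift-cong (*-assoc≃ p r t))) ⟩
  map (a ℤ.*_) (r *ₚ t) +ₚ (0ℤ ∷ (p *ₚ (r *ₚ t))) ∎
  where open SetoidReasoning polySetoid

*-identityˡ≃ : ∀ p → 1ₚ *ₚ p ≃ p
*-identityˡ≃ p = pointwise λ k →
  trans (coeff-* 1ℤ [] p k)
        (trans (cong₂ ℤ._+_ (ℤ.*-identityˡ (coeff p k)) (zeros k)) (ℤ.+-identityʳ _))
  where
  zeros : ∀ k → coeff (0ℤ ∷ []) k ≡ 0ℤ
  zeros zero    = refl
  zeros (suc _) = refl

polyRing : CommutativeRing 0ℓ 0ℓ
polyRing = record
  { Carrier = Poly
  ; _≈_     = _≃_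
  ; _+_     = _+ₚ_
  ; _*_     = _*ₚ_
  ; -_      = -ₚ_
  ; 0#      = 0ₚ
  ; 1#      = 1ₚ
  ; isCommutativeRing = record
    { isRing = record
      { +-isAbelianGroup = record
        { isGroup = record
          { isMonoid = record
            { isSemigroup = record
              { isMagma = record { isEquivalence = Setoid.isEquivalence polySetoid ; ∙-cong = +-cong≃ }
              ; assoc   = +-assoc≃
              }
            ; identity = (λ _ → ≃-refl) , +-identityʳ≃
            }
          ; inverse = (λ p → ≃-trans (+-comm≃ (-ₚ p) p) (+-inverseʳ≃ p)) , +-inverseʳ≃
          ; ⁻¹-cong = neg-cong≃
          }
        ; comm = +-comm≃
        }
      ; *-cong     = *-cong≃
      ; *-assoc    = *-assoc≃
      ; *-identity = *-identityˡ≃ , λ p → ≃-trans (*-comm≃ p 1ₚ) (*-identityˡ≃ p)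
      ; distrib    = (λ p r t → ≃-trans (*-comm≃ p (r +ₚ t))
                                 (≃-trans (*-distribʳ≃ p r t) (+-cong≃ (*-comm≃ r p) (*-comm≃ t p))))
                   , *-distribʳ≃
      }
    ; *-comm = *-comm≃
    }
  }

-- Adding `1ₚ` and `-ₚ 1ₚ` gives the list `0ℤ ∷ []` and not `0ₚ`, so the zero test has to accept
-- lists of zeros for the solver to cancel terms.
polyACR : AlmostCommutativeRing 0ℓ 0ℓ
polyACR = fromCommutativeRing polyRing isZero?
  where
  isZero? : ∀ p → Maybe (0ₚ ≃ p)
  isZero? []           = just ≃-refl
  isZero? (ℤ.+ 0 ∷ p)  = Maybe.map (λ e → pointwise λ { zero → refl ; (suc k) → at e k }) (isZero? p)
  isZero? (_ ∷ p)      = nothing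

-- The solver treats `q` as a variable; the constants `q-1` and `1+q` must be expressed through it
-- before it can relate them.
q-1≃ : q-1 ≃ q +ₚ (-ₚ 1ₚ)
q-1≃ = pointwise λ { zero → refl ; (suc zero) → refl ; (suc (suc k)) → refl }

1+q≃ : 1+q ≃ 1ₚ +ₚ q
1+q≃ = pointwise λ { zero → refl ; (suc zero) → refl ; (suc (suc k)) → refl }

coeff-q*-zero : ∀ p → coeff (q *ₚ p) 0 ≡ 0ℤ
coeff-q*-zero p = at (shift-* 1ₚ p) 0

coeff-q*-suc : ∀ p k → coeff (q *ₚ p) (suc k) ≡ coeff p k
coeff-q*-suc p k = trans (at (shift-* 1ₚ p) (suc k)) (at (*-identityˡ≃ p) k)

indicator : ∀ {p} {P : Set p} → Dec P → ℕ
indicator P? = if does P? then 1 else 0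

indicator-true : ∀ {p} {P : Set p} (P? : Dec P) → P → indicator P? ≡ 1
indicator-true P? p rewrite dec-true P? p = refl

indicator-false : ∀ {p} {P : Set p} (P? : Dec P) → ¬ P → indicator P? ≡ 0
indicator-false P? ¬p rewrite dec-false P? ¬p = refl

indicator-cong : ∀ {p r} {P : Set p} {R : Set r} (P? : Dec P) (R? : Dec R) →
                 (P → R) → (R → P) → indicator P? ≡ indicator R?
indicator-cong P? (yes r) f g = indicator-true P? (g r)
indicator-cong P? (no ¬r) f g = indicator-false P? (¬r ∘ f)

module _ {m : ℕ} where

  transpose-ˡ : ∀ (a b : Fin m) → transpose a b ⟨$⟩ʳ a ≡ b
  transpose-ˡ a b rewrite dec-true (a Fin.≟ a) refl = refl

  transpose-≢ : ∀ (a b : Fin m) {x} → x ≢ a → x ≢ b → transpose a b ⟨$⟩ʳ x ≡ x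
  transpose-≢ a b {x} x≢a x≢b
    rewrite dec-false (x Fin.≟ a) x≢a | dec-false (x Fin.≟ b) x≢b = refl

  transpose-ʳ : ∀ (a b : Fin m) → transpose a b ⟨$⟩ʳ b ≡ a
  transpose-ʳ a b with b Fin.≟ a
  ... | yes b≡a = b≡a
  ... | no  b≢a rewrite dec-true (b Fin.≟ b) refl = refl

  data TransposeView (a b x : Fin m) : Set where
    at-ˡ : x ≡ a → transpose a b ⟨$⟩ʳ x ≡ b → TransposeView a b x
    at-ʳ : x ≡ b → transpose a b ⟨$⟩ʳ x ≡ a → TransposeView a b x
    off  : x ≢ a → x ≢ b → transpose a b ⟨$⟩ʳ x ≡ x → TransposeView a b x

  transposeView : ∀ a b x → TransposeView a b x
  transposeView a b x with x Fin.≟ a | x Fin.≟ b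
  ... | yes refl | _        = at-ˡ refl (transpose-ˡ a b)
  ... | no  _    | yes refl = at-ʳ refl (transpose-ʳ a b)
  ... | no  x≢a  | no  x≢b  = off x≢a x≢b (transpose-≢ a b x≢a x≢b)

  transpose-involutive : ∀ a b x → transpose a b ⟨$⟩ʳ (transpose a b ⟨$⟩ʳ x) ≡ x
  transpose-involutive a b x with transposeView a b x
  ... | at-ˡ refl e = trans (cong (transpose a b ⟨$⟩ʳ_) e) (transpose-ʳ a b)
  ... | at-ʳ refl e = trans (cong (transpose a b ⟨$⟩ʳ_) e) (transpose-ˡ a b)
  ... | off _ _ e   = trans (cong (transpose a b ⟨$⟩ʳ_) e) e

  injective : ∀ (w : Permutation′ m) {x y} → w ⟨$⟩ʳ x ≡ w ⟨$⟩ʳ y → x ≡ y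
  injective w e = trans (sym (Perm.inverseˡ w)) (trans (cong (flip w ⟨$⟩ʳ_) e) (Perm.inverseˡ w))

  inversion? : (w : Permutation′ m) (x y : Fin m) → Dec (x < y × w ⟨$⟩ʳ y < w ⟨$⟩ʳ x)
  inversion? w x y = (x Fin.<? y) ×-dec (w ⟨$⟩ʳ y Fin.<? w ⟨$⟩ʳ x)

  inv : Permutation′ m → ℕ
  inv w = sum λ x → sum λ y → indicator (inversion? w x y)

  inv-cong : ∀ u v → u Perm.≈ v → inv u ≡ inv v
  inv-cong u v u≈v = sum-cong-≗ λ x → sum-cong-≗ λ y →
    indicator-cong (inversion? u x y) (inversion? v x y)
      (λ (x<y , d) → x<y , subst₂ _<_ (u≈v y) (u≈v x) d)
      (λ (x<y , d) → x<y , subst₂ _<_ (sym (u≈v y)) (sym (u≈v x)) d)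

  sum-permute₂ : ∀ (g : Fin m → Fin m → ℕ) (π : Permutation′ m) →
                 (sum λ x → sum (g x)) ≡ (sum λ x → sum λ y → g (π ⟨$⟩ʳ x) (π ⟨$⟩ʳ y))
  sum-permute₂ g π = trans (sum-permute (λ x → sum (g x)) π)
                           (sum-cong-≗ λ x → sum-permute (g (π ⟨$⟩ʳ x)) π)

  -- (x, y) is an inversion of w exactly when (w y, w x) is one of w⁻¹, so the sums agree after
  -- reindexing by w.
  inv-flip : ∀ w → inv (flip w) ≡ inv w
  inv-flip w = begin
    (sum λ x → sum λ y → indicator (inversion? (flip w) x y))
      ≡⟨ sum-permute₂ (λ x y → indicator (inversion? (flip w) x y)) w ⟩
    (sum λ x → sum λ y → indicator (inversion? (flip w) (w ⟨$⟩ʳ x) (w ⟨$⟩ʳ y)))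
      ≡⟨ (sum-cong-≗ λ x → sum-cong-≗ λ y →
           indicator-cong (inversion? (flip w) (w ⟨$⟩ʳ x) (w ⟨$⟩ʳ y)) (inversion? w y x)
             (λ (d , e) → subst₂ _<_ (Perm.inverseˡ w) (Perm.inverseˡ w) e , d)
             (λ (e , d) → d , subst₂ _<_ (sym (Perm.inverseˡ w)) (sym (Perm.inverseˡ w)) e)) ⟩
    (sum λ x → sum λ y → indicator (inversion? w y x))
      ≡⟨ ∑-comm (λ x y → indicator (inversion? w y x)) ⟩
    inv w ∎
    where open ≡-Reasoning

sum-indicator : ∀ {m} (a : Fin m) → (sum λ x → indicator (x Fin.≟ a)) ≡ 1
sum-indicator {suc m} Fin.zero    = cong suc (sum-replicate-zero m)
sum-indicator {suc m} (Fin.suc a) = trans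
  (sum-cong-≗ λ x → indicator-cong (Fin.suc x Fin.≟ Fin.suc a) (x Fin.≟ a) Fin.suc-injective (cong Fin.suc))
  (sum-indicator a)

module _ {n : ℕ} where

  private s = simpleTransposition n

  inject₁<suc : ∀ (k : Fin n) → inject₁ k < Fin.suc k
  inject₁<suc k = s≤s (ℕ.≤-reflexive (Fin.toℕ-inject₁ k))

  <suc⇒≤inject₁ : ∀ (k : Fin n) {x : Fin (suc n)} → x < Fin.suc k → x ≢ inject₁ k → x < inject₁ k
  <suc⇒≤inject₁ k (s≤s x≤k) x≢k =
    Fin.≤∧≢⇒< (ℕ.≤-trans x≤k (ℕ.≤-reflexive (sym (Fin.toℕ-inject₁ k)))) x≢k

  inject₁<⇒suc< : ∀ (k : Fin n) {x : Fin (suc n)} → inject₁ k < x → x ≢ Fin.suc k → Fin.suc k < x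
  inject₁<⇒suc< k k<x x≢k+1 =
    Fin.≤∧≢⇒< (ℕ.≤-trans (s≤s (ℕ.≤-reflexive (sym (Fin.toℕ-inject₁ k)))) k<x) (x≢k+1 ∘ sym)

  -- Nothing lies strictly between k and k + 1, so exchanging them reverses no other comparison.
  s-mono-< : ∀ (k : Fin n) {x y} → x < y → ¬ (x ≡ inject₁ k × y ≡ Fin.suc k) → s k ⟨$⟩ʳ x < s k ⟨$⟩ʳ y
  s-mono-< k {x} {y} x<y ¬k with transposeView (inject₁ k) (Fin.suc k) x | transposeView (inject₁ k) (Fin.suc k) y
  ... | at-ˡ refl e | at-ˡ refl e′ = contradiction x<y (ℕ.n≮n _)
  ... | at-ˡ refl e | at-ʳ refl e′ = contradiction (refl , refl) ¬k
  ... | at-ˡ refl e | off _ y≢ e′  = subst₂ _<_ (sym e) (sym e′) (inject₁<⇒suc< k x<y y≢)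
  ... | at-ʳ refl e | at-ˡ refl e′ = subst₂ _<_ (sym e) (sym e′) (inject₁<suc k)
  ... | at-ʳ refl e | at-ʳ refl e′ = contradiction x<y (ℕ.n≮n _)
  ... | at-ʳ refl e | off _ _ e′   = subst₂ _<_ (sym e) (sym e′) (ℕ.<-trans (inject₁<suc k) x<y)
  ... | off _ _ e   | at-ˡ refl e′ = subst₂ _<_ (sym e) (sym e′) (ℕ.<-trans x<y (inject₁<suc k))
  ... | off x≢ _ e  | at-ʳ refl e′ = subst₂ _<_ (sym e) (sym e′) (<suc⇒≤inject₁ k x<y x≢)
  ... | off _ _ e   | off _ _ e′   = subst₂ _<_ (sym e) (sym e′) x<y

  open Group (symmetricGroup (suc n)) using (_∙_)

  s-involutive : ∀ k x → s k ⟨$⟩ʳ (s k ⟨$⟩ʳ x) ≡ x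
  s-involutive k = transpose-involutive (inject₁ k) (Fin.suc k)

  Ascent : Permutation′ (suc n) → Fin n → Set
  Ascent w k = w ⟨$⟩ʳ inject₁ k < w ⟨$⟩ʳ Fin.suc k

  ascent? : ∀ w k → Dec (Ascent w k)
  ascent? w k = w ⟨$⟩ʳ inject₁ k Fin.<? w ⟨$⟩ʳ Fin.suc k

  -- After reindexing by s k, the inversions of w ∙ s k are those of w together
  -- with the pair of positions (k , k + 1), which appears as (k + 1 , k).
  inv-ascent : ∀ w k → Ascent w k → inv (w ∙ s k) ≡ suc (inv w)
  inv-ascent w k asc = begin
    inv (w ∙ s k)
      ≡⟨ (sum-cong-≗ λ x → sum-cong-≗ λ y →
           indicator-cong (inversion? (w ∙ s k) x y) (moved? (s k ⟨$⟩ʳ x) (s k ⟨$⟩ʳ y))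
             (λ (d , e) → subst₂ _<_ (sym (s-involutive k x)) (sym (s-involutive k y)) d , e)
             (λ (d , e) → subst₂ _<_ (s-involutive k x) (s-involutive k y) d , e)) ⟩
    (sum λ x → sum λ y → indicator (moved? (s k ⟨$⟩ʳ x) (s k ⟨$⟩ʳ y)))
      ≡⟨ sum-permute₂ (λ x y → indicator (moved? x y)) (s k) ⟨
    (sum λ x → sum λ y → indicator (moved? x y))
      ≡⟨ (sum-cong-≗ λ x → sum-cong-≗ (entry x)) ⟩
    (sum λ x → sum λ y → indicator (inversion? w x y) + new x y)
      ≡⟨ (sum-cong-≗ λ x → ∑-distrib-+ (λ y → indicator (inversion? w x y)) (new x)) ⟩
    (sum λ x → (sum λ y → indicator (inversion? w x y)) + sum (new x))
      ≡⟨ ∑-distrib-+ (λ x → sum λ y → indicator (inversion? w x y)) (λ x → sum (new x)) ⟩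
    inv w + (sum λ x → sum (new x))
      ≡⟨ cong (inv w +_) (trans (sum-cong-≗ sum-new) (sum-indicator (Fin.suc k))) ⟩
    inv w + 1
      ≡⟨ ℕ.+-comm (inv w) 1 ⟩
    suc (inv w) ∎
    where
    open ≡-Reasoning
    moved? : ∀ x y → Dec (s k ⟨$⟩ʳ x < s k ⟨$⟩ʳ y × w ⟨$⟩ʳ y < w ⟨$⟩ʳ x)
    moved? x y = (s k ⟨$⟩ʳ x Fin.<? s k ⟨$⟩ʳ y) ×-dec (w ⟨$⟩ʳ y Fin.<? w ⟨$⟩ʳ x)

    new : Fin (suc n) → Fin (suc n) → ℕ
    new x y = indicator ((x Fin.≟ Fin.suc k) ×-dec (y Fin.≟ inject₁ k))

    sum-new : ∀ x → sum (new x) ≡ indicator (x Fin.≟ Fin.suc k)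
    sum-new x with x Fin.≟ Fin.suc k
    ... | yes _ = sum-indicator (inject₁ k)
    ... | no _  = sum-replicate-zero (suc n)

    entry′ : ∀ x y (new? : Dec (x ≡ Fin.suc k × y ≡ inject₁ k)) →
                 indicator (moved? x y) ≡ indicator (inversion? w x y) + indicator new?
    entry′ x y (yes (refl , refl)) = trans
      (indicator-true (moved? (Fin.suc k) (inject₁ k))
        ( subst₂ _<_ (sym (transpose-ʳ (inject₁ k) (Fin.suc k))) (sym (transpose-ˡ (inject₁ k) (Fin.suc k))) (inject₁<suc k)
        , asc))
      (cong (_+ 1) (sym (indicator-false (inversion? w (Fin.suc k) (inject₁ k))
        λ (d , _) → ℕ.<-asym d (inject₁<suc k))))
    entry′ x y (no ¬new) = trans
      (indicator-cong (moved? x y) (inversion? w x y)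
        (λ (d , e) → subst₂ _<_ (s-involutive k x) (s-involutive k y)
            (s-mono-< k d λ (p , r) → ¬new
              ( trans (sym (s-involutive k x)) (trans (cong (s k ⟨$⟩ʳ_) p) (transpose-ˡ (inject₁ k) (Fin.suc k)))
              , trans (sym (s-involutive k y)) (trans (cong (s k ⟨$⟩ʳ_) r) (transpose-ʳ (inject₁ k) (Fin.suc k))) )) , e)
        (λ (d , e) → s-mono-< k d (λ { (refl , refl) → ℕ.<-asym e asc }) , e))
      (sym (ℕ.+-identityʳ _))

    entry : ∀ x y → indicator (moved? x y) ≡ indicator (inversion? w x y) + new x y
    entry x y = entry′ x y ((x Fin.≟ Fin.suc k) ×-dec (y Fin.≟ inject₁ k))

-- Coxeter length as number of inversions

module Lengths (n : ℕ) where

  open A n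
  open Group (symmetricGroup (suc n)) using (_∙_; _≈_; ε)

  S : Set
  S = Permutation′ (suc n)

  s : Fin n → S
  s = simpleTransposition n

  s-ˡ : ∀ k → s k ⟨$⟩ʳ inject₁ k ≡ Fin.suc k
  s-ˡ k = transpose-ˡ (inject₁ k) (Fin.suc k)

  s-ʳ : ∀ k → s k ⟨$⟩ʳ Fin.suc k ≡ inject₁ k
  s-ʳ k = transpose-ʳ (inject₁ k) (Fin.suc k)

  s-≢ : ∀ k {x} → x ≢ inject₁ k → x ≢ Fin.suc k → s k ⟨$⟩ʳ x ≡ x
  s-≢ k = transpose-≢ (inject₁ k) (Fin.suc k)

  cancelʳ : ∀ (w : S) k → (w ∙ s k) ∙ s k ≈ w
  cancelʳ w k x = cong (w ⟨$⟩ʳ_) (s-involutive k x)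

  cancelˡ : ∀ k (w : S) → s k ∙ (s k ∙ w) ≈ w
  cancelˡ k w x = s-involutive k (w ⟨$⟩ʳ x)

  ¬Ascent⇒> : ∀ (w : S) k → ¬ Ascent w k → w ⟨$⟩ʳ Fin.suc k < w ⟨$⟩ʳ inject₁ k
  ¬Ascent⇒> w k ¬asc with Fin.<-cmp (w ⟨$⟩ʳ inject₁ k) (w ⟨$⟩ʳ Fin.suc k)
  ... | tri< asc _ _ = contradiction asc ¬asc
  ... | tri≈ _ e _   = contradiction (cong toℕ (injective w e)) (ℕ.<⇒≢ (inject₁<suc k))
  ... | tri> _ _ d   = d

  ¬Ascent⇒Ascent-∙s : ∀ (w : S) k → ¬ Ascent w k → Ascent (w ∙ s k) k
  ¬Ascent⇒Ascent-∙s w k ¬asc = subst₂ _<_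
    (cong (w ⟨$⟩ʳ_) (sym (s-ˡ k))) (cong (w ⟨$⟩ʳ_) (sym (s-ʳ k))) (¬Ascent⇒> w k ¬asc)

  Ascent⇒¬Ascent-∙s : ∀ (w : S) k → Ascent w k → ¬ Ascent (w ∙ s k) k
  Ascent⇒¬Ascent-∙s w k asc asc′ = ℕ.<-asym asc
    (subst₂ _<_ (cong (w ⟨$⟩ʳ_) (s-ˡ k)) (cong (w ⟨$⟩ʳ_) (s-ʳ k)) asc′)

  Ascent-cong : ∀ (u v : S) k → u ≈ v → Ascent u k → Ascent v k
  Ascent-cong u v k u≈v = subst₂ _<_ (u≈v (inject₁ k)) (u≈v (Fin.suc k))

  inv-descent : ∀ (w : S) k → ¬ Ascent w k → suc (inv (w ∙ s k)) ≡ inv w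
  inv-descent w k ¬asc = trans
    (sym (inv-ascent (w ∙ s k) k (¬Ascent⇒Ascent-∙s w k ¬asc)))
    (inv-cong ((w ∙ s k) ∙ s k) w (cancelʳ w k))

  inv-∙s≤ : ∀ (w : S) k → inv (w ∙ s k) ℕ.≤ suc (inv w)
  inv-∙s≤ w k with ascent? w k
  ... | yes asc = ℕ.≤-reflexive (inv-ascent w k asc)
  ... | no ¬asc = ℕ.m≤n⇒m≤1+n (ℕ.≤-trans (ℕ.n≤1+n _) (ℕ.≤-reflexive (inv-descent w k ¬asc)))

  inv≤-∙s : ∀ (w : S) k → inv w ℕ.≤ suc (inv (w ∙ s k))
  inv≤-∙s w k = ℕ.≤-trans
    (ℕ.≤-reflexive (inv-cong w ((w ∙ s k) ∙ s k) (sym ∘ cancelʳ w k))) (inv-∙s≤ (w ∙ s k) k)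

  inv-ε : inv ε ≡ 0
  inv-ε = trans
    (sum-cong-≗ λ x → trans
      (sum-cong-≗ λ y → indicator-false (inversion? ε x y) λ (d , e) → ℕ.<-asym d e)
      (sum-replicate-zero (suc n)))
    (sum-replicate-zero (suc n))

  module _ (w : S) (asc : ∀ k → Ascent w k) where

    private
      bound : ∀ x → Acc _<_ x → toℕ x ℕ.≤ toℕ (w ⟨$⟩ʳ x)
      bound Fin.zero    _        = z≤n
      bound (Fin.suc k) (acc rs) = ℕ.≤-<-trans
        (ℕ.≤-trans (ℕ.≤-reflexive (sym (Fin.toℕ-inject₁ k))) (bound (inject₁ k) (rs (inject₁<suc k))))
        (asc k)

      -- Downward induction: by `bound`, a moved x has w x > x; then w x is already known to be
      -- fixed, and injectivity gives w x = x.
      fixed : ∀ x → Acc Fin._>_ x → w ⟨$⟩ʳ x ≡ x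
      fixed x (acc rs) with w ⟨$⟩ʳ x Fin.≟ x
      ... | yes e = e
      ... | no ¬e = contradiction (injective w (fixed (w ⟨$⟩ʳ x) (rs
              (Fin.≤∧≢⇒< (bound x (Fin.<-wellFounded x)) (¬e ∘ sym))))) ¬e

    noDescent⇒≈ε : w ≈ ε
    noDescent⇒≈ε x = fixed x (Fin.>-wellFounded x)

  descent? : ∀ (w : S) → w ≈ ε ⊎ ∃[ k ] ¬ Ascent w k
  descent? w with Fin.all? (ascent? w)
  ... | yes asc = inj₁ (noDescent⇒≈ε w asc)
  ... | no ¬asc = inj₂ (Fin.¬∀⟶∃¬ n (Ascent w) (ascent? w) ¬asc)

  eval-∷ʳ : ∀ is k → eval (is ++ k ∷ []) ≈ eval is ∙ s k
  eval-∷ʳ []       k x = refl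
  eval-∷ʳ (i ∷ is) k x = cong (s i ⟨$⟩ʳ_) (eval-∷ʳ is k x)

  reducedWord : ∀ m (w : S) → inv w ≡ m → ∃[ is ] (eval is ≈ w × length is ≡ m)
  reducedWord m w e with descent? w
  ... | inj₁ w≈ε = [] , (λ x → sym (w≈ε x)) , trans (sym inv-ε) (trans (inv-cong ε w (sym ∘ w≈ε)) e)
  reducedWord zero    w e | inj₂ (k , ¬asc) = contradiction (trans (inv-descent w k ¬asc) e) λ ()
  reducedWord (suc m) w e | inj₂ (k , ¬asc) =
    let is , eq , len = reducedWord m (w ∙ s k) (ℕ.suc-injective (trans (inv-descent w k ¬asc) e))
    in is ++ k ∷ []
     , (λ x → trans (eval-∷ʳ is k x) (trans (eq (s k ⟨$⟩ʳ x)) (cancelʳ w k x)))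
     , trans (List.length-++ is) (trans (ℕ.+-comm (length is) 1) (cong suc len))

  inv-∙eval≤ : ∀ (w : S) is → inv (w ∙ eval is) ℕ.≤ inv w + length is
  inv-∙eval≤ w []       = ℕ.≤-reflexive (trans (inv-cong (w ∙ eval []) w (λ _ → refl)) (sym (ℕ.+-identityʳ _)))
  inv-∙eval≤ w (i ∷ is) = begin
    inv (w ∙ eval (i ∷ is))       ≡⟨ inv-cong (w ∙ eval (i ∷ is)) ((w ∙ s i) ∙ eval is) (λ _ → refl) ⟩
    inv ((w ∙ s i) ∙ eval is)     ≤⟨ inv-∙eval≤ (w ∙ s i) is ⟩
    inv (w ∙ s i) + length is     ≤⟨ ℕ.+-monoˡ-≤ (length is) (inv-∙s≤ w i) ⟩
    suc (inv w + length is)       ≡⟨ ℕ.+-suc (inv w) (length is) ⟨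
    inv w + length (i ∷ is)       ∎
    where open ℕ.≤-Reasoning

  inv-eval≤ : ∀ is → inv (eval is) ℕ.≤ length is
  inv-eval≤ is = ℕ.≤-trans
    (ℕ.≤-reflexive (inv-cong (eval is) (ε ∙ eval is) (λ _ → refl)))
    (ℕ.≤-trans (inv-∙eval≤ ε is) (ℕ.≤-reflexive (cong (_+ length is) inv-ε)))

  -- Stripping descents yields a word of length `inv w`, and no word is shorter because each letter
  -- raises the number of inversions by at most one.
  hasLength : ∀ w → w HasLength inv w
  hasLength w = reducedWord (inv w) w refl , λ is eq →
    ℕ.≤-trans (ℕ.≤-reflexive (inv-cong w (eval is) (sym ∘ eq))) (inv-eval≤ is)

  hasLength⇒≡inv : ∀ w {a} → w HasLength a → a ≡ inv w
  hasLength⇒≡inv w ((is , eq , refl) , min) = ℕ.≤-antisym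
    (let js , eq′ , len = reducedWord (inv w) w refl
     in ℕ.≤-trans (min js eq′) (ℕ.≤-reflexive len))
    (ℕ.≤-trans (ℕ.≤-reflexive (inv-cong w (eval is) (sym ∘ eq))) (inv-eval≤ is))

  shorter⇒inv< : ∀ u v → u Shorter v → inv u ℕ.< inv v
  shorter⇒inv< u v (a , b , ua , vb , a<b) = subst₂ ℕ._<_ (hasLength⇒≡inv u ua) (hasLength⇒≡inv v vb) a<b

  inv<⇒shorter : ∀ u v → inv u ℕ.< inv v → u Shorter v
  inv<⇒shorter u v lt = inv u , inv v , hasLength u , hasLength v , lt

  ∈D⇒¬Ascent : ∀ w k → k ∈D w → ¬ Ascent w k
  ∈D⇒¬Ascent w k k∈D asc = ℕ.<-asym (shorter⇒inv< (w ∙ s k) w k∈D) (ℕ.≤-reflexive (sym (inv-ascent w k asc)))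

  ¬Ascent⇒∈D : ∀ w k → ¬ Ascent w k → k ∈D w
  ¬Ascent⇒∈D w k ¬asc = inv<⇒shorter (w ∙ s k) w (ℕ.≤-reflexive (inv-descent w k ¬asc))

  transpose-comm : ∀ (a b : Fin (suc n)) → transpose a b ≈ transpose b a
  transpose-comm a b x with transposeView a b x
  ... | at-ˡ refl e  = trans e (sym (transpose-ʳ b x))
  ... | at-ʳ refl e  = trans e (sym (transpose-ˡ x a))
  ... | off x≢a x≢b e = trans e (sym (transpose-≢ b a x≢b x≢a))

  conjugate-transpose : ∀ (w : S) a b x →
    w ⟨$⟩ʳ (transpose a b ⟨$⟩ʳ (flip w ⟨$⟩ʳ x)) ≡ transpose (w ⟨$⟩ʳ a) (w ⟨$⟩ʳ b) ⟨$⟩ʳ x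
  conjugate-transpose w a b x with transposeView (w ⟨$⟩ʳ a) (w ⟨$⟩ʳ b) x
  ... | at-ˡ refl e = trans (cong (λ y → w ⟨$⟩ʳ (transpose a b ⟨$⟩ʳ y)) (Perm.inverseˡ w))
                            (trans (cong (w ⟨$⟩ʳ_) (transpose-ˡ a b)) (sym e))
  ... | at-ʳ refl e = trans (cong (λ y → w ⟨$⟩ʳ (transpose a b ⟨$⟩ʳ y)) (Perm.inverseˡ w))
                            (trans (cong (w ⟨$⟩ʳ_) (transpose-ʳ a b)) (sym e))
  ... | off x≢ x≢′ e = trans (cong (w ⟨$⟩ʳ_) (transpose-≢ a b
                              (λ { refl → x≢ (sym (Perm.inverseʳ w)) }) (λ { refl → x≢′ (sym (Perm.inverseʳ w)) })))
                            (trans (Perm.inverseʳ w) (sym e))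

  -- Induction on b through (a, k+1) = s_k (a, k) s_k. If the first s_k adds an inversion, the last
  -- one can at most take it back; if it removes one, the last one restores it.
  inv-transpose : ∀ (u : S) a b → a < b → u ⟨$⟩ʳ a < u ⟨$⟩ʳ b → inv u ℕ.< inv (u ∙ transpose a b)
  inv-transpose u a b = go u b (Fin.<-wellFounded b)
    where
    go : ∀ u b → Acc _<_ b → a < b → u ⟨$⟩ʳ a < u ⟨$⟩ʳ b → inv u ℕ.< inv (u ∙ transpose a b)
    go u (Fin.suc k) (acc rs) a<b ua<ub with a Fin.≟ inject₁ k
    ... | yes refl = ℕ.≤-reflexive (sym (inv-ascent u k ua<ub))
    ... | no a≢k   = case ascent? u k of λ
      { (yes asc) → ℕ.s≤s⁻¹ (begin-strict
          suc (inv u)           ≡⟨ inv-ascent u k asc ⟨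
          inv (u ∙ s k)         <⟨ ih ⟩
          inv u′                ≤⟨ inv≤-∙s u′ k ⟩
          suc (inv (u′ ∙ s k))  ≡⟨ cong suc final ⟩
          suc (inv (u ∙ transpose a (Fin.suc k))) ∎)
      ; (no ¬asc) → begin-strict
          inv u                 ≡⟨ inv-descent u k ¬asc ⟨
          suc (inv (u ∙ s k))   <⟨ s≤s ih ⟩
          -- `u′` has the values u a at k and u k at k + 1, and u a < u (k + 1) < u k.
          suc (inv u′)          ≡⟨ inv-ascent u′ k (subst₂ _<_
                                     (sym (trans (cong (λ x → u ⟨$⟩ʳ (s k ⟨$⟩ʳ x)) (transpose-ʳ a (inject₁ k))) (cong (u ⟨$⟩ʳ_) sa)))
                                     (sym (trans (cong (λ x → u ⟨$⟩ʳ (s k ⟨$⟩ʳ x)) (transpose-≢ a (inject₁ k) (≢-sym a≢k+1) (≢-sym k≢k+1))) (cong (u ⟨$⟩ʳ_) (s-ʳ k))))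
                                     (ℕ.<-trans ua<ub (¬Ascent⇒> u k ¬asc))) ⟨
          inv (u′ ∙ s k)        ≡⟨ final ⟩
          inv (u ∙ transpose a (Fin.suc k)) ∎
      }
      where
      open ℕ.≤-Reasoning
      u′ : S
      u′ = (u ∙ s k) ∙ transpose a (inject₁ k)

      a≢k+1 : a ≢ Fin.suc k
      a≢k+1 = Fin.<⇒≢ a<b

      k≢k+1 : inject₁ k ≢ Fin.suc k
      k≢k+1 = Fin.<⇒≢ (inject₁<suc k)

      sa : s k ⟨$⟩ʳ a ≡ a
      sa = s-≢ k a≢k a≢k+1

      ih : inv (u ∙ s k) ℕ.< inv u′
      ih = go (u ∙ s k) (inject₁ k) (rs (inject₁<suc k)) (<suc⇒≤inject₁ k a<b a≢k)
        (subst₂ _<_ (cong (u ⟨$⟩ʳ_) (sym sa)) (cong (u ⟨$⟩ʳ_) (sym (s-ˡ k))) ua<ub)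

      final : inv (u′ ∙ s k) ≡ inv (u ∙ transpose a (Fin.suc k))
      final = inv-cong (u′ ∙ s k) (u ∙ transpose a (Fin.suc k)) λ x → cong (u ⟨$⟩ʳ_)
        (trans (cong (λ y → s k ⟨$⟩ʳ (transpose a (inject₁ k) ⟨$⟩ʳ y)) (sym (transpose-comm (Fin.suc k) (inject₁ k) x)))
        (trans (conjugate-transpose (s k) a (inject₁ k) x)
               (cong₂ (λ y z → transpose y z ⟨$⟩ʳ x) sa (s-ˡ k))))

-- Bruhat order: lifting property, decidability, finite intervals

module Bruhat (n : ℕ) where

  open Lengths n
  open A n
  open Group (symmetricGroup (suc n)) using (_∙_; _≈_; ε; setoid)

  infix 4 _≈?_
  _≈?_ : ∀ (u v : S) → Dec (u ≈ v)
  u ≈? v = Fin.all? λ x → u ⟨$⟩ʳ x Fin.≟ v ⟨$⟩ʳ x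

  reflection⇒transpose : ∀ t → Reflection t → ∃[ a ] ∃[ b ] (a < b × t ≈ transpose a b)
  reflection⇒transpose t (w , i , eq) with Fin.<-cmp (w ⟨$⟩ʳ inject₁ i) (w ⟨$⟩ʳ Fin.suc i)
  ... | tri< lt _ _ = _ , _ , lt , λ x → trans (eq x) (conjugate-transpose w (inject₁ i) (Fin.suc i) x)
  ... | tri≈ _ e _  = contradiction (cong toℕ (injective w e)) (ℕ.<⇒≢ (inject₁<suc i))
  ... | tri> _ _ gt = _ , _ , gt , λ x → trans (eq x)
    (trans (conjugate-transpose w (inject₁ i) (Fin.suc i) x) (transpose-comm _ _ x))

  reflection-s : ∀ k → Reflection (s k)
  reflection-s k = ε , k , λ _ → refl

  reflection-conjugate : ∀ k t → Reflection t → Reflection (s k ∙ (t ∙ s k))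
  reflection-conjugate k t (w , i , eq) = s k ∙ w , i , λ x → cong (s k ⟨$⟩ʳ_)
    (trans (eq (s k ⟨$⟩ʳ x)) (cong (λ y → w ⟨$⟩ʳ (s i ⟨$⟩ʳ (flip w ⟨$⟩ʳ y)))
      (transpose-comm (inject₁ k) (Fin.suc k) x)))

  conjugate-s : ∀ k t a b → t ≈ transpose a b → s k ∙ (t ∙ s k) ≈ transpose (s k ⟨$⟩ʳ a) (s k ⟨$⟩ʳ b)
  conjugate-s k t a b eq x = trans
    (cong (s k ⟨$⟩ʳ_) (trans (eq (s k ⟨$⟩ʳ x)) (cong (transpose a b ⟨$⟩ʳ_) (transpose-comm (inject₁ k) (Fin.suc k) x))))
    (conjugate-transpose (s k) a b x)

  shorter⇒< : ∀ u t a b → a < b → t ≈ transpose a b → u Shorter (u ∙ t) → u ⟨$⟩ʳ a < u ⟨$⟩ʳ b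
  shorter⇒< u t a b a<b eq sh with Fin.<-cmp (u ⟨$⟩ʳ a) (u ⟨$⟩ʳ b)
  ... | tri< lt _ _ = lt
  ... | tri≈ _ e _  = contradiction (cong toℕ (injective u e)) (ℕ.<⇒≢ a<b)
  ... | tri> _ _ gt = contradiction (begin-strict
      inv u                             <⟨ shorter⇒inv< u (u ∙ t) sh ⟩
      inv (u ∙ t)                       <⟨ inv-transpose (u ∙ t) a b a<b (subst₂ _<_
                                             (cong (u ⟨$⟩ʳ_) (sym (trans (eq a) (transpose-ˡ a b))))
                                             (cong (u ⟨$⟩ʳ_) (sym (trans (eq b) (transpose-ʳ a b)))) gt) ⟩
      inv ((u ∙ t) ∙ transpose a b)     ≡⟨ inv-cong ((u ∙ t) ∙ transpose a b) u (λ x → cong (u ⟨$⟩ʳ_)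
                                             (trans (eq (transpose a b ⟨$⟩ʳ x)) (transpose-involutive a b x))) ⟩
      inv u                             ∎) (ℕ.n≮n _)
    where open ℕ.≤-Reasoning

  <⇒shorter : ∀ u t a b → a < b → t ≈ transpose a b → u ⟨$⟩ʳ a < u ⟨$⟩ʳ b → u Shorter (u ∙ t)
  <⇒shorter u t a b a<b eq lt = inv<⇒shorter u (u ∙ t) (ℕ.<-≤-trans (inv-transpose u a b a<b lt)
    (ℕ.≤-reflexive (inv-cong (u ∙ transpose a b) (u ∙ t) (λ x → cong (u ⟨$⟩ʳ_) (sym (eq x))))))

  shorter-cong : ∀ u u′ v v′ → u ≈ u′ → v ≈ v′ → u Shorter v → u′ Shorter v′
  shorter-cong u u′ v v′ e f sh = inv<⇒shorter u′ v′
    (subst₂ ℕ._<_ (inv-cong u u′ e) (inv-cong v v′ f) (shorter⇒inv< u v sh))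

  ≤-respˡ : ∀ u u′ {v} → u ≈ u′ → u ≤ᴮ v → u′ ≤ᴮ v
  ≤-respˡ u u′ e (done u≈v)          = done λ x → trans (sym (e x)) (u≈v x)
  ≤-respˡ u u′ e (step {t} r sh u∙t≤v) =
    step {t = t} r (shorter-cong u u′ (u ∙ t) (u′ ∙ t) e (λ x → e (t ⟨$⟩ʳ x)) sh)
           (≤-respˡ (u ∙ t) (u′ ∙ t) (λ x → e (t ⟨$⟩ʳ x)) u∙t≤v)

  ≤-trans : ∀ {u v w} → u ≤ᴮ v → v ≤ᴮ w → u ≤ᴮ w
  ≤-trans {u} {v} (done u≈v)    v≤w = ≤-respˡ v u (λ x → sym (u≈v x)) v≤w
  ≤-trans         (step {t} r sh p) v≤w = step {t = t} r sh (≤-trans p v≤w)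

  ≤-refl : ∀ u → u ≤ᴮ u
  ≤-refl u = done λ _ → refl

  ≤-respʳ : ∀ {u} v v′ → v ≈ v′ → u ≤ᴮ v → u ≤ᴮ v′
  ≤-respʳ v v′ e u≤v = ≤-trans u≤v (done e)

  ≤⇒inv≤ : ∀ {u v} → u ≤ᴮ v → inv u ℕ.≤ inv v
  ≤⇒inv≤ {u} {v} (done e)          = ℕ.≤-reflexive (inv-cong u v e)
  ≤⇒inv≤ {u}     (step {t} r sh p) = ℕ.≤-trans (ℕ.<⇒≤ (shorter⇒inv< u (u ∙ t) sh)) (≤⇒inv≤ p)

  ≤∧≉⇒inv< : ∀ {u v} → u ≤ᴮ v → ¬ u ≈ v → inv u ℕ.< inv v
  ≤∧≉⇒inv<     (done e)          u≉v = contradiction e u≉v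
  ≤∧≉⇒inv< {u} (step {t} r sh p) u≉v = ℕ.<-≤-trans (shorter⇒inv< u (u ∙ t) sh) (≤⇒inv≤ p)

  ≤ε⇒≈ε : ∀ {u} → u ≤ᴮ ε → u ≈ ε
  ≤ε⇒≈ε {u} u≤ε with u ≈? ε
  ... | yes e = e
  ... | no ¬e = contradiction (ℕ.<-≤-trans (≤∧≉⇒inv< u≤ε ¬e) (ℕ.≤-reflexive inv-ε)) λ ()

  ascent⇒≤ : ∀ v k → Ascent v k → v ≤ᴮ v ∙ s k
  ascent⇒≤ v k asc = step {t = s k} (reflection-s k)
    (inv<⇒shorter v (v ∙ s k) (ℕ.≤-reflexive (sym (inv-ascent v k asc)))) (≤-refl (v ∙ s k))

  private
    module _ (u t : S) (k : Fin n) (r : Reflection t) (sh : u Shorter (u ∙ t)) where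

      conjugated : ∀ a b → a < b → t ≈ transpose a b → ¬ (a ≡ inject₁ k × b ≡ Fin.suc k) →
                   ∀ {v} → (u ∙ t) ∙ s k ≤ᴮ v → u ∙ s k ≤ᴮ v
      conjugated a b a<b t≈ ¬k p = step {t = s k ∙ (t ∙ s k)} (reflection-conjugate k t r)
        (<⇒shorter (u ∙ s k) (s k ∙ (t ∙ s k)) _ _ (s-mono-< k a<b ¬k) (conjugate-s k t a b t≈)
          (subst₂ _<_ (cong (u ⟨$⟩ʳ_) (sym (s-involutive k a))) (cong (u ⟨$⟩ʳ_) (sym (s-involutive k b)))
            (shorter⇒< u t a b a<b t≈ sh)))
        (≤-respˡ ((u ∙ t) ∙ s k) ((u ∙ s k) ∙ (s k ∙ (t ∙ s k)))
          (λ x → cong (u ⟨$⟩ʳ_) (sym (s-involutive k (t ⟨$⟩ʳ (s k ⟨$⟩ʳ x))))) p)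

  -- A step u < u ∙ t of the Bruhat order is carried by s k to the step
  -- u ∙ s k < u ∙ t ∙ s k of the conjugate reflection, unless t is s k itself.
  conjugate-step : ∀ u t k → Reflection t → u Shorter (u ∙ t) →
                   t ≈ s k ⊎ (∀ {v} → (u ∙ t) ∙ s k ≤ᴮ v → u ∙ s k ≤ᴮ v)
  conjugate-step u t k r sh with reflection⇒transpose t r
  ... | a , b , a<b , t≈ with a Fin.≟ inject₁ k | b Fin.≟ Fin.suc k
  ... | yes refl | yes refl = inj₁ t≈
  ... | yes _    | no b≢    = inj₂ (conjugated u t k r sh a b a<b t≈ (b≢ ∘ proj₂))
  ... | no a≢    | _        = inj₂ (conjugated u t k r sh a b a<b t≈ (a≢ ∘ proj₁))

  ∙s-mono : ∀ {u v} k → Ascent v k → u ≤ᴮ v → u ∙ s k ≤ᴮ v ∙ s k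
  ∙s-mono k asc (done e) = done λ x → e (s k ⟨$⟩ʳ x)
  ∙s-mono {u} {v} k asc (step {t} r sh p) with conjugate-step u t k r sh
  ... | inj₁ t≈s = ≤-trans (≤-respˡ (u ∙ t) (u ∙ s k) (λ x → cong (u ⟨$⟩ʳ_) (t≈s x)) p) (ascent⇒≤ v k asc)
  ... | inj₂ f   = f (∙s-mono k asc p)

  -- The alternative is carried down the chain by `conjugate-step`; a step by s k itself turns its
  -- second case into the first, since then u t s = u.
  ≤∙s⇒ : ∀ {u} v k → u ≤ᴮ v ∙ s k → u ≤ᴮ v ⊎ u ∙ s k ≤ᴮ v
  ≤∙s⇒ {u} v k (done e) = inj₂ (done λ x → trans (e (s k ⟨$⟩ʳ x)) (cancelʳ v k x))
  ≤∙s⇒ {u} v k (step {t} r sh p) with ≤∙s⇒ v k p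
  ... | inj₁ ut≤v = inj₁ (step {t = t} r sh ut≤v)
  ... | inj₂ uts≤v with conjugate-step u t k r sh
  ...   | inj₁ t≈s = inj₁ (≤-respˡ ((u ∙ t) ∙ s k) u
            (λ x → cong (u ⟨$⟩ʳ_) (trans (t≈s (s k ⟨$⟩ʳ x)) (s-involutive k x))) uts≤v)
  ...   | inj₂ f   = inj₂ (f uts≤v)

  ⇒≤∙s : ∀ {u} v k → Ascent v k → u ≤ᴮ v ⊎ u ∙ s k ≤ᴮ v → u ≤ᴮ v ∙ s k
  ⇒≤∙s v k asc (inj₁ u≤v) = ≤-trans u≤v (ascent⇒≤ v k asc)
  ⇒≤∙s {u} v k asc (inj₂ us≤v) = ≤-respˡ ((u ∙ s k) ∙ s k) u (cancelʳ u k) (∙s-mono k asc us≤v)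

  open Membership setoid using (_∈_)

  -- By the lifting property the lower set of v is that of v s together with its translate by s, for
  -- any descent s of v. This list makes the order decidable, although its definition searches over
  -- chains of reflections.
  ideal : ∀ m v → inv v ≡ m → ∃[ us ] (∀ u → u ≤ᴮ v ⇔ u ∈ us)
  ideal m v e with descent? v
  ... | inj₁ v≈ε = ε ∷ [] , λ u → mk⇔
    (λ u≤v → here (≤ε⇒≈ε (≤-respʳ v ε v≈ε u≤v)))
    (λ { (here u≈ε) → done λ x → trans (u≈ε x) (sym (v≈ε x)) ; (there ()) })
  ideal zero    v e | inj₂ (k , ¬asc) = contradiction (trans (inv-descent v k ¬asc) e) λ ()
  ideal (suc m) v e | inj₂ (k , ¬asc) with ideal m (v ∙ s k) (ℕ.suc-injective (trans (inv-descent v k ¬asc) e))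
  ... | us , ih = us ++ map (_∙ s k) us , λ u → mk⇔
    (λ u≤v → case ≤∙s⇒ (v ∙ s k) k (≤-respʳ v ((v ∙ s k) ∙ s k) (λ x → sym (cancelʳ v k x)) u≤v) of λ
      { (inj₁ p) → ∈ₚ.∈-++⁺ˡ setoid {v = u} (Equivalence.to (ih u) p)
      ; (inj₂ p) → ∈ₚ.∈-++⁺ʳ setoid {v = u} us (∈ₚ.∈-resp-≈ setoid {x = (u ∙ s k) ∙ s k} {y = u} (cancelʳ u k)
                     (∈ₚ.∈-map⁺ setoid setoid {f = _∙ s k} (λ {x} {y} e z → e (s k ⟨$⟩ʳ z)) {v = u ∙ s k}
                       (Equivalence.to (ih (u ∙ s k)) p))) })
    (λ u∈ → ≤-respʳ ((v ∙ s k) ∙ s k) v (cancelʳ v k)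
      (⇒≤∙s (v ∙ s k) k (¬Ascent⇒Ascent-∙s v k ¬asc) (case ∈ₚ.∈-++⁻ setoid {v = u} us u∈ of λ
        { (inj₁ p) → inj₁ (Equivalence.from (ih u) p)
        ; (inj₂ p) → let u′ , u′∈ , e = ∈ₚ.∈-map⁻ setoid setoid {v = u} {f = _∙ s k} p
                     in inj₂ (≤-respˡ u′ (u ∙ s k) (λ x → trans (sym (cancelʳ u′ k x)) (sym (e (s k ⟨$⟩ʳ x))))
                               (Equivalence.from (ih u′) u′∈)) })))

  infix 4 _≤?_
  _≤?_ : ∀ u v → Dec (u ≤ᴮ v)
  u ≤? v with ideal (inv v) v refl
  ... | us , ih = map′ (Equivalence.from (ih u)) (Equivalence.to (ih u)) (any? (u ≈?_) us)

  decSetoid : DecSetoid _ _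
  decSetoid = record
    { Carrier = S ; _≈_ = _≈_
    ; isDecEquivalence = record
      { isEquivalence = Group.isEquivalence (symmetricGroup (suc n)) ; _≟_ = _≈?_ } }

  interval : ∀ u v → ∃[ as ] EnumeratesInterval as u v
  interval u v with ideal (inv v) v refl
  ... | us , ih = filter (u ≤?_) (deduplicate _≈?_ us)
    , !ₚ.filter⁺ setoid (u ≤?_) (!ₚ.deduplicate-! decSetoid us)
    , λ a → mk⇔
      (λ a∈ → let a∈us , u≤a = ∈ₚ.∈-filter⁻ setoid (u ≤?_) (λ {a} {b} → ≤-respʳ a b) {v = a} a∈
              in u≤a , Equivalence.from (ih a) (∈ₚ.∈-deduplicate⁻ setoid _≈?_ us {z = a} a∈us))
      (λ (u≤a , a≤v) → ∈ₚ.∈-filter⁺ setoid (u ≤?_) (λ {a} {b} → ≤-respʳ a b) {v = a}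
        (∈ₚ.∈-deduplicate⁺ setoid _≈?_ (λ {x} {y} {z} e f w → trans (f w) (sym (e w))) {z = a}
          (Equivalence.to (ih a) a≤v)) u≤a)

-- Subgroups generated by the later generators

module Parabolic (n : ℕ) where

  open Lengths n
  open Bruhat n
  open A n
  open Group (symmetricGroup (suc n)) using (_∙_; _≈_; ε)

  -- The parabolic subgroup generated by the s i with i ≥ k, described by its action on points
  -- instead of by words.
  W : ℕ → S → Set
  W k w = ∀ x → toℕ x ℕ.< k → w ⟨$⟩ʳ x ≡ x

  W? : ∀ k w → Dec (W k w)
  W? k w = Fin.all? λ x → (toℕ x ℕ.<? k) →-dec (w ⟨$⟩ʳ x Fin.≟ x)

  W-cong : ∀ {k} u v → u ≈ v → W k u → W k v
  W-cong u v e u∈W x x<k = trans (sym (e x)) (u∈W x x<k)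

  W-mono : ∀ {k} w → W (suc k) w → W k w
  W-mono w w∈W x x<k = w∈W x (ℕ.m<n⇒m<1+n x<k)

  W-∙ : ∀ {k} u v → W k u → W k v → W k (u ∙ v)
  W-∙ u v u∈W v∈W x x<k = trans (cong (u ⟨$⟩ʳ_) (v∈W x x<k)) (u∈W x x<k)

  W-flip : ∀ {k} w → W k w → W k (flip w)
  W-flip w w∈W x x<k = trans (cong (flip w ⟨$⟩ʳ_) (sym (w∈W x x<k))) (Perm.inverseˡ w)

  W-s : ∀ {k} i → k ℕ.≤ toℕ i → W k (s i)
  W-s i k≤i x x<k = s-≢ i
    (λ { refl → ℕ.<⇒≱ x<k (ℕ.≤-trans k≤i (ℕ.≤-reflexive (sym (Fin.toℕ-inject₁ i)))) })
    (λ { refl → ℕ.<⇒≱ x<k (ℕ.m≤n⇒m≤1+n k≤i) })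

  W-≥ : ∀ {k} w → W k w → ∀ {x} → k ℕ.≤ toℕ x → k ℕ.≤ toℕ (w ⟨$⟩ʳ x)
  W-≥ w w∈W {x} k≤x = ℕ.≮⇒≥ λ wx<k → ℕ.<⇒≱ (subst (λ y → toℕ y ℕ.< _) (injective w (w∈W _ wx<k)) wx<k) k≤x

  -- A step by t = (a, b) into `W k` moves no position below k. If a < k, then u b = a, so u a < a
  -- is a fixed point of u t below k, which forces u a = b and b < a. If also b < k, then u a = b
  -- and u b = a contradict u a < u b.
  W-≤ : ∀ {k u w} → u ≤ᴮ w → W k w → W k u
  W-≤ {k} {u} {w} (done e) w∈W = W-cong w u (sym ∘ e) w∈W
  W-≤ {k} {u} {w} (step {t} r sh p) w∈W = u∈W
    where
    ut∈W : W k (u ∙ t)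
    ut∈W = W-≤ p w∈W

    u∈W : W k u
    u∈W x x<k with reflection⇒transpose t r
    ... | a , b , a<b , t≈ = at-x (transposeView a b x)
      where
      ua<ub : u ⟨$⟩ʳ a < u ⟨$⟩ʳ b
      ua<ub = shorter⇒< u t a b a<b t≈ sh

      uta : (u ∙ t) ⟨$⟩ʳ a ≡ u ⟨$⟩ʳ b
      uta = cong (u ⟨$⟩ʳ_) (trans (t≈ a) (transpose-ˡ a b))

      utb : (u ∙ t) ⟨$⟩ʳ b ≡ u ⟨$⟩ʳ a
      utb = cong (u ⟨$⟩ʳ_) (trans (t≈ b) (transpose-ʳ a b))

      at-x : TransposeView a b x → u ⟨$⟩ʳ x ≡ x
      at-x (at-ˡ refl _) = contradiction
        (ℕ.<-trans (subst₂ _<_ (trans (sym utb) utb≡b) ub≡a ua<ub) a<b) (ℕ.n≮n _)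
        where
        ub≡a : u ⟨$⟩ʳ b ≡ a
        ub≡a = trans (sym uta) (ut∈W a x<k)
        utb≡b : (u ∙ t) ⟨$⟩ʳ b ≡ b
        utb≡b = trans utb (injective (u ∙ t) (trans
          (ut∈W (u ⟨$⟩ʳ a) (ℕ.<-trans (subst (u ⟨$⟩ʳ a <_) ub≡a ua<ub) x<k)) (sym utb)))
      at-x (at-ʳ refl _) = contradiction
        (subst₂ _<_ (trans (sym utb) (ut∈W b x<k)) (trans (sym uta) (ut∈W a (ℕ.<-trans a<b x<k))) ua<ub)
        (ℕ.<-asym a<b)
      at-x (off x≢a x≢b e) = trans (cong (u ⟨$⟩ʳ_) (sym (trans (t≈ x) e))) (ut∈W x x<k)

  -- If i < k, then w fixes i, so w (i+1) < i lies below k and is fixed too; hence it equals i + 1,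
  -- which is absurd.
  W-descent : ∀ {k} w i → W k w → ¬ Ascent w i → k ℕ.≤ toℕ i
  W-descent {k} w i w∈W ¬asc = ℕ.≮⇒≥ λ i<k →
    let i<k′ = subst (ℕ._< k) (sym (Fin.toℕ-inject₁ i)) i<k
        lt   = subst (w ⟨$⟩ʳ Fin.suc i <_) (w∈W (inject₁ i) i<k′) (¬Ascent⇒> w i ¬asc)
        eq   = injective w (w∈W (w ⟨$⟩ʳ Fin.suc i) (ℕ.<-trans lt i<k′))
    in ℕ.<-asym (subst (_< inject₁ i) eq lt) (inject₁<suc i)

  -- Induction on length inside the subgroup: by `W-descent` every descent of an element of `W k` is
  -- a generator of `W k`, so stripping it stays inside. `resp` is required because stripped words
  -- give w back only up to `_≈_`.
  W-rec : ∀ {ℓ} k (M : S → Set ℓ) → (∀ u v → u ≈ v → M u → M v) → M ε →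
          (∀ w i → W k w → k ℕ.≤ toℕ i → Ascent w i → M w → M (w ∙ s i)) →
          ∀ w → W k w → M w
  W-rec k M resp base ind w = go (inv w) w refl
    where
    go : ∀ m w → inv w ≡ m → W k w → M w
    go m w e w∈W with descent? w
    ... | inj₁ w≈ε = resp ε w (sym ∘ w≈ε) base
    go zero    w e w∈W | inj₂ (i , ¬asc) = contradiction (trans (inv-descent w i ¬asc) e) λ ()
    go (suc m) w e w∈W | inj₂ (i , ¬asc) = resp ((w ∙ s i) ∙ s i) w (cancelʳ w i)
      (ind (w ∙ s i) i ws∈W k≤i (¬Ascent⇒Ascent-∙s w i ¬asc)
        (go m (w ∙ s i) (ℕ.suc-injective (trans (inv-descent w i ¬asc) e)) ws∈W))
      where
      k≤i : k ℕ.≤ toℕ i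
      k≤i = W-descent w i w∈W ¬asc
      ws∈W : W k (w ∙ s i)
      ws∈W = W-∙ w (s i) w∈W (W-s i k≤i)

  -- The subgroup of the generators after s k. Multiplying one of its elements by s k, on either
  -- side, raises the length by one.
  W⁺ : Fin n → S → Set
  W⁺ k = W (suc (toℕ k))

  W⁺-fix : ∀ k w → W⁺ k w → w ⟨$⟩ʳ inject₁ k ≡ inject₁ k
  W⁺-fix k w w∈W = w∈W (inject₁ k) (inject₁<suc k)

  W⁺-ascent : ∀ k w → W⁺ k w → Ascent w k
  W⁺-ascent k w w∈W = subst (_< w ⟨$⟩ʳ Fin.suc k) (sym (W⁺-fix k w w∈W))
    (ℕ.≤-trans (inject₁<suc k) (W-≥ w w∈W ℕ.≤-refl))

  s∙∉W⁺ : ∀ k w → W⁺ k w → ¬ W⁺ k (s k ∙ w)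
  s∙∉W⁺ k w w∈W sw∈W = Fin.<⇒≢ (inject₁<suc k)
    (trans (sym (W⁺-fix k (s k ∙ w) sw∈W)) (trans (cong (s k ⟨$⟩ʳ_) (W⁺-fix k w w∈W)) (s-ˡ k)))

  ∙s∉W⁺ : ∀ k w → W⁺ k w → ¬ W⁺ k (w ∙ s k)
  ∙s∉W⁺ k w w∈W ws∈W = Ascent⇒¬Ascent-∙s w k (W⁺-ascent k w w∈W) (W⁺-ascent k (w ∙ s k) ws∈W)

  W⁺≢ : ∀ k w → W⁺ k w → ∀ {x} → inject₁ k < x → w ⟨$⟩ʳ x ≢ inject₁ k
  W⁺≢ k w w∈W {x} k<x e = ℕ.<⇒≢
    (W-≥ w w∈W (subst (ℕ._< toℕ x) (Fin.toℕ-inject₁ k) k<x))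
    (sym (trans (cong toℕ e) (Fin.toℕ-inject₁ k)))

  private
    k<i⇒ : ∀ (k i : Fin n) → k < i → inject₁ k < inject₁ i
    k<i⇒ k i = subst₂ ℕ._<_ (sym (Fin.toℕ-inject₁ k)) (sym (Fin.toℕ-inject₁ i))

  s∙-ascent : ∀ k w i → W⁺ k w → k < i → Ascent w i → Ascent (s k ∙ w) i
  s∙-ascent k w i w∈W k<i asc = s-mono-< k asc λ (e , _) → W⁺≢ k w w∈W (k<i⇒ k i k<i) e

  s∙-descent : ∀ k w i → W⁺ k w → k < i → ¬ Ascent w i → ¬ Ascent (s k ∙ w) i
  s∙-descent k w i w∈W k<i ¬asc asc = ℕ.<-asym asc
    (s-mono-< k (¬Ascent⇒> w i ¬asc) λ (e , _) → W⁺≢ k w w∈W (ℕ.<-trans (k<i⇒ k i k<i) (inject₁<suc i)) e)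

  s∙-commute : ∀ k w → W (suc (suc (toℕ k))) w → s k ∙ w ≈ w ∙ s k
  s∙-commute k w w∈W x with transposeView (inject₁ k) (Fin.suc k) x
  ... | at-ˡ refl e = trans (cong (s k ⟨$⟩ʳ_) (W⁺-fix k w (W-mono w w∈W))) (trans e (sym (trans (cong (w ⟨$⟩ʳ_) e) (w∈W (Fin.suc k) ℕ.≤-refl))))
  ... | at-ʳ refl e = trans (cong (s k ⟨$⟩ʳ_) (w∈W (Fin.suc k) ℕ.≤-refl)) (trans e (sym (trans (cong (w ⟨$⟩ʳ_) e) (W⁺-fix k w (W-mono w w∈W)))))
  ... | off x≢ x≢′ e = trans
    (s-≢ k (λ p → x≢ (injective w (trans p (sym (W⁺-fix k w (W-mono w w∈W))))))
           (λ p → x≢′ (injective w (trans p (sym (w∈W (Fin.suc k) ℕ.≤-refl))))))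
    (cong (w ⟨$⟩ʳ_) (sym e))

  inv-s∙ : ∀ k w → W⁺ k w → inv (s k ∙ w) ≡ suc (inv w)
  inv-s∙ k w w∈W = begin
    inv (s k ∙ w)         ≡⟨ inv-flip (s k ∙ w) ⟨
    inv (flip (s k ∙ w))  ≡⟨ inv-cong (flip (s k ∙ w)) (flip w ∙ s k)
                               (λ x → cong (flip w ⟨$⟩ʳ_) (transpose-comm (Fin.suc k) (inject₁ k) x)) ⟩
    inv (flip w ∙ s k)    ≡⟨ inv-ascent (flip w) k (W⁺-ascent k (flip w) (W-flip w w∈W)) ⟩
    suc (inv (flip w))    ≡⟨ cong suc (inv-flip w) ⟩
    suc (inv w)           ∎
    where open ≡-Reasoning

  -- The lifting property on the left. Building v up by right factors lets the right-hand lifting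
  -- property do the work, because left and right multiplication commute; at v = ε the two sides
  -- coincide.
  ≤s∙⇔ : ∀ k v → W⁺ k v → ∀ u →
         (u ≤ᴮ s k ∙ v → u ≤ᴮ v ⊎ s k ∙ u ≤ᴮ v) × (u ≤ᴮ v ⊎ s k ∙ u ≤ᴮ v → u ≤ᴮ s k ∙ v)
  ≤s∙⇔ k = W-rec (suc (toℕ k)) M resp base ind
    where
    M : S → Set
    M v = ∀ u → (u ≤ᴮ s k ∙ v → u ≤ᴮ v ⊎ s k ∙ u ≤ᴮ v) × (u ≤ᴮ v ⊎ s k ∙ u ≤ᴮ v → u ≤ᴮ s k ∙ v)

    resp : ∀ v v′ → v ≈ v′ → M v → M v′
    resp v v′ e m u =
        (λ p → Sum.map (≤-respʳ v v′ e) (≤-respʳ v v′ e)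
          (proj₁ (m u) (≤-respʳ (s k ∙ v′) (s k ∙ v) (λ x → cong (s k ⟨$⟩ʳ_) (sym (e x))) p)))
      , (λ p → ≤-respʳ (s k ∙ v) (s k ∙ v′) (λ x → cong (s k ⟨$⟩ʳ_) (e x))
          (proj₂ (m u) (Sum.map (≤-respʳ v′ v (sym ∘ e)) (≤-respʳ v′ v (sym ∘ e)) p)))

    commutes : ∀ u → u ∙ s k ≈ ε → s k ∙ u ≈ ε
    commutes u e x = trans (cong (λ y → s k ⟨$⟩ʳ (u ⟨$⟩ʳ y)) (sym (s-involutive k x)))
                           (trans (cong (s k ⟨$⟩ʳ_) (e (s k ⟨$⟩ʳ x))) (s-involutive k x))

    commutes′ : ∀ u → s k ∙ u ≈ ε → u ∙ s k ≈ ε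
    commutes′ u e x = trans (sym (s-involutive k _)) (trans (cong (s k ⟨$⟩ʳ_) (e (s k ⟨$⟩ʳ x))) (s-involutive k x))

    base : M ε
    base u =
        (λ p → Sum.map₂ (λ us≤ε → done (commutes u (≤ε⇒≈ε us≤ε)))
          (≤∙s⇒ ε k (≤-respʳ (s k ∙ ε) (ε ∙ s k) (λ _ → refl) p)))
      , (λ p → ≤-respʳ (ε ∙ s k) (s k ∙ ε) (λ _ → refl)
          (⇒≤∙s ε k (inject₁<suc k) (Sum.map₂ (λ su≤ε → done (commutes′ u (≤ε⇒≈ε su≤ε))) p)))

    ind : ∀ w i → W⁺ k w → k < i → Ascent w i → M w → M (w ∙ s i)
    ind w i w∈W k<i asc m u = to , from
      where
      asc′ : Ascent (s k ∙ w) i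
      asc′ = s∙-ascent k w i w∈W k<i asc

      to : u ≤ᴮ s k ∙ (w ∙ s i) → u ≤ᴮ w ∙ s i ⊎ s k ∙ u ≤ᴮ w ∙ s i
      to p with ≤∙s⇒ (s k ∙ w) i (≤-respʳ (s k ∙ (w ∙ s i)) ((s k ∙ w) ∙ s i) (λ _ → refl) p)
      ... | inj₁ r = Sum.map (⇒≤∙s w i asc ∘ inj₁) (⇒≤∙s w i asc ∘ inj₁) (proj₁ (m u) r)
      ... | inj₂ r = Sum.map (⇒≤∙s w i asc ∘ inj₂)
        (λ r′ → ⇒≤∙s w i asc (inj₂ (≤-respˡ (s k ∙ (u ∙ s i)) ((s k ∙ u) ∙ s i) (λ _ → refl) r′)))
        (proj₁ (m (u ∙ s i)) r)

      back : u ≤ᴮ s k ∙ w ⊎ u ∙ s i ≤ᴮ s k ∙ w → u ≤ᴮ s k ∙ (w ∙ s i)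
      back p = ≤-respʳ ((s k ∙ w) ∙ s i) (s k ∙ (w ∙ s i)) (λ _ → refl) (⇒≤∙s (s k ∙ w) i asc′ p)

      from : u ≤ᴮ w ∙ s i ⊎ s k ∙ u ≤ᴮ w ∙ s i → u ≤ᴮ s k ∙ (w ∙ s i)
      from (inj₁ p) with ≤∙s⇒ w i p
      ... | inj₁ r = back (inj₁ (proj₂ (m u) (inj₁ r)))
      ... | inj₂ r = back (inj₂ (proj₂ (m (u ∙ s i)) (inj₁ r)))
      from (inj₂ p) with ≤∙s⇒ w i p
      ... | inj₁ r = back (inj₁ (proj₂ (m u) (inj₂ r)))
      ... | inj₂ r = back (inj₂ (proj₂ (m (u ∙ s i))
                       (inj₂ (≤-respˡ ((s k ∙ u) ∙ s i) (s k ∙ (u ∙ s i)) (λ _ → refl) r))))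

  -- R-polynomials under left multiplication

  module RFamily (R : S → S → Poly) (isR : IsRFamily R) where

    open IsRFamily isR

    R-resp : ∀ u u′ v v′ → u ≈ u′ → v ≈ v′ → R u v ≃ R u′ v′
    R-resp u u′ v v′ e f = pointwise (R-cong {u} {u′} {v} {v′} e f)

    R-≰ : ∀ u v → ¬ u ≤ᴮ v → R u v ≃ 0ₚ
    R-≰ u v u≰v = pointwise (R-zero u≰v)

    R-refl : ∀ u → R u u ≃ 1ₚ
    R-refl u = pointwise R-one

    private
      ∈D-∙s : ∀ v i → Ascent v i → i ∈D (v ∙ s i)
      ∈D-∙s v i asc = ¬Ascent⇒∈D (v ∙ s i) i (Ascent⇒¬Ascent-∙s v i asc)

    R-down : ∀ u v i → Ascent v i → ¬ Ascent u i → R u (v ∙ s i) ≃ R (u ∙ s i) v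
    R-down u v i v-asc u-desc = ≃-trans
      (pointwise (R-descent {u} {v ∙ s i} {i} (∈D-∙s v i v-asc) (¬Ascent⇒∈D u i u-desc)))
      (R-resp (u ∙ s i) (u ∙ s i) ((v ∙ s i) ∙ s i) v (λ _ → refl) (cancelʳ v i))

    R-up : ∀ u v i → Ascent v i → Ascent u i →
           R u (v ∙ s i) ≃ q *ₚ R (u ∙ s i) v +ₚ q-1 *ₚ R u v
    R-up u v i v-asc u-asc = ≃-trans
      (pointwise (R-ascent {u} {v ∙ s i} {i} (∈D-∙s v i v-asc) (λ i∈D → ∈D⇒¬Ascent u i i∈D u-asc)))
      (+-cong≃ (*-congˡ≃ q (R-resp (u ∙ s i) (u ∙ s i) ((v ∙ s i) ∙ s i) v (λ _ → refl) (cancelʳ v i)))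
              (*-congˡ≃ q-1 (R-resp u u ((v ∙ s i) ∙ s i) v (λ _ → refl) (cancelʳ v i))))

    private
      ring-lemma : ∀ (a b c d : Poly) → a *ₚ (b *ₚ c) +ₚ b *ₚ (b *ₚ d) ≃ b *ₚ (a *ₚ c +ₚ b *ₚ d)
      ring-lemma = solve-∀ polyACR

    -- The left-hand recursion for R, restricted to the subgroup, where u and v both ascend under s
    -- k. It follows by induction over right factors i of v: left multiplication by s k preserves
    -- ascents and descents at i > k, so the right recursion takes the same branch on both sides.
    R-s∙ : ∀ k v → W⁺ k v → ∀ u → W⁺ k u →
           R (s k ∙ u) (s k ∙ v) ≃ R u v × R u (s k ∙ v) ≃ q-1 *ₚ R u v
    R-s∙ k = W-rec (suc (toℕ k)) M resp base ind
      where
      M : S → Set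
      M v = ∀ u → W⁺ k u → R (s k ∙ u) (s k ∙ v) ≃ R u v × R u (s k ∙ v) ≃ q-1 *ₚ R u v

      s-resp : ∀ v v′ → v ≈ v′ → s k ∙ v ≈ s k ∙ v′
      s-resp v v′ e x = cong (s k ⟨$⟩ʳ_) (e x)

      resp : ∀ v v′ → v ≈ v′ → M v → M v′
      resp v v′ e m u u∈W =
          ≃-trans (R-resp (s k ∙ u) (s k ∙ u) (s k ∙ v′) (s k ∙ v) (λ _ → refl) (s-resp v′ v (sym ∘ e)))
                  (≃-trans (proj₁ (m u u∈W)) (R-resp u u v v′ (λ _ → refl) e))
        , ≃-trans (R-resp u u (s k ∙ v′) (s k ∙ v) (λ _ → refl) (s-resp v′ v (sym ∘ e)))
                  (≃-trans (proj₂ (m u u∈W)) (*-congˡ≃ q-1 (R-resp u u v v′ (λ _ → refl) e)))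

      base : M ε
      base u u∈W = first , second
        where
        W-ε : W⁺ k ε
        W-ε _ _ = refl

        first : R (s k ∙ u) (s k ∙ ε) ≃ R u ε
        first with u ≈? ε
        ... | yes u≈ε = ≃-trans (R-resp (s k ∙ u) (s k ∙ ε) (s k ∙ ε) (s k ∙ ε) (s-resp u ε u≈ε) (λ _ → refl))
                          (≃-trans (R-refl (s k ∙ ε)) (≃-sym (≃-trans
                            (R-resp u ε ε ε u≈ε (λ _ → refl)) (R-refl ε))))
        ... | no u≉ε = ≃-trans
          (R-≰ (s k ∙ u) (s k ∙ ε) λ p → case proj₁ (≤s∙⇔ k ε W-ε (s k ∙ u)) p of λ
            { (inj₁ su≤ε)  → s∙∉W⁺ k u u∈W (W-≤ su≤ε W-ε)
            ; (inj₂ ssu≤ε) → u≉ε (≤ε⇒≈ε (≤-respˡ (s k ∙ (s k ∙ u)) u (cancelˡ k u) ssu≤ε)) })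
          (≃-sym (R-≰ u ε (u≉ε ∘ ≤ε⇒≈ε)))

        second : R u (s k ∙ ε) ≃ q-1 *ₚ R u ε
        second = begin
          R u (s k ∙ ε)                                ≈⟨ R-resp u u (s k ∙ ε) (ε ∙ s k) (λ _ → refl) (λ _ → refl) ⟩
          R u (ε ∙ s k)                                ≈⟨ R-up u ε k (inject₁<suc k) (W⁺-ascent k u u∈W) ⟩
          q *ₚ R (u ∙ s k) ε +ₚ q-1 *ₚ R u ε           ≈⟨ +-cong≃ (*-congˡ≃ q (R-≰ (u ∙ s k) ε λ p → ∙s∉W⁺ k u u∈W (W-≤ p W-ε))) ≃-refl ⟩
          q *ₚ 0ₚ +ₚ q-1 *ₚ R u ε                      ≈⟨ +-cong≃ (*-zeroʳ≃ q) ≃-refl ⟩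
          q-1 *ₚ R u ε                                 ∎
          where open SetoidReasoning polySetoid

      ind : ∀ w i → W⁺ k w → k < i → Ascent w i → M w → M (w ∙ s i)
      ind w i w∈W k<i w-asc m u u∈W with ascent? u i
      ... | no u-desc = first , second
        where
        open SetoidReasoning polySetoid
        us∈W : W⁺ k (u ∙ s i)
        us∈W = W-∙ u (s i) u∈W (W-s i k<i)
        sw-asc : Ascent (s k ∙ w) i
        sw-asc = s∙-ascent k w i w∈W k<i w-asc
        first : R (s k ∙ u) (s k ∙ (w ∙ s i)) ≃ R u (w ∙ s i)
        first = begin
          R (s k ∙ u) (s k ∙ (w ∙ s i))    ≈⟨ R-resp (s k ∙ u) (s k ∙ u) (s k ∙ (w ∙ s i)) ((s k ∙ w) ∙ s i) (λ _ → refl) (λ _ → refl) ⟩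
          R (s k ∙ u) ((s k ∙ w) ∙ s i)    ≈⟨ R-down (s k ∙ u) (s k ∙ w) i sw-asc (s∙-descent k u i u∈W k<i u-desc) ⟩
          R ((s k ∙ u) ∙ s i) (s k ∙ w)    ≈⟨ R-resp ((s k ∙ u) ∙ s i) (s k ∙ (u ∙ s i)) (s k ∙ w) (s k ∙ w) (λ _ → refl) (λ _ → refl) ⟩
          R (s k ∙ (u ∙ s i)) (s k ∙ w)    ≈⟨ proj₁ (m (u ∙ s i) us∈W) ⟩
          R (u ∙ s i) w                    ≈⟨ R-down u w i w-asc u-desc ⟨
          R u (w ∙ s i)                    ∎
        second : R u (s k ∙ (w ∙ s i)) ≃ q-1 *ₚ R u (w ∙ s i)
        second = begin
          R u (s k ∙ (w ∙ s i))    ≈⟨ R-resp u u (s k ∙ (w ∙ s i)) ((s k ∙ w) ∙ s i) (λ _ → refl) (λ _ → refl) ⟩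
          R u ((s k ∙ w) ∙ s i)    ≈⟨ R-down u (s k ∙ w) i sw-asc u-desc ⟩
          R (u ∙ s i) (s k ∙ w)    ≈⟨ proj₂ (m (u ∙ s i) us∈W) ⟩
          q-1 *ₚ R (u ∙ s i) w     ≈⟨ *-congˡ≃ q-1 (R-down u w i w-asc u-desc) ⟨
          q-1 *ₚ R u (w ∙ s i)     ∎
      ... | yes u-asc = first , second
        where
        open SetoidReasoning polySetoid
        us∈W : W⁺ k (u ∙ s i)
        us∈W = W-∙ u (s i) u∈W (W-s i k<i)
        sw-asc : Ascent (s k ∙ w) i
        sw-asc = s∙-ascent k w i w∈W k<i w-asc
        first : R (s k ∙ u) (s k ∙ (w ∙ s i)) ≃ R u (w ∙ s i)
        first = begin
          R (s k ∙ u) (s k ∙ (w ∙ s i))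
            ≈⟨ R-resp (s k ∙ u) (s k ∙ u) (s k ∙ (w ∙ s i)) ((s k ∙ w) ∙ s i) (λ _ → refl) (λ _ → refl) ⟩
          R (s k ∙ u) ((s k ∙ w) ∙ s i)
            ≈⟨ R-up (s k ∙ u) (s k ∙ w) i sw-asc (s∙-ascent k u i u∈W k<i u-asc) ⟩
          q *ₚ R ((s k ∙ u) ∙ s i) (s k ∙ w) +ₚ q-1 *ₚ R (s k ∙ u) (s k ∙ w)
            ≈⟨ +-cong≃ (*-congˡ≃ q (≃-trans
                 (R-resp ((s k ∙ u) ∙ s i) (s k ∙ (u ∙ s i)) (s k ∙ w) (s k ∙ w) (λ _ → refl) (λ _ → refl))
                 (proj₁ (m (u ∙ s i) us∈W)))) (*-congˡ≃ q-1 (proj₁ (m u u∈W))) ⟩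
          q *ₚ R (u ∙ s i) w +ₚ q-1 *ₚ R u w
            ≈⟨ R-up u w i w-asc u-asc ⟨
          R u (w ∙ s i) ∎
        second : R u (s k ∙ (w ∙ s i)) ≃ q-1 *ₚ R u (w ∙ s i)
        second = begin
          R u (s k ∙ (w ∙ s i))
            ≈⟨ R-resp u u (s k ∙ (w ∙ s i)) ((s k ∙ w) ∙ s i) (λ _ → refl) (λ _ → refl) ⟩
          R u ((s k ∙ w) ∙ s i)
            ≈⟨ R-up u (s k ∙ w) i sw-asc u-asc ⟩
          q *ₚ R (u ∙ s i) (s k ∙ w) +ₚ q-1 *ₚ R u (s k ∙ w)
            ≈⟨ +-cong≃ (*-congˡ≃ q (proj₂ (m (u ∙ s i) us∈W))) (*-congˡ≃ q-1 (proj₂ (m u u∈W))) ⟩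
          q *ₚ (q-1 *ₚ R (u ∙ s i) w) +ₚ q-1 *ₚ (q-1 *ₚ R u w)
            ≈⟨ ring-lemma q q-1 (R (u ∙ s i) w) (R u w) ⟩
          q-1 *ₚ (q *ₚ R (u ∙ s i) w +ₚ q-1 *ₚ R u w)
            ≈⟨ *-congˡ≃ q-1 (R-up u w i w-asc u-asc) ⟨
          q-1 *ₚ R u (w ∙ s i) ∎

-- Reciprocal pairs of polynomials

-- r = q^(L − ℓ) p(q⁻¹), both p and r being of degree at most L − ℓ; when
-- L < ℓ this says that both are zero.
record Mirror (L ℓ : ℕ) (p r : Poly) : Set where
  field
    mirror  : ∀ i j → i + j + ℓ ≡ L → coeff p i ≡ coeff r j
    boundˡ : ∀ i → L ℕ.< i + ℓ → coeff p i ≡ 0ℤ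
    boundʳ : ∀ i → L ℕ.< i + ℓ → coeff r i ≡ 0ℤ

open Mirror

Mirror-cong : ∀ {L ℓ p p′ r r′} → p ≃ p′ → r ≃ r′ → Mirror L ℓ p r → Mirror L ℓ p′ r′
Mirror-cong e f m = record
  { mirror  = λ i j eq → trans (sym (at e i)) (trans (mirror m i j eq) (at f j))
  ; boundˡ = λ i lt → trans (sym (at e i)) (boundˡ m i lt)
  ; boundʳ = λ i lt → trans (sym (at f i)) (boundʳ m i lt)
  }

Mirror-zero : ∀ {L ℓ p r} → p ≃ 0ₚ → r ≃ 0ₚ → Mirror L ℓ p r
Mirror-zero e f = record
  { mirror  = λ i j _ → trans (at e i) (sym (at f j))
  ; boundˡ = λ i _ → at e i
  ; boundʳ = λ i _ → at f i
  }

Mirror-+ : ∀ {L ℓ} p p′ r r′ → Mirror L ℓ p r → Mirror L ℓ p′ r′ → Mirror L ℓ (p +ₚ p′) (r +ₚ r′)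
Mirror-+ p p′ r r′ m m′ = record
  { mirror  = λ i j eq → trans (coeff-+ p p′ i)
      (trans (cong₂ ℤ._+_ (mirror m i j eq) (mirror m′ i j eq)) (sym (coeff-+ r r′ j)))
  ; boundˡ = λ i lt → trans (coeff-+ p p′ i) (cong₂ ℤ._+_ (boundˡ m i lt) (boundˡ m′ i lt))
  ; boundʳ = λ i lt → trans (coeff-+ r r′ i) (cong₂ ℤ._+_ (boundʳ m i lt) (boundʳ m′ i lt))
  }

Mirror-neg : ∀ {L ℓ} p r → Mirror L ℓ p r → Mirror L ℓ (-ₚ p) (-ₚ r)
Mirror-neg p r m = record
  { mirror  = λ i j eq → trans (coeff-neg p i) (trans (cong ℤ.-_ (mirror m i j eq)) (sym (coeff-neg r j)))
  ; boundˡ = λ i lt → trans (coeff-neg p i) (cong ℤ.-_ (boundˡ m i lt))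
  ; boundʳ = λ i lt → trans (coeff-neg r i) (cong ℤ.-_ (boundʳ m i lt))
  }

Mirror-suc : ∀ {L ℓ p r} → Mirror L ℓ p r → Mirror (suc L) (suc ℓ) p r
Mirror-suc {L} {ℓ} m = record
  { mirror  = λ i j eq → mirror m i j (ℕ.suc-injective (trans (sym (ℕ.+-suc (i + j) ℓ)) eq))
  ; boundˡ = λ i lt → boundˡ m i (ℕ.s<s⁻¹ (subst (suc L ℕ.<_) (ℕ.+-suc i ℓ) lt))
  ; boundʳ = λ i lt → boundʳ m i (ℕ.s<s⁻¹ (subst (suc L ℕ.<_) (ℕ.+-suc i ℓ) lt))
  }

-- Raising L by one lengthens the window: the zero constant term of `q *ₚ r` faces the first
-- coefficient of p beyond its old bound.
Mirror-q*ʳ : ∀ {L ℓ} p r → Mirror L ℓ p r → Mirror (suc L) ℓ p (q *ₚ r)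
Mirror-q*ʳ {L} {ℓ} p r m = record
  { mirror  = λ
    { i zero    eq → trans (boundˡ m i (ℕ.≤-reflexive (sym (trans (cong (_+ ℓ) (sym (ℕ.+-identityʳ i))) eq))))
                           (sym (coeff-q*-zero r))
    ; i (suc j) eq → trans (mirror m i j (ℕ.suc-injective (trans (cong (_+ ℓ) (sym (ℕ.+-suc i j))) eq)))
                           (sym (coeff-q*-suc r j)) }
  ; boundˡ = λ i lt → boundˡ m i (ℕ.<⇒≤ lt)
  ; boundʳ = λ
    { zero    lt → coeff-q*-zero r
    ; (suc i) lt → trans (coeff-q*-suc r i) (boundʳ m i (ℕ.s<s⁻¹ lt)) }
  }

Mirror-q*ˡ : ∀ {L ℓ} p r → Mirror L (suc ℓ) p r → Mirror L ℓ (q *ₚ p) r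
Mirror-q*ˡ {L} {ℓ} p r m = record
  { mirror  = λ
    { zero    j eq → trans (coeff-q*-zero p) (sym (boundʳ m j
        (ℕ.≤-reflexive (trans (cong suc (sym eq)) (sym (ℕ.+-suc j ℓ))))))
    ; (suc i) j eq → trans (coeff-q*-suc p i) (mirror m i j (trans (ℕ.+-suc (i + j) ℓ) eq)) }
  ; boundˡ = λ
    { zero    lt → coeff-q*-zero p
    ; (suc i) lt → trans (coeff-q*-suc p i) (boundˡ m i (subst (L ℕ.<_) (sym (ℕ.+-suc i ℓ)) lt)) }
  ; boundʳ = λ i lt → boundʳ m i (subst (L ℕ.<_) (sym (ℕ.+-suc i ℓ)) (ℕ.m<n⇒m<1+n lt))
  }

-- The Hecke algebra

module Hecke (n : ℕ) where

  open Lengths n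
  open Bruhat n
  open Parabolic n
  open A n
  open Group (symmetricGroup (suc n)) using (_∙_; _≈_; ε)

  -- A list of pairs (c , x) stands for the element Σ c T_x of the Hecke algebra.
  Hecke : Set
  Hecke = List (Poly × S)

  -- The linear form with T_x ↦ φ x. With `δ u` it reads off the coefficient of T_u. With `R u` it
  -- describes the bar involution, which maps h to the sum of q^(-ℓ(u)) r_u(q⁻¹) T_u, where r_u =
  -- `linear (R u) h`. Invariance up to q^L thus compares f(u) with q^(L-ℓ(u)) r_u(q⁻¹), which is
  -- what `Mirror` expresses.
  linear : (S → Poly) → Hecke → Poly
  linear φ = foldr (λ (c , x) p → c *ₚ φ x +ₚ p) 0ₚ

  linear-++ : ∀ φ h h′ → linear φ (h ++ h′) ≃ linear φ h +ₚ linear φ h′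
  linear-++ φ []            h′ = ≃-refl
  linear-++ φ ((c , x) ∷ h) h′ = ≃-trans (+-cong≃ ≃-refl (linear-++ φ h h′))
                                         (≃-sym (+-assoc≃ (c *ₚ φ x) (linear φ h) (linear φ h′)))

  linear-cong : ∀ {k} φ ψ h → All (W k ∘ proj₂) h → (∀ x → W k x → φ x ≃ ψ x) → linear φ h ≃ linear ψ h
  linear-cong φ ψ []            []          e = ≃-refl
  linear-cong φ ψ ((c , x) ∷ h) (x∈W ∷ h∈W) e = +-cong≃ (*-congˡ≃ c (e x x∈W)) (linear-cong φ ψ h h∈W e)

  private
    combine : ∀ (a b c p r t u : Poly) →
              c *ₚ (a *ₚ p +ₚ b *ₚ r) +ₚ (a *ₚ t +ₚ b *ₚ u) ≃ a *ₚ (c *ₚ p +ₚ t) +ₚ b *ₚ (c *ₚ r +ₚ u)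
    combine = solve-∀ polyACR

    combine-zero : ∀ (a b : Poly) → 0ₚ ≃ a *ₚ 0ₚ +ₚ b *ₚ 0ₚ
    combine-zero a b = ≃-sym (+-cong≃ (*-zeroʳ≃ a) (*-zeroʳ≃ b))

  linear-combination : ∀ a b φ ψ h →
    linear (λ x → a *ₚ φ x +ₚ b *ₚ ψ x) h ≃ a *ₚ linear φ h +ₚ b *ₚ linear ψ h
  linear-combination a b φ ψ []            = combine-zero a b
  linear-combination a b φ ψ ((c , x) ∷ h) =
    ≃-trans (+-cong≃ ≃-refl (linear-combination a b φ ψ h)) (combine a b c (φ x) (ψ x) (linear φ h) (linear ψ h))

  linear-zero : ∀ h → linear (λ _ → 0ₚ) h ≃ 0ₚ
  linear-zero []            = ≃-refl
  linear-zero ((c , x) ∷ h) = +-cong≃ (*-zeroʳ≃ c) (linear-zero h)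

  scale : Poly → Hecke → Hecke
  scale d = map (map₁ (d *ₚ_))

  linear-scale : ∀ φ d h → linear φ (scale d h) ≃ d *ₚ linear φ h
  linear-scale φ d []            = ≃-sym (*-zeroʳ≃ d)
  linear-scale φ d ((c , x) ∷ h) = ≃-trans (+-cong≃ ≃-refl (linear-scale φ d h)) (lemma d c (φ x) (linear φ h))
    where
    lemma : ∀ (d c p r : Poly) → (d *ₚ c) *ₚ p +ₚ d *ₚ r ≃ d *ₚ (c *ₚ p +ₚ r)
    lemma = solve-∀ polyACR

  unit : ∀ {p} {P : Set p} → Dec P → Poly
  unit (yes _) = 1ₚ
  unit (no _)  = 0ₚ

  unit-cong : ∀ {p r} {P : Set p} {R : Set r} (P? : Dec P) (R? : Dec R) →
              (P → R) → (R → P) → unit P? ≃ unit R?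
  unit-cong (yes p) (yes r) f g = ≃-refl
  unit-cong (yes p) (no ¬r) f g = contradiction (f p) ¬r
  unit-cong (no ¬p) (yes r) f g = contradiction (g r) ¬p
  unit-cong (no ¬p) (no ¬r) f g = ≃-refl

  δ : S → S → Poly
  δ u x = unit (x ≈? u)

  δ-≈ : ∀ u x → x ≈ u → δ u x ≃ 1ₚ
  δ-≈ u x e = unit-cong (x ≈? u) (yes e) (λ p → p) (λ p → p)

  δ-≉ : ∀ u x → ¬ x ≈ u → δ u x ≃ 0ₚ
  δ-≉ u x ¬e = unit-cong (x ≈? u) (no ¬e) (λ p → p) (λ p → p)

  δ-cong : ∀ u x u′ x′ → (x ≈ u → x′ ≈ u′) → (x′ ≈ u′ → x ≈ u) → δ u x ≃ δ u′ x′
  δ-cong u x u′ x′ f g = unit-cong (x ≈? u) (x′ ≈? u′) f g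

  -- At a descent T_x T_s = (q - 1) T_x + q T_xs, so after adding T_x both coefficients are q.
  _▷₁_ : Poly × S → Fin n → Hecke
  (c , x) ▷₁ k with ascent? x k
  ... | yes _ = (c , x) ∷ (c , x ∙ s k) ∷ []
  ... | no _  = (q *ₚ c , x) ∷ (q *ₚ c , x ∙ s k) ∷ []

  infixl 6 _▷_
  -- Multiplication on the right by 1 + T_s.
  _▷_ : Hecke → Fin n → Hecke
  h ▷ k = concatMap (_▷₁ k) h

  -- ψ is the form h ↦ φ(h C_s) on the basis, so a form on a product is determined by one
  -- computation at ascents and one at descents.
  linear-▷ : ∀ φ ψ k →
    (∀ x → Ascent x k → φ x +ₚ φ (x ∙ s k) ≃ ψ x) →
    (∀ x → ¬ Ascent x k → q *ₚ (φ x +ₚ φ (x ∙ s k)) ≃ ψ x) →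
    ∀ h → linear φ (h ▷ k) ≃ linear ψ h
  linear-▷ φ ψ k asc desc []            = ≃-refl
  linear-▷ φ ψ k asc desc ((c , x) ∷ h) = ≃-trans
    (linear-++ φ ((c , x) ▷₁ k) (h ▷ k)) (+-cong≃ single (linear-▷ φ ψ k asc desc h))
    where
    up : ∀ (c a b : Poly) → c *ₚ a +ₚ (c *ₚ b +ₚ 0ₚ) ≃ c *ₚ (a +ₚ b)
    up c a b = ≃-trans (+-cong≃ ≃-refl (+-identityʳ≃ (c *ₚ b))) (lemma c a b)
      where
      lemma : ∀ (c a b : Poly) → c *ₚ a +ₚ c *ₚ b ≃ c *ₚ (a +ₚ b)
      lemma = solve-∀ polyACR
    down : ∀ (d c a b : Poly) → (d *ₚ c) *ₚ (a +ₚ b) ≃ c *ₚ (d *ₚ (a +ₚ b))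
    down = solve-∀ polyACR
    single : linear φ ((c , x) ▷₁ k) ≃ c *ₚ ψ x
    single with ascent? x k
    ... | yes x-asc = ≃-trans (up c (φ x) (φ (x ∙ s k))) (*-congˡ≃ c (asc x x-asc))
    ... | no x-desc = ≃-trans (up (q *ₚ c) (φ x) (φ (x ∙ s k)))
                        (≃-trans (down q c (φ x) (φ (x ∙ s k))) (*-congˡ≃ c (desc x x-desc)))

  ▷-support : ∀ {k} i → k ℕ.≤ toℕ i → ∀ h → All (W k ∘ proj₂) h → All (W k ∘ proj₂) (h ▷ i)
  ▷-support     i k≤i []            []          = []
  ▷-support {k} i k≤i ((c , x) ∷ h) (x∈W ∷ h∈W) = All.++⁺ single (▷-support i k≤i h h∈W)
    where
    single : All (W k ∘ proj₂) ((c , x) ▷₁ i)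
    single with ascent? x i
    ... | yes _ = x∈W ∷ W-∙ x (s i) x∈W (W-s i k≤i) ∷ []
    ... | no _  = x∈W ∷ W-∙ x (s i) x∈W (W-s i k≤i) ∷ []

  infix 7 _◁_
  -- Multiplication on the left by 1 + T_s, for elements supported on W⁺ k.
  _◁_ : Fin n → Hecke → Hecke
  k ◁ h = h ++ map (map₂ (s k ∙_)) h

  linear-map : ∀ φ k h → linear φ (map (map₂ (s k ∙_)) h) ≡ linear (λ x → φ (s k ∙ x)) h
  linear-map φ k []            = refl
  linear-map φ k ((c , x) ∷ h) = cong (c *ₚ φ (s k ∙ x) +ₚ_) (linear-map φ k h)

  linear-◁ : ∀ φ k h → linear φ (k ◁ h) ≃ linear φ h +ₚ linear (λ x → φ (s k ∙ x)) h
  linear-◁ φ k h = subst (λ p → linear φ (k ◁ h) ≃ linear φ h +ₚ p) (linear-map φ k h)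
    (linear-++ φ h (map (map₂ (s k ∙_)) h))

  ◁-support : ∀ k h → All (W⁺ k ∘ proj₂) h → All (W (toℕ k) ∘ proj₂) (k ◁ h)
  ◁-support k h h∈W = All.++⁺ (All.map (λ {(c , x)} → W-mono x) h∈W)
    (All.map⁺ (All.map (λ {(c , x)} x∈W → W-∙ (s k) x (W-s k ℕ.≤-refl) (W-mono x x∈W)) h∈W))

  -- The coefficients of h C_s in terms of those of h: of u and u s, the longer one contributes with
  -- the factor q to both.
  right : Fin n → (S → Poly) → S → Poly
  right k f u with ascent? u k
  ... | yes _ = f u +ₚ q *ₚ f (u ∙ s k)
  ... | no _  = f (u ∙ s k) +ₚ q *ₚ f u

  -- The coefficients of C_s h for h supported on `W⁺ k`. There s x is always longer than x, so no
  -- factor q appears.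
  left : Fin n → (S → Poly) → S → Poly
  left k f u with W? (suc (toℕ k)) u
  ... | yes _ = f u
  ... | no _  = f (s k ∙ u)

  -- Bar-invariant elements

  module SelfDuality (R : S → S → Poly) (isR : IsRFamily R) where

    open RFamily R isR

    -- f(u) is the coefficient of T_u in an element h of the Hecke algebra such that
    -- q^(-L/2) h is invariant under the bar involution.
    record SelfDual (k L : ℕ) (f : S → Poly) : Set where
      field
        element : Hecke
        support : All (W k ∘ proj₂) element
        value   : ∀ u → linear (δ u) element ≃ f u
        dual    : ∀ u → Mirror L (inv u) (f u) (linear (R u) element)

    open SelfDual

    selfDual-resp : ∀ {k L f} → SelfDual k L f → ∀ u v → u ≈ v → f u ≃ f v
    selfDual-resp d u v e = ≃-trans (≃-sym (value d u)) (≃-trans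
      (linear-cong (δ u) (δ v) (element d) (support d) λ x _ →
        δ-cong u x v x (λ x≈u i → trans (x≈u i) (e i)) (λ x≈v i → trans (x≈v i) (sym (e i))))
      (value d v))

    selfDual-cong : ∀ {k L f g} → (∀ u → f u ≃ g u) → SelfDual k L f → SelfDual k L g
    selfDual-cong e d = record
      { element = element d
      ; support = support d
      ; value   = λ u → ≃-trans (value d u) (e u)
      ; dual    = λ u → Mirror-cong (e u) ≃-refl (dual d u)
      }

    selfDual-mono : ∀ {k L f} → SelfDual (suc k) L f → SelfDual k L f
    selfDual-mono d = record
      { element = element d
      ; support = All.map (λ {(c , x)} → W-mono x) (support d)
      ; value   = value d
      ; dual    = dual d
      }

    selfDual-ε : ∀ {k} → SelfDual k 0 (λ u → δ u ε)
    selfDual-ε = record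
      { element = (1ₚ , ε) ∷ []
      ; support = (λ _ _ → refl) ∷ []
      ; value   = λ u → single (δ u)
      ; dual    = λ u → Mirror-cong ≃-refl (≃-sym (single (R u))) (dual-ε u)
      }
      where
      single : ∀ φ → 1ₚ *ₚ φ ε +ₚ 0ₚ ≃ φ ε
      single φ = ≃-trans (+-identityʳ≃ (1ₚ *ₚ φ ε)) (*-identityˡ≃ (φ ε))
      one : Mirror 0 0 1ₚ 1ₚ
      one = record
        { mirror  = λ { zero zero _ → refl }
        ; boundˡ = λ { (suc i) _ → refl }
        ; boundʳ = λ { (suc i) _ → refl }
        }
      dual-ε : ∀ u → Mirror 0 (inv u) (δ u ε) (R u ε)
      dual-ε u with u ≈? ε
      ... | yes u≈ε = subst (λ ℓ → Mirror 0 ℓ (δ u ε) (R u ε)) (sym (trans (inv-cong u ε u≈ε) inv-ε))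
        (Mirror-cong (≃-sym (δ-≈ u ε (sym ∘ u≈ε)))
          (≃-sym (≃-trans (R-resp u ε ε ε u≈ε (λ _ → refl)) (R-refl ε))) one)
      ... | no u≉ε = Mirror-zero (δ-≉ u ε (λ e → u≉ε (sym ∘ e))) (R-≰ u ε (u≉ε ∘ ≤ε⇒≈ε))

    module _ (k : Fin n) (u : S) (u-asc : Ascent u k) where

      private
        us : S
        us = u ∙ s k

        us-desc : ¬ Ascent us k
        us-desc = Ascent⇒¬Ascent-∙s u k u-asc

        R-swap : ∀ y → Ascent y k → R us (y ∙ s k) ≃ R u y
        R-swap y y-asc = ≃-trans (R-down us y k y-asc us-desc)
                                 (R-resp (us ∙ s k) u y y (cancelʳ u k) (λ _ → refl))

        module _ (x : S) (x-desc : ¬ Ascent x k) where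
          y : S
          y = x ∙ s k

          y-asc : Ascent y k
          y-asc = ¬Ascent⇒Ascent-∙s x k x-desc

          R-x : ∀ w → R w x ≃ R w (y ∙ s k)
          R-x w = R-resp w w x (y ∙ s k) (λ _ → refl) (sym ∘ cancelʳ x k)

          R-u-x : R u x ≃ q *ₚ R us y +ₚ (q +ₚ (-ₚ 1ₚ)) *ₚ R u y
          R-u-x = ≃-trans (R-x u) (≃-trans (R-up u y k y-asc u-asc)
            (+-congˡ≃ (q *ₚ R us y) (*-congʳ≃ (R u y) q-1≃)))

          R-us-x : R us x ≃ R u y
          R-us-x = ≃-trans (R-x us) (R-swap y y-asc)

      -- Together with `linear-R-▷′` this is the counterpart of `right` after the bar involution: on
      -- u < u s the new values are q (r_u + r_us) and r_u + r_us, whereas the new coefficients at u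
      -- and u s are equal.
      linear-R-▷ : ∀ h → linear (R u) (h ▷ k) ≃ q *ₚ (linear (R u) h +ₚ linear (R us) h)
      linear-R-▷ h = ≃-trans
        (linear-▷ (R u) (λ x → q *ₚ R u x +ₚ q *ₚ R us x) k up down h)
        (≃-trans (linear-combination q q (R u) (R us) h) (factor q (linear (R u) h) (linear (R us) h)))
        where
        factor : ∀ (a b c : Poly) → a *ₚ b +ₚ a *ₚ c ≃ a *ₚ (b +ₚ c)
        factor = solve-∀ polyACR

        up : ∀ x → Ascent x k → R u x +ₚ R u (x ∙ s k) ≃ q *ₚ R u x +ₚ q *ₚ R us x
        up x x-asc = ≃-trans
          (+-cong≃ ≃-refl (≃-trans (R-up u x k x-asc u-asc) (+-congˡ≃ (q *ₚ R us x) (*-congʳ≃ (R u x) q-1≃))))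
          (lemma q (R u x) (R us x))
          where
          lemma : ∀ (a b c : Poly) → b +ₚ (a *ₚ c +ₚ (a +ₚ (-ₚ 1ₚ)) *ₚ b) ≃ a *ₚ b +ₚ a *ₚ c
          lemma = solve-∀ polyACR

        down : ∀ x → ¬ Ascent x k → q *ₚ (R u x +ₚ R u (x ∙ s k)) ≃ q *ₚ R u x +ₚ q *ₚ R us x
        down x x-desc = ≃-trans (lemma q (R u x) (R u (x ∙ s k)))
          (+-congˡ≃ (q *ₚ R u x) (*-congˡ≃ q (≃-sym (R-us-x x x-desc))))
          where
          lemma : ∀ (a b c : Poly) → a *ₚ (b +ₚ c) ≃ a *ₚ b +ₚ a *ₚ c
          lemma = solve-∀ polyACR

      linear-R-▷′ : ∀ h → linear (R us) (h ▷ k) ≃ linear (R u) h +ₚ linear (R us) h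
      linear-R-▷′ h = ≃-trans
        (linear-▷ (R us) (λ x → 1ₚ *ₚ R u x +ₚ 1ₚ *ₚ R us x) k up down h)
        (≃-trans (linear-combination 1ₚ 1ₚ (R u) (R us) h)
          (+-cong≃ (*-identityˡ≃ (linear (R u) h)) (*-identityˡ≃ (linear (R us) h))))
        where
        units : ∀ x → R u x +ₚ R us x ≃ 1ₚ *ₚ R u x +ₚ 1ₚ *ₚ R us x
        units x = ≃-sym (+-cong≃ (*-identityˡ≃ (R u x)) (*-identityˡ≃ (R us x)))

        up : ∀ x → Ascent x k → R us x +ₚ R us (x ∙ s k) ≃ 1ₚ *ₚ R u x +ₚ 1ₚ *ₚ R us x
        up x x-asc = ≃-trans (≃-trans (+-cong≃ ≃-refl (R-swap x x-asc)) (+-comm≃ (R us x) (R u x))) (units x)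

        down : ∀ x → ¬ Ascent x k → q *ₚ (R us x +ₚ R us (x ∙ s k)) ≃ 1ₚ *ₚ R u x +ₚ 1ₚ *ₚ R us x
        down x x-desc = ≃-trans (≃-trans
          (*-congˡ≃ q (+-cong≃ (R-us-x x x-desc) ≃-refl))
          (≃-trans (lemma q (R u (x ∙ s k)) (R us (x ∙ s k)))
            (+-cong≃ (≃-sym (R-u-x x x-desc)) (≃-sym (R-us-x x x-desc))))) (units x)
          where
          lemma : ∀ (a b c : Poly) → a *ₚ (b +ₚ c) ≃ a *ₚ c +ₚ (a +ₚ (-ₚ 1ₚ)) *ₚ b +ₚ b
          lemma = solve-∀ polyACR

    selfDual-right : ∀ {k L f} i → k ℕ.≤ toℕ i → SelfDual k L f → SelfDual k (suc L) (right i f)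
    selfDual-right {k} {L} {f} i k≤i d = record
      { element = element d ▷ i
      ; support = ▷-support i k≤i (element d) (support d)
      ; value   = value′
      ; dual    = dual′
      }
      where
      h : Hecke
      h = element d

      F : S → Poly
      F u = linear (R u) h

      desc≢ : ∀ (x u : S) → Ascent u i → ¬ Ascent x i → ¬ x ≈ u
      desc≢ x u u-asc x-desc e = x-desc (Ascent-cong u x i (sym ∘ e) u-asc)

      swap-δ : ∀ u x → δ u (x ∙ s i) ≃ δ (u ∙ s i) x
      swap-δ u x = δ-cong u (x ∙ s i) (u ∙ s i) x
        (λ e j → trans (sym (cancelʳ x i j)) (e (s i ⟨$⟩ʳ j)))
        (λ e j → trans (e (s i ⟨$⟩ʳ j)) (cancelʳ u i j))

      -- The coefficients of h C_s agree on u and u s, so one computation, based at the shorter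
      -- element u, serves for both.
      value-▷ : ∀ u → Ascent u i → ∀ v → v ≈ u ⊎ v ≈ u ∙ s i →
                linear (δ v) (h ▷ i) ≃ f u +ₚ q *ₚ f (u ∙ s i)
      value-▷ u u-asc v v≈ = ≃-trans
        (linear-▷ (δ v) (λ x → 1ₚ *ₚ δ u x +ₚ q *ₚ δ (u ∙ s i) x) i up down h)
        (≃-trans (linear-combination 1ₚ q (δ u) (δ (u ∙ s i)) h)
          (+-cong≃ (≃-trans (*-identityˡ≃ (linear (δ u) h)) (value d u)) (*-congˡ≃ q (value d (u ∙ s i)))))
        where
        both : v ≈ u ⊎ v ≈ u ∙ s i → ∀ x → δ v x +ₚ δ v (x ∙ s i) ≃ δ u x +ₚ δ (u ∙ s i) x
        both (inj₁ e) x = +-cong≃ (δ-cong v x u x (λ p j → trans (p j) (e j)) (λ p j → trans (p j) (sym (e j))))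
                (≃-trans (δ-cong v (x ∙ s i) u (x ∙ s i) (λ p j → trans (p j) (e j)) (λ p j → trans (p j) (sym (e j))))
                         (swap-δ u x))
        both (inj₂ e) x = ≃-trans
                (+-cong≃ (δ-cong v x (u ∙ s i) x (λ p j → trans (p j) (e j)) (λ p j → trans (p j) (sym (e j))))
                  (≃-trans (δ-cong v (x ∙ s i) (u ∙ s i) (x ∙ s i) (λ p j → trans (p j) (e j)) (λ p j → trans (p j) (sym (e j))))
                    (≃-trans (swap-δ (u ∙ s i) x)
                      (δ-cong ((u ∙ s i) ∙ s i) x u x (λ p j → trans (p j) (cancelʳ u i j)) (λ p j → trans (p j) (sym (cancelʳ u i j)))))))
                (+-comm≃ (δ (u ∙ s i) x) (δ u x))

        up : ∀ x → Ascent x i → δ v x +ₚ δ v (x ∙ s i) ≃ 1ₚ *ₚ δ u x +ₚ q *ₚ δ (u ∙ s i) x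
        up x x-asc = ≃-trans (both v≈ x) (≃-trans
          (+-cong≃ ≃-refl zero′)
          (≃-sym (+-cong≃ (*-identityˡ≃ (δ u x)) (≃-trans (*-congˡ≃ q zero′) (*-zeroʳ≃ q)))))
          where
          zero′ : δ (u ∙ s i) x ≃ 0ₚ
          zero′ = δ-≉ (u ∙ s i) x λ e → desc≢ (u ∙ s i) x x-asc (Ascent⇒¬Ascent-∙s u i u-asc) (sym ∘ e)

        down : ∀ x → ¬ Ascent x i → q *ₚ (δ v x +ₚ δ v (x ∙ s i)) ≃ 1ₚ *ₚ δ u x +ₚ q *ₚ δ (u ∙ s i) x
        down x x-desc = ≃-trans (*-congˡ≃ q (≃-trans (both v≈ x) (+-cong≃ zero′ ≃-refl)))
          (≃-sym (+-cong≃ (≃-trans (*-congˡ≃ 1ₚ zero′) (*-zeroʳ≃ 1ₚ)) ≃-refl))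
          where
          zero′ : δ u x ≃ 0ₚ
          zero′ = δ-≉ u x (desc≢ x u u-asc x-desc)

      value′ : ∀ u → linear (δ u) (h ▷ i) ≃ right i f u
      value′ u with ascent? u i
      ... | yes u-asc = value-▷ u u-asc u (inj₁ λ _ → refl)
      ... | no u-desc = ≃-trans
        (value-▷ (u ∙ s i) (¬Ascent⇒Ascent-∙s u i u-desc) u (inj₂ (sym ∘ cancelʳ u i)))
        (+-congˡ≃ (f (u ∙ s i)) (*-congˡ≃ q (selfDual-resp d ((u ∙ s i) ∙ s i) u (cancelʳ u i))))

      -- The factor q makes up for u s being longer than u by one. For L + 1, the value at u then
      -- takes one more factor q, and at u s the length grows along with L.
      mirror-sum : ∀ u → Ascent u i →
                   Mirror L (inv u) (f u +ₚ q *ₚ f (u ∙ s i)) (F u +ₚ F (u ∙ s i))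
      mirror-sum u u-asc = Mirror-+ (f u) (q *ₚ f (u ∙ s i)) (F u) (F (u ∙ s i)) (dual d u)
        (Mirror-q*ˡ (f (u ∙ s i)) (F (u ∙ s i))
          (subst (λ ℓ → Mirror L ℓ (f (u ∙ s i)) (F (u ∙ s i))) (inv-ascent u i u-asc) (dual d (u ∙ s i))))

      dual′ : ∀ u → Mirror (suc L) (inv u) (right i f u) (linear (R u) (h ▷ i))
      dual′ u with ascent? u i
      ... | yes u-asc = Mirror-cong ≃-refl (≃-sym (linear-R-▷ i u u-asc h))
        (Mirror-q*ʳ (f u +ₚ q *ₚ f (u ∙ s i)) (F u +ₚ F (u ∙ s i)) (mirror-sum u u-asc))
      ... | no u-desc = subst (λ ℓ → Mirror (suc L) ℓ (f y +ₚ q *ₚ f u) (linear (R u) (h ▷ i))) (inv-descent u i u-desc)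
        (Mirror-cong
          (+-congˡ≃ (f y) (*-congˡ≃ q (selfDual-resp d (y ∙ s i) u (cancelʳ u i))))
          (≃-trans (≃-sym (linear-R-▷′ i y y-asc h))
            (linear-cong (R (y ∙ s i)) (R u) (h ▷ i) (▷-support i k≤i h (support d))
              λ x _ → R-resp (y ∙ s i) u x x (cancelʳ u i) (λ _ → refl)))
          (Mirror-suc (mirror-sum y y-asc)))
        where
        y : S
        y = u ∙ s i
        y-asc : Ascent y i
        y-asc = ¬Ascent⇒Ascent-∙s u i u-desc

    -- By `R-s∙`, the form `R u` on C_s h is q times its value on h if u lies in `W⁺ k`, and equals
    -- the form `R w` on h if u = s w with w there. For all other u the coefficients and the forms
    -- vanish.
    selfDual-left : ∀ {L f} k → SelfDual (suc (toℕ k)) L f → SelfDual (toℕ k) (suc L) (left k f)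
    selfDual-left {L} {f} k d = record
      { element = k ◁ h
      ; support = ◁-support k h (support d)
      ; value   = value′
      ; dual    = dual′
      }
      where
      h : Hecke
      h = element d

      vanish : ∀ φ → (∀ x → W⁺ k x → φ x ≃ 0ₚ) → linear φ h ≃ 0ₚ
      vanish φ e = ≃-trans (linear-cong φ (λ _ → 0ₚ) h (support d) e) (linear-zero h)

      f-vanish : ∀ u → ¬ W⁺ k u → f u ≃ 0ₚ
      f-vanish u u∉W = ≃-trans (≃-sym (value d u))
        (vanish (δ u) λ x x∈W → δ-≉ u x λ e → u∉W (W-cong x u e x∈W))

      value′ : ∀ u → linear (δ u) (k ◁ h) ≃ left k f u
      value′ u with W? (suc (toℕ k)) u
      ... | yes u∈W = ≃-trans (linear-◁ (δ u) k h) (≃-trans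
        (+-cong≃ (value d u) (vanish (λ x → δ u (s k ∙ x)) λ x x∈W →
          δ-≉ u (s k ∙ x) λ e → s∙∉W⁺ k x x∈W (W-cong u (s k ∙ x) (sym ∘ e) u∈W)))
        (+-identityʳ≃ (f u)))
      ... | no u∉W = ≃-trans (linear-◁ (δ u) k h) (+-cong≃
        (vanish (δ u) λ x x∈W → δ-≉ u x λ e → u∉W (W-cong x u e x∈W))
        (≃-trans
          (linear-cong (λ x → δ u (s k ∙ x)) (δ (s k ∙ u)) h (support d) λ x _ →
            δ-cong u (s k ∙ x) (s k ∙ u) x
              (λ e j → trans (sym (cancelˡ k x j)) (cong (s k ⟨$⟩ʳ_) (e j)))
              (λ e j → trans (cong (s k ⟨$⟩ʳ_) (e j)) (cancelˡ k u j)))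
          (value d (s k ∙ u))))

      dual′ : ∀ u → Mirror (suc L) (inv u) (left k f u) (linear (R u) (k ◁ h))
      dual′ u with W? (suc (toℕ k)) u
      ... | yes u∈W = Mirror-cong ≃-refl (≃-sym total) (Mirror-q*ʳ (f u) (linear (R u) h) (dual d u))
        where
        lemma : ∀ (a p : Poly) → p +ₚ ((a +ₚ (-ₚ 1ₚ)) *ₚ p) ≃ a *ₚ p
        lemma = solve-∀ polyACR
        total : linear (R u) (k ◁ h) ≃ q *ₚ linear (R u) h
        total = ≃-trans (linear-◁ (R u) k h) (≃-trans
          (+-cong≃ ≃-refl (≃-trans
            (linear-cong (λ x → R u (s k ∙ x)) (λ x → q-1 *ₚ R u x +ₚ 0ₚ *ₚ R u x) h (support d) λ x x∈W →
              ≃-trans (proj₂ (R-s∙ k x x∈W u u∈W)) (≃-sym (+-identityʳ≃ (q-1 *ₚ R u x))))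
            (≃-trans (linear-combination q-1 0ₚ (R u) (R u) h)
              (≃-trans (+-identityʳ≃ (q-1 *ₚ linear (R u) h)) (*-cong≃ q-1≃ ≃-refl)))))
          (lemma q (linear (R u) h)))
      ... | no u∉W with W? (suc (toℕ k)) (s k ∙ u)
      ...   | yes w∈W = subst (λ ℓ → Mirror (suc L) ℓ (f w) (linear (R u) (k ◁ h)))
          (sym (trans (inv-cong u (s k ∙ w) (sym ∘ cancelˡ k u)) (inv-s∙ k w w∈W)))
          (Mirror-cong ≃-refl (≃-sym total) (Mirror-suc (dual d w)))
        where
        w : S
        w = s k ∙ u
        total : linear (R u) (k ◁ h) ≃ linear (R w) h
        total = ≃-trans (linear-◁ (R u) k h) (+-cong≃
          (vanish (R u) λ x x∈W → R-≰ u x λ u≤x → u∉W (W-≤ u≤x x∈W))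
          (linear-cong (λ x → R u (s k ∙ x)) (R w) h (support d) λ x x∈W →
            ≃-trans (R-resp u (s k ∙ w) (s k ∙ x) (s k ∙ x) (sym ∘ cancelˡ k u) (λ _ → refl))
                    (proj₁ (R-s∙ k x x∈W w w∈W))))
      ...   | no w∉W = Mirror-zero (f-vanish (s k ∙ u) w∉W) (≃-trans (linear-◁ (R u) k h) (+-cong≃
          (vanish (R u) λ x x∈W → R-≰ u x λ u≤x → u∉W (W-≤ u≤x x∈W))
          (vanish (λ x → R u (s k ∙ x)) λ x x∈W → R-≰ u (s k ∙ x) λ u≤sx →
            case proj₁ (≤s∙⇔ k x x∈W u) u≤sx of λ
              { (inj₁ u≤x)  → u∉W (W-≤ u≤x x∈W)
              ; (inj₂ su≤x) → w∉W (W-≤ su≤x x∈W) })))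

    -- Since q^(-(L+2)/2) q g = q^(-L/2) g, the factor q makes up exactly for a difference of 2
    -- between the lengths.
    selfDual-minus : ∀ {k L f g} → SelfDual k (2 + L) f → SelfDual k L g →
                     SelfDual k (2 + L) (λ u → f u +ₚ (-ₚ (q *ₚ g u)))
    selfDual-minus {k} {L} {f} {g} d e = record
      { element = element d ++ scale (-ₚ q) (element e)
      ; support = All.++⁺ (support d) (All.map⁺ (support e))
      ; value   = λ u → ≃-trans (total (δ u)) (+-cong≃ (value d u) (neg-cong≃ (*-congˡ≃ q (value e u))))
      ; dual    = λ u → Mirror-cong ≃-refl (≃-sym (total (R u)))
          (Mirror-+ (f u) (-ₚ (q *ₚ g u)) (linear (R u) (element d)) (-ₚ (q *ₚ linear (R u) (element e)))
            (dual d u) (Mirror-neg (q *ₚ g u) (q *ₚ linear (R u) (element e))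
              (Mirror-q*ˡ (g u) (q *ₚ linear (R u) (element e))
                (Mirror-suc (Mirror-q*ʳ (g u) (linear (R u) (element e)) (dual e u))))))
      }
      where
      lemma : ∀ (a p : Poly) → (-ₚ a) *ₚ p ≃ -ₚ (a *ₚ p)
      lemma = solve-∀ polyACR
      total : ∀ φ → linear φ (element d ++ scale (-ₚ q) (element e)) ≃
                    linear φ (element d) +ₚ (-ₚ (q *ₚ linear φ (element e)))
      total φ = ≃-trans (linear-++ φ (element d) (scale (-ₚ q) (element e)))
        (+-cong≃ ≃-refl (≃-trans (linear-scale φ (-ₚ q) (element e)) (lemma q (linear φ (element e)))))

-- Uniqueness of Kazhdan-Lusztig polynomials

coeff-applyUpTo : ∀ (φ : ℕ → ℤ) m {k} → k ℕ.< m → coeff (applyUpTo φ m) k ≡ φ k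
coeff-applyUpTo φ (suc m) {zero}  _   = refl
coeff-applyUpTo φ (suc m) {suc k} k<m = coeff-applyUpTo (φ ∘ suc) m (ℕ.s<s⁻¹ k<m)

coeff-reciprocal : ∀ m p {i j} → i + j ≡ m → coeff (reciprocal m p) j ≡ coeff p i
coeff-reciprocal m p {i} {j} refl = trans
  (coeff-applyUpTo (λ k → coeff p (i + j ∸ k)) (suc (i + j)) (s≤s (ℕ.m≤n+m j i)))
  (cong (coeff p) (ℕ.m+n∸n≡m i j))

half-< : ∀ d k → 0 ℕ.< d → d ℕ.≤ k + k → ⌊ d ∸ 1 /2⌋ ℕ.< k
half-< (suc d) k _ d<2k = ℕ.≰⇒> λ k≤ → ℕ.<⇒≱ d<2k
  (ℕ.≤-trans (ℕ.+-mono-≤ k≤ (ℕ.≤-trans k≤ (ℕ.⌊n/2⌋≤⌈n/2⌉ d))) (ℕ.≤-reflexive (ℕ.⌊n/2⌋+⌈n/2⌉≡n d)))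

module KazhdanLusztig (n : ℕ) where

  open Lengths n
  open Bruhat n
  open Parabolic n
  open Hecke n
  open A n
  open Group (symmetricGroup (suc n)) using (_≈_; setoid)
  open Membership setoid using (_∈_)
  open Unique setoid using (Unique)

  Respects : (S → Poly) → Set
  Respects φ = ∀ u v → u ≈ v → φ u ≃ φ v

  Σₚ : List S → (S → Poly) → Poly
  Σₚ as φ = sumₚ (map φ as)

  Σₚ-cong : ∀ as (φ ψ : S → Poly) → (∀ x → x ∈ as → φ x ≃ ψ x) → Σₚ as φ ≃ Σₚ as ψ
  Σₚ-cong []       φ ψ e = ≃-refl
  Σₚ-cong (a ∷ as) φ ψ e = +-cong≃ (e a (here λ _ → refl)) (Σₚ-cong as φ ψ λ x x∈ → e x (there x∈))

  private
    middle-swap : ∀ (a b c d : Poly) → (a +ₚ b) +ₚ (c +ₚ d) ≃ (a +ₚ c) +ₚ (b +ₚ d)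
    middle-swap = solve-∀ polyACR

    distribute : ∀ (a b c : Poly) → a *ₚ b +ₚ a *ₚ c ≃ a *ₚ (b +ₚ c)
    distribute = solve-∀ polyACR

  Σₚ-+ : ∀ as φ ψ → Σₚ as (λ x → φ x +ₚ ψ x) ≃ Σₚ as φ +ₚ Σₚ as ψ
  Σₚ-+ []       φ ψ = ≃-refl
  Σₚ-+ (a ∷ as) φ ψ = ≃-trans (+-congˡ≃ (φ a +ₚ ψ a) (Σₚ-+ as φ ψ))
    (middle-swap (φ a) (ψ a) (Σₚ as φ) (Σₚ as ψ))

  Σₚ-* : ∀ as c φ → Σₚ as (λ x → c *ₚ φ x) ≃ c *ₚ Σₚ as φ
  Σₚ-* []       c φ = ≃-sym (*-zeroʳ≃ c)
  Σₚ-* (a ∷ as) c φ = ≃-trans (+-congˡ≃ (c *ₚ φ a) (Σₚ-* as c φ)) (distribute c (φ a) (Σₚ as φ))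

  Σₚ-zero : ∀ as (φ : S → Poly) → (∀ x → x ∈ as → φ x ≃ 0ₚ) → Σₚ as φ ≃ 0ₚ
  Σₚ-zero []       φ e = ≃-refl
  Σₚ-zero (a ∷ as) φ e = +-cong≃ (e a (here λ _ → refl)) (Σₚ-zero as φ λ x x∈ → e x (there x∈))

  ∉⇒≉ : ∀ {as} a x → x ∈ as → All (λ b → ¬ a ≈ b) as → ¬ a ≈ x
  ∉⇒≉ a x (here e)   (¬e ∷ _)   a≈x = ¬e λ i → trans (a≈x i) (e i)
  ∉⇒≉ a x (there x∈) (_ ∷ rest) a≈x = ∉⇒≉ a x x∈ rest a≈x

  Σₚ-δ-∉ : ∀ as (φ : S → Poly) u → ¬ u ∈ as → Σₚ as (λ x → φ x *ₚ δ u x) ≃ 0ₚ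
  Σₚ-δ-∉ as φ u u∉ = Σₚ-zero as (λ x → φ x *ₚ δ u x) λ x x∈ →
    ≃-trans (*-congˡ≃ (φ x) (δ-≉ u x λ e → u∉ (∈ₚ.∈-resp-≈ setoid {x = x} {y = u} e x∈))) (*-zeroʳ≃ (φ x))

  Σₚ-δ : ∀ as (φ : S → Poly) u → Respects φ → Unique as → u ∈ as → Σₚ as (λ x → φ x *ₚ δ u x) ≃ φ u
  Σₚ-δ (a ∷ as) φ u φ-resp (a∉ ∷ !as) (here u≈a) = ≃-trans
    (+-cong≃ (≃-trans (*-congˡ≃ (φ a) (δ-≈ u a (sym ∘ u≈a)))
                      (≃-trans (*-comm≃ (φ a) 1ₚ) (≃-trans (*-identityˡ≃ (φ a)) (φ-resp a u (sym ∘ u≈a)))))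
             (Σₚ-δ-∉ as φ u λ u∈ → ∉⇒≉ a u u∈ a∉ (sym ∘ u≈a)))
    (+-identityʳ≃ (φ u))
  Σₚ-δ (a ∷ as) φ u φ-resp (a∉ ∷ !as) (there u∈) = +-cong≃
    (≃-trans (*-congˡ≃ (φ a) (δ-≉ u a (∉⇒≉ a u u∈ a∉))) (*-zeroʳ≃ (φ a)))
    (Σₚ-δ as φ u φ-resp !as u∈)

  Supported : List S → Poly × S → Set
  Supported as (_ , x) = x ∈ as

  -- A Hecke element may list the same permutation several times, even by different representatives;
  -- this collects its terms over a list without repetitions.
  linear-expand : ∀ φ → Respects φ → ∀ as → Unique as → ∀ h → All (Supported as) h →
                  linear φ h ≃ Σₚ as (λ y → φ y *ₚ linear (δ y) h)
  linear-expand φ φ-resp as !as []            []         = ≃-sym (Σₚ-zero as (λ y → φ y *ₚ 0ₚ) λ y _ → *-zeroʳ≃ (φ y))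
  linear-expand φ φ-resp as !as ((c , x) ∷ h) (x∈ ∷ h∈) = begin
    c *ₚ φ x +ₚ linear φ h
      ≈⟨ +-cong≃ (*-congˡ≃ c (≃-sym (Σₚ-δ as φ x φ-resp !as x∈))) (linear-expand φ φ-resp as !as h h∈) ⟩
    c *ₚ Σₚ as (λ y → φ y *ₚ δ x y) +ₚ Σₚ as (λ y → φ y *ₚ linear (δ y) h)
      ≈⟨ +-cong≃ (Σₚ-* as c (λ y → φ y *ₚ δ x y)) ≃-refl ⟨
    Σₚ as (λ y → c *ₚ (φ y *ₚ δ x y)) +ₚ Σₚ as (λ y → φ y *ₚ linear (δ y) h)
      ≈⟨ Σₚ-+ as (λ y → c *ₚ (φ y *ₚ δ x y)) (λ y → φ y *ₚ linear (δ y) h) ⟨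
    Σₚ as (λ y → c *ₚ (φ y *ₚ δ x y) +ₚ φ y *ₚ linear (δ y) h)
      ≈⟨ Σₚ-cong as (λ y → c *ₚ (φ y *ₚ δ x y) +ₚ φ y *ₚ linear (δ y) h)
                    (λ y → φ y *ₚ (c *ₚ δ y x +ₚ linear (δ y) h)) (λ y _ → term y) ⟩
    Σₚ as (λ y → φ y *ₚ (c *ₚ δ y x +ₚ linear (δ y) h)) ∎
    where
    open SetoidReasoning polySetoid
    rearrange : ∀ (a b d p : Poly) → a *ₚ (b *ₚ d) +ₚ b *ₚ p ≃ b *ₚ (a *ₚ d +ₚ p)
    rearrange = solve-∀ polyACR
    term : ∀ y → c *ₚ (φ y *ₚ δ x y) +ₚ φ y *ₚ linear (δ y) h ≃ φ y *ₚ (c *ₚ δ y x +ₚ linear (δ y) h)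
    term y = ≃-trans
      (+-cong≃ (*-congˡ≃ c (*-congˡ≃ (φ y) (δ-cong x y y x (λ e → sym ∘ e) (λ e → sym ∘ e)))) ≃-refl)
      (rearrange c (φ y) (δ y x) (linear (δ y) h))

  module Uniqueness
    (P : S → S → Poly) (isKL : IsKLFamily P)
    where

    open IsKLFamily isKL
    open RFamily R isRFamily
    open SelfDuality R isRFamily
    open SelfDual

    P-resp : ∀ u u′ v v′ → u ≈ u′ → v ≈ v′ → P u v ≃ P u′ v′
    P-resp u u′ v v′ e f = pointwise (P-cong {u} {u′} {v} {v′} e f)

    module _ (ρ : S) (f : S → Poly) (sd : SelfDual 0 (inv ρ) f)
      (f-≰ : ∀ u → ¬ u ≤ᴮ ρ → f u ≃ 0ₚ)
      (f-ρ : f ρ ≃ 1ₚ)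
      (f-degree : ∀ u → u ≤ᴮ ρ → ¬ u ≈ ρ → ∀ i → inv ρ ℕ.≤ inv u + (i + i) → coeff (f u) i ≡ 0ℤ)
      where

      private
        module _ (u : S) (as : List S) (as-interval : EnumeratesInterval as u ρ) where

          !as : Unique as
          !as = proj₁ as-interval

          h : Hecke
          h = element sd

          h′ : Hecke
          h′ = map (λ x → f x , x) as

          f-resp : Respects f
          f-resp = selfDual-resp sd

          linear-h′ : ∀ φ bs → linear φ (map (λ x → f x , x) bs) ≡ Σₚ bs (λ x → f x *ₚ φ x)
          linear-h′ φ []       = refl
          linear-h′ φ (b ∷ bs) = cong (f b *ₚ φ b +ₚ_) (linear-h′ φ bs)

          all : List S
          all = deduplicate _≈?_ (map proj₂ h ++ as)

          !all : Unique all
          !all = !ₚ.deduplicate-! decSetoid (map proj₂ h ++ as)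

          ∈-all : ∀ {x} → x ∈ (map proj₂ h ++ as) → x ∈ all
          ∈-all {x} = ∈ₚ.∈-deduplicate⁺ setoid _≈?_ (λ {x} {y} {z} e f i → trans (f i) (sym (e i))) {map proj₂ h ++ as} {x}

          h∈ : ∀ g → All (Supported (map proj₂ g)) g
          h∈ []            = []
          h∈ ((c , x) ∷ g) = here (λ _ → refl) ∷ All.map (λ {(c , x)} → there) (h∈ g)

          h∈all : All (Supported all) h
          h∈all = All.map (λ {(c , x)} x∈ → ∈-all {x} (∈ₚ.∈-++⁺ˡ setoid {v = x} {map proj₂ h} {as} x∈)) (h∈ h)

          h′∈as : ∀ bs → All (Supported bs) (map (λ x → f x , x) bs)
          h′∈as []       = []
          h′∈as (b ∷ bs) = here (λ _ → refl) ∷ All.map (λ {(c , x)} → there) (h′∈as bs)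

          h′∈all : All (Supported all) h′
          h′∈all = All.map (λ {(c , x)} x∈ → ∈-all {x} (∈ₚ.∈-++⁺ʳ setoid {v = x} (map proj₂ h) x∈)) (h′∈as as)

          Ru-resp : Respects (R u)
          Ru-resp x y = R-resp u u x y (λ _ → refl)

          term : ∀ y → R u y *ₚ linear (δ y) h ≃ R u y *ₚ linear (δ y) h′
          term y with u ≤? y | y ≤? ρ
          ... | no u≰y  | _       = ≃-trans (*-congʳ≃ (linear (δ y) h) (R-≰ u y u≰y))
                                            (≃-sym (*-congʳ≃ (linear (δ y) h′) (R-≰ u y u≰y)))
          ... | yes u≤y | yes y≤ρ = *-congˡ≃ (R u y) (≃-trans (value sd y) (≃-sym (≃-trans
            (subst (λ p → linear (δ y) h′ ≃ p) (linear-h′ (δ y) as) ≃-refl)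
            (Σₚ-δ as f y f-resp !as (Equivalence.from (proj₂ as-interval y) (u≤y , y≤ρ))))))
          ... | yes u≤y | no y≰ρ  = *-congˡ≃ (R u y) (≃-trans (value sd y) (≃-trans (f-≰ y y≰ρ) (≃-sym (≃-trans
            (subst (λ p → linear (δ y) h′ ≃ p) (linear-h′ (δ y) as) ≃-refl)
            (Σₚ-δ-∉ as f y λ y∈ → y≰ρ (proj₂ (Equivalence.to (proj₂ as-interval y) y∈)))))))

          -- The form on the self-dual element reduces to a sum over the interval from u to ρ,
          -- because outside of it R u y or f y vanishes. This brings its duality into the shape of
          -- `P-dual`.
          dual-sum : linear (R u) h ≃ Σₚ as (λ x → R u x *ₚ f x)
          dual-sum = begin
            linear (R u) h                          ≈⟨ linear-expand (R u) Ru-resp all !all h h∈all ⟩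
            Σₚ all (λ y → R u y *ₚ linear (δ y) h)   ≈⟨ Σₚ-cong all (λ y → R u y *ₚ linear (δ y) h)
                                                         (λ y → R u y *ₚ linear (δ y) h′) (λ y _ → term y) ⟩
            Σₚ all (λ y → R u y *ₚ linear (δ y) h′)  ≈⟨ linear-expand (R u) Ru-resp all !all h′ h′∈all ⟨
            linear (R u) h′                         ≡⟨ linear-h′ (R u) as ⟩
            Σₚ as (λ x → f x *ₚ R u x)               ≈⟨ Σₚ-cong as (λ x → f x *ₚ R u x) (λ x → R u x *ₚ f x)
                                                         (λ x _ → *-comm≃ (f x) (R u x)) ⟩
            Σₚ as (λ x → R u x *ₚ f x)               ∎
            where open SetoidReasoning polySetoid

        -- Induction on the length gap, bounded by m. In the two dual sums the terms with x ≠ u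
        -- cancel by induction, so p - g equals the difference of the sums; by duality its j-th
        -- coefficient is then also its (d - j)-th one.
        unique : ∀ m u → u ≤ᴮ ρ → inv ρ ℕ.≤ inv u + m → P u ρ ≃ f u
        unique m u u≤ρ bound with u ≈? ρ
        ... | yes u≈ρ = ≃-trans (P-resp u ρ ρ ρ u≈ρ (λ _ → refl)) (≃-trans (pointwise P-one)
                          (≃-sym (≃-trans (selfDual-resp sd u ρ u≈ρ) f-ρ)))
        unique zero    u u≤ρ bound | no u≉ρ = contradiction
          (subst (inv ρ ℕ.≤_) (ℕ.+-identityʳ (inv u)) bound) (ℕ.<⇒≱ (≤∧≉⇒inv< u≤ρ u≉ρ))
        unique (suc m) u u≤ρ bound | no u≉ρ = pointwise equal
          where
          u<ρ : inv u ℕ.< inv ρ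
          u<ρ = ≤∧≉⇒inv< u≤ρ u≉ρ

          d : ℕ
          d = inv ρ ∸ inv u

          as : List S
          as = proj₁ (interval u ρ)

          as-interval : EnumeratesInterval as u ρ
          as-interval = proj₂ (interval u ρ)

          p g : Poly
          p = P u ρ
          g = f u

          ΣP Σf : Poly
          ΣP = Σₚ as (λ x → R u x *ₚ P x ρ)
          Σf = Σₚ as (λ x → R u x *ₚ f x)

          χ : S → Poly
          χ x = R u x *ₚ (P x ρ +ₚ (-ₚ f x))

          χ-resp : Respects χ
          χ-resp x y e = *-cong≃ (R-resp u u x y (λ _ → refl) e)
            (+-cong≃ (P-resp x y ρ ρ e (λ _ → refl)) (neg-cong≃ (selfDual-resp sd x y e)))

          χ-δ : ∀ x → x ∈ as → χ x ≃ χ x *ₚ δ u x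
          χ-δ x x∈ with x ≈? u | Equivalence.to (proj₂ as-interval x) x∈
          ... | yes x≈u | _ = ≃-sym (≃-trans (*-comm≃ (χ x) 1ₚ) (*-identityˡ≃ (χ x)))
          ... | no x≉u  | u≤x , x≤ρ = ≃-trans
            (≃-trans (*-congˡ≃ (R u x) (≃-trans
              (+-cong≃ (unique m x x≤ρ (let open ℕ.≤-Reasoning in begin
                inv ρ           ≤⟨ bound ⟩
                inv u + suc m   ≡⟨ ℕ.+-suc (inv u) m ⟩
                suc (inv u) + m ≤⟨ ℕ.+-monoˡ-≤ m (≤∧≉⇒inv< u≤x (λ e → x≉u (sym ∘ e))) ⟩
                inv x + m       ∎)) ≃-refl)
              (+-inverseʳ≃ (f x)))) (*-zeroʳ≃ (R u x)))
            (≃-sym (*-zeroʳ≃ (χ x)))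

          split : ∀ (r a b : Poly) → r *ₚ (a +ₚ (-ₚ b)) ≃ r *ₚ a +ₚ (-ₚ 1ₚ) *ₚ (r *ₚ b)
          split = solve-∀ polyACR

          negate : ∀ (a b : Poly) → a +ₚ (-ₚ 1ₚ) *ₚ b ≃ a +ₚ (-ₚ b)
          negate = solve-∀ polyACR

          difference : ΣP +ₚ (-ₚ Σf) ≃ p +ₚ (-ₚ g)
          difference = ≃-trans (≃-sym (let open SetoidReasoning polySetoid in begin
            Σₚ as χ
              ≈⟨ Σₚ-cong as χ (λ x → R u x *ₚ P x ρ +ₚ (-ₚ 1ₚ) *ₚ (R u x *ₚ f x))
                   (λ x _ → split (R u x) (P x ρ) (f x)) ⟩
            Σₚ as (λ x → R u x *ₚ P x ρ +ₚ (-ₚ 1ₚ) *ₚ (R u x *ₚ f x))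
              ≈⟨ Σₚ-+ as (λ x → R u x *ₚ P x ρ) (λ x → (-ₚ 1ₚ) *ₚ (R u x *ₚ f x)) ⟩
            ΣP +ₚ Σₚ as (λ x → (-ₚ 1ₚ) *ₚ (R u x *ₚ f x))
              ≈⟨ +-congˡ≃ ΣP (Σₚ-* as (-ₚ 1ₚ) (λ x → R u x *ₚ f x)) ⟩
            ΣP +ₚ (-ₚ 1ₚ) *ₚ Σf
              ≈⟨ negate ΣP Σf ⟩
            ΣP +ₚ (-ₚ Σf) ∎)) (let open SetoidReasoning polySetoid in begin
            Σₚ as χ                        ≈⟨ Σₚ-cong as χ (λ x → χ x *ₚ δ u x) χ-δ ⟩
            Σₚ as (λ x → χ x *ₚ δ u x)     ≈⟨ Σₚ-δ as χ u χ-resp (proj₁ as-interval)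
                                               (Equivalence.from (proj₂ as-interval u) (≤-refl u , u≤ρ)) ⟩
            R u u *ₚ (p +ₚ (-ₚ g))         ≈⟨ *-congʳ≃ (p +ₚ (-ₚ g)) (R-refl u) ⟩
            1ₚ *ₚ (p +ₚ (-ₚ g))            ≈⟨ *-identityˡ≃ (p +ₚ (-ₚ g)) ⟩
            p +ₚ (-ₚ g)                    ∎)

          coeff-difference : ∀ j → coeff ΣP j ℤ.- coeff Σf j ≡ coeff p j ℤ.- coeff g j
          coeff-difference j = trans (sym (coeff-minus ΣP Σf)) (trans (at difference j) (coeff-minus p g))
            where
            coeff-minus : ∀ a b → coeff (a +ₚ (-ₚ b)) j ≡ coeff a j ℤ.- coeff b j
            coeff-minus a b = trans (coeff-+ a (-ₚ b) j) (cong (λ z → coeff a j ℤ.+ z) (coeff-neg b j))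

          mirror-P : ∀ i j → i + j ≡ d → coeff p i ≡ coeff ΣP j
          mirror-P i j e = trans (sym (coeff-reciprocal d p e))
            (P-dual u≤ρ (hasLength u) (hasLength ρ) as-interval j)

          mirror-f : ∀ i j → i + j ≡ d → coeff g i ≡ coeff Σf j
          mirror-f i j e = trans
            (Mirror.mirror (dual sd u) i j (trans (cong (_+ inv u) e) (ℕ.m∸n+n≡m (ℕ.<⇒≤ u<ρ))))
            (at (dual-sum u as as-interval) j)

          P-vanish : ∀ i → d ℕ.≤ i + i → coeff p i ≡ 0ℤ
          P-vanish i d≤ = P-degree (u≤ρ , u≉ρ) (hasLength u) (hasLength ρ) i (half-< d i (ℕ.m<n⇒0<n∸m u<ρ) d≤)

          f-vanish : ∀ i → d ℕ.≤ i + i → coeff g i ≡ 0ℤ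
          f-vanish i d≤ = f-degree u u≤ρ u≉ρ i (let open ℕ.≤-Reasoning in begin
            inv ρ             ≡⟨ ℕ.m+[n∸m]≡n (ℕ.<⇒≤ u<ρ) ⟨
            inv u + d         ≤⟨ ℕ.+-monoʳ-≤ (inv u) d≤ ⟩
            inv u + (i + i)   ∎)

          equal : ∀ j → coeff p j ≡ coeff g j
          -- One of j and d - j is at least d / 2, where the degree bounds make both polynomials
          -- vanish.
          equal j with d ℕ.≤? j + j
          ... | yes d≤ = trans (P-vanish j d≤) (sym (f-vanish j d≤))
          ... | no d≰  = ℤ.i-j≡0⇒i≡j (coeff p j) (coeff g j) (trans (sym (coeff-difference j))
              (trans (cong₂ ℤ._-_ (sym (mirror-P i j i+j≡d)) (sym (mirror-f i j i+j≡d)))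
                     (cong₂ ℤ._-_ (P-vanish i d≤) (f-vanish i d≤))))
            where
            2j<d : j + j ℕ.< d
            2j<d = ℕ.≰⇒> d≰
            i : ℕ
            i = d ∸ j
            j≤d : j ℕ.≤ d
            j≤d = ℕ.≤-trans (ℕ.m≤m+n j j) (ℕ.<⇒≤ 2j<d)
            i+j≡d : i + j ≡ d
            i+j≡d = ℕ.m∸n+n≡m j≤d
            j≤i : j ℕ.≤ i
            j≤i = ℕ.+-cancelʳ-≤ j j i (ℕ.≤-trans (ℕ.<⇒≤ 2j<d) (ℕ.≤-reflexive (sym i+j≡d)))
            d≤ : d ℕ.≤ i + i
            d≤ = ℕ.≤-trans (ℕ.≤-reflexive (sym i+j≡d)) (ℕ.+-monoʳ-≤ i j≤i)

      KL-unique : ∀ u → u ≤ᴮ ρ → P u ρ ≃ f u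
      KL-unique u u≤ρ = unique (inv ρ) u u≤ρ (ℕ.m≤n+m (inv ρ) (inv u))

-- Counting by indicator sums

count-tabulate : ∀ {a p} {A : Set a} {P : Pred A p} (P? : Decidable P) m (f : Fin m → A) →
                 Vec.count P? (Vec.tabulate f) ≡ sum λ i → indicator (P? (f i))
count-tabulate P? zero    f = refl
count-tabulate P? (suc m) f with P? (f Fin.zero)
... | yes _ = cong suc (count-tabulate P? m (f ∘ Fin.suc))
... | no _  = count-tabulate P? m (f ∘ Fin.suc)

module _ {m p r} {P : Pred (Fin m) p} {Q : Pred (Fin m) r} (P? : Decidable P) (Q? : Decidable Q) where

  count-cong : (∀ i → P i → Q i) → (∀ i → Q i → P i) →
               Vec.count P? (Vec.allFin m) ≡ Vec.count Q? (Vec.allFin m)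
  count-cong f g = trans (count-tabulate P? m (λ i → i))
    (trans (sum-cong-≗ λ i → indicator-cong (P? i) (Q? i) (f i) (g i))
           (sym (count-tabulate Q? m (λ i → i))))

  count-insert : ∀ k → P k → ¬ Q k → (∀ i → i ≢ k → P i → Q i) → (∀ i → i ≢ k → Q i → P i) →
                 Vec.count P? (Vec.allFin m) ≡ suc (Vec.count Q? (Vec.allFin m))
  count-insert k Pk ¬Qk f g = begin
    Vec.count P? (Vec.allFin m)                                         ≡⟨ count-tabulate P? m (λ i → i) ⟩
    (sum λ i → indicator (P? i))                                        ≡⟨ sum-cong-≗ term ⟩
    (sum λ i → indicator (Q? i) + indicator (i Fin.≟ k))                ≡⟨ ∑-distrib-+ (λ i → indicator (Q? i)) (λ i → indicator (i Fin.≟ k)) ⟩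
    (sum λ i → indicator (Q? i)) + (sum λ i → indicator (i Fin.≟ k))    ≡⟨ cong₂ _+_ (sym (count-tabulate Q? m (λ i → i))) (sum-indicator k) ⟩
    Vec.count Q? (Vec.allFin m) + 1                                     ≡⟨ ℕ.+-comm _ 1 ⟩
    suc (Vec.count Q? (Vec.allFin m))                                   ∎
    where
    open ≡-Reasoning
    term : ∀ i → indicator (P? i) ≡ indicator (Q? i) + indicator (i Fin.≟ k)
    term i with i Fin.≟ k
    ... | yes refl = trans (indicator-true (P? i) Pk) (cong (_+ 1) (sym (indicator-false (Q? i) ¬Qk)))
    ... | no i≢k   = trans (indicator-cong (P? i) (Q? i) (f i i≢k) (g i i≢k)) (sym (ℕ.+-identityʳ _))

-- Fix, NFix and 𝒜 under multiplication by a generator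

module FixedIntervals (n : ℕ) where

  open Lengths n
  open Parabolic n
  open Group (symmetricGroup (suc n)) using (_∙_; _≈_)

  Fix⁻ : ∀ (σ : S) {i} → Fix σ i → ∀ x → (toℕ (σ ⟨$⟩ʳ x) ℕ.≤ toℕ i → toℕ x ℕ.≤ toℕ i) ×
                                   (toℕ x ℕ.≤ toℕ i → toℕ (σ ⟨$⟩ʳ x) ℕ.≤ toℕ i)
  Fix⁻ σ {i} fix x =
      (λ σx≤i → let x′ , x′≤i , e = Equivalence.from (fix (σ ⟨$⟩ʳ x)) σx≤i
                in subst (λ y → toℕ y ℕ.≤ toℕ i) (injective σ e) x′≤i)
    , (λ x≤i → Equivalence.to (fix (σ ⟨$⟩ʳ x)) (x , x≤i , refl))

  Fix⁺ : ∀ (σ : S) {i} → (∀ x → (toℕ (σ ⟨$⟩ʳ x) ℕ.≤ toℕ i → toℕ x ℕ.≤ toℕ i) ×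
                                (toℕ x ℕ.≤ toℕ i → toℕ (σ ⟨$⟩ʳ x) ℕ.≤ toℕ i)) → Fix σ i
  Fix⁺ σ {i} stable y = mk⇔
    (λ { (x , x≤i , refl) → proj₂ (stable x) x≤i })
    (λ y≤i → σ ⟨$⟩ˡ y , proj₁ (stable (σ ⟨$⟩ˡ y)) (subst (λ z → toℕ z ℕ.≤ toℕ i) (sym (Perm.inverseʳ σ)) y≤i) , Perm.inverseʳ σ)

  Fix-cong : ∀ (σ τ : S) {i} → σ ≈ τ → Fix σ i → Fix τ i
  Fix-cong σ τ {i} e fix = Fix⁺ τ λ x →
      (λ le → proj₁ (Fix⁻ σ fix x) (subst (λ y → toℕ y ℕ.≤ toℕ i) (sym (e x)) le))
    , (λ le → subst (λ y → toℕ y ℕ.≤ toℕ i) (e x) (proj₂ (Fix⁻ σ fix x) le))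

  W⇒Fix : ∀ (w : S) i → W⁺ i w → Fix w i
  W⇒Fix w i w∈W = Fix⁺ w λ x →
      (λ wx≤i → subst (λ y → toℕ y ℕ.≤ toℕ i) (injective w (w∈W (w ⟨$⟩ʳ x) (s≤s wx≤i))) wx≤i)
    , (λ x≤i → subst (λ y → toℕ y ℕ.≤ toℕ i) (sym (w∈W x (s≤s x≤i))) x≤i)

  -- The points below i are fixed already, so an image of i that is at most i can only be i. With
  -- `W⇒Fix`, on `W (toℕ i)` the condition `Fix w i` means that s i does not occur in w.
  Fix⇒W : ∀ (w : S) i → W (toℕ i) w → Fix w i → W⁺ i w
  Fix⇒W w i w∈W fix x (s≤s x≤i) with ℕ.m≤n⇒m<n∨m≡n x≤i
  ... | inj₁ x<i = w∈W x x<i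
  ... | inj₂ x≡i with ℕ.m≤n⇒m<n∨m≡n (proj₂ (Fix⁻ w fix x) x≤i)
  ...   | inj₁ wx<i = injective w (w∈W (w ⟨$⟩ʳ x) wx<i)
  ...   | inj₂ wx≡i = Fin.toℕ-injective (trans wx≡i (sym x≡i))

  s-[] : ∀ k (j : Fin n) → k < j → ∀ x → toℕ x ℕ.≤ toℕ j → toℕ (s k ⟨$⟩ʳ x) ℕ.≤ toℕ j
  s-[] k j k<j x x≤j with transposeView (inject₁ k) (Fin.suc k) x
  ... | at-ˡ _ e  = subst (λ y → toℕ y ℕ.≤ toℕ j) (sym e) k<j
  ... | at-ʳ _ e  = subst (λ y → toℕ y ℕ.≤ toℕ j) (sym e)
                      (ℕ.≤-trans (ℕ.≤-reflexive (Fin.toℕ-inject₁ k)) (ℕ.<⇒≤ k<j))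
  ... | off _ _ e = subst (λ y → toℕ y ℕ.≤ toℕ j) (sym e) x≤j

  s-[]⁻ : ∀ k (j : Fin n) → k < j → ∀ x → toℕ (s k ⟨$⟩ʳ x) ℕ.≤ toℕ j → toℕ x ℕ.≤ toℕ j
  s-[]⁻ k j k<j x le = subst (λ y → toℕ y ℕ.≤ toℕ j) (s-involutive k x) (s-[] k j k<j (s k ⟨$⟩ʳ x) le)

  s-suc : ∀ k (j : Fin n) → k < j → s k ⟨$⟩ʳ Fin.suc j ≡ Fin.suc j
  s-suc k j k<j = s-≢ k
    (λ e → ℕ.<⇒≢ (ℕ.m<n⇒m<1+n k<j) (trans (sym (Fin.toℕ-inject₁ k)) (sym (cong toℕ e))))
    (λ e → ℕ.<⇒≢ (s≤s k<j) (sym (cong toℕ e)))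

  -- All that 𝒜 reads at indices beyond k. Multiplication by s k on either side preserves it, as s k
  -- maps [j] to itself and fixes j + 1 for each j > k.
  record Agree (k : Fin n) (u v : S) : Set where
    field
      Fix-to    : ∀ j → k < j → Fix u j → Fix v j
      Fix-from  : ∀ j → k < j → Fix v j → Fix u j
      point-to   : ∀ j → k < j → u ⟨$⟩ʳ Fin.suc j ≡ Fin.suc j → v ⟨$⟩ʳ Fin.suc j ≡ Fin.suc j
      point-from : ∀ j → k < j → v ⟨$⟩ʳ Fin.suc j ≡ Fin.suc j → u ⟨$⟩ʳ Fin.suc j ≡ Fin.suc j

  open Agree

  Agree-sym : ∀ {k u v} → Agree k u v → Agree k v u
  Agree-sym a = record { Fix-to = Fix-from a ; Fix-from = Fix-to a ; point-to = point-from a ; point-from = point-to a }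

  Agree-trans : ∀ {k u v w} → Agree k u v → Agree k v w → Agree k u w
  Agree-trans a b = record
    { Fix-to    = λ j k<j → Fix-to b j k<j ∘ Fix-to a j k<j
    ; Fix-from  = λ j k<j → Fix-from a j k<j ∘ Fix-from b j k<j
    ; point-to   = λ j k<j → point-to b j k<j ∘ point-to a j k<j
    ; point-from = λ j k<j → point-from a j k<j ∘ point-from b j k<j
    }

  Agree-≈ : ∀ {k} u v → u ≈ v → Agree k u v
  Agree-≈ u v e = record
    { Fix-to    = λ j _ → Fix-cong u v e
    ; Fix-from  = λ j _ → Fix-cong v u (sym ∘ e)
    ; point-to   = λ j _ → trans (sym (e _))
    ; point-from = λ j _ → trans (e _)
    }

  Agree-s∙ : ∀ k u → Agree k (s k ∙ u) u
  Agree-s∙ k u = record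
    { Fix-to = λ j k<j fix → Fix⁺ u λ x →
          (λ le → proj₁ (Fix⁻ (s k ∙ u) fix x) (s-[] k j k<j (u ⟨$⟩ʳ x) le))
        , (λ le → s-[]⁻ k j k<j (u ⟨$⟩ʳ x) (proj₂ (Fix⁻ (s k ∙ u) fix x) le))
    ; Fix-from = λ j k<j fix → Fix⁺ (s k ∙ u) λ x →
          (λ le → proj₁ (Fix⁻ u fix x) (s-[]⁻ k j k<j (u ⟨$⟩ʳ x) le))
        , (λ le → s-[] k j k<j (u ⟨$⟩ʳ x) (proj₂ (Fix⁻ u fix x) le))
    ; point-to = λ j k<j e →
        trans (sym (s-involutive k (u ⟨$⟩ʳ Fin.suc j))) (trans (cong (s k ⟨$⟩ʳ_) e) (s-suc k j k<j))
    ; point-from = λ j k<j e → trans (cong (s k ⟨$⟩ʳ_) e) (s-suc k j k<j)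
    }

  Agree-∙s : ∀ k u → Agree k (u ∙ s k) u
  Agree-∙s k u = record
    { Fix-to = λ j k<j fix → Fix⁺ u λ x →
          (λ le → s-[]⁻ k j k<j x (proj₁ (Fix⁻ (u ∙ s k) fix (s k ⟨$⟩ʳ x))
            (subst (λ y → toℕ (u ⟨$⟩ʳ y) ℕ.≤ toℕ j) (sym (s-involutive k x)) le)))
        , (λ le → subst (λ y → toℕ (u ⟨$⟩ʳ y) ℕ.≤ toℕ j) (s-involutive k x)
            (proj₂ (Fix⁻ (u ∙ s k) fix (s k ⟨$⟩ʳ x)) (s-[] k j k<j x le)))
    ; Fix-from = λ j k<j fix → Fix⁺ (u ∙ s k) λ x →
          (λ le → s-[]⁻ k j k<j x (proj₁ (Fix⁻ u fix (s k ⟨$⟩ʳ x)) le))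
        , (λ le → proj₂ (Fix⁻ u fix (s k ⟨$⟩ʳ x)) (s-[] k j k<j x le))
    ; point-to   = λ j k<j e → trans (cong (u ⟨$⟩ʳ_) (sym (s-suc k j k<j))) e
    ; point-from = λ j k<j e → trans (cong (u ⟨$⟩ʳ_) (s-suc k j k<j)) e
    }

  NFix-agree : ∀ {k u v} → Agree k u v → ∀ j → k < j → NFix u j → NFix v j
  NFix-agree a j k<j (¬fix , e) = ¬fix ∘ Fix-from a j k<j , point-to a j k<j e

  NFix-cong : ∀ (u v : S) {i} → u ≈ v → NFix u i → NFix v i
  NFix-cong u v e (¬fix , p) = ¬fix ∘ Fix-cong v u (sym ∘ e) , trans (sym (e _)) p

  private
    next : ∀ {i j k : Fin n} → toℕ j ≡ suc (toℕ i) → toℕ k ℕ.≤ toℕ i → k < j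
    next e k≤i = subst (_ ℕ.<_) (sym e) (s≤s k≤i)

  𝒜-agree : ∀ {k u u′ ρ ρ′} → Agree k u u′ → Agree k ρ ρ′ → ∀ i → k < i → 𝒜 u ρ i → 𝒜 u′ ρ′ i
  𝒜-agree a b i k<i (nfix , j , e , nfix′ , fix) =
    NFix-agree b i k<i nfix , j , e , NFix-agree b j (next e (ℕ.<⇒≤ k<i)) nfix′ , Fix-to a j (next e (ℕ.<⇒≤ k<i)) fix

  -- The first argument of 𝒜 is consulted only at i + 1, so i = k is allowed here, unlike in
  -- `𝒜-agree`.
  𝒜-agreeˡ : ∀ {k u u′} ρ → Agree k u u′ → ∀ i → toℕ k ℕ.≤ toℕ i → 𝒜 u ρ i → 𝒜 u′ ρ i
  𝒜-agreeˡ ρ a i k≤i (nfix , j , e , nfix′ , fix) = nfix , j , e , nfix′ , Fix-to a j (next e k≤i) fix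

  W⇒¬𝒜 : ∀ {k} u (ρ : S) → W k ρ → ∀ i → toℕ i ℕ.< k → ¬ 𝒜 u ρ i
  W⇒¬𝒜 u ρ ρ∈W i i<k ((¬fix , _) , _) = ¬fix (W⇒Fix ρ i λ x x≤i → ρ∈W x (ℕ.<-≤-trans x≤i i<k))

  abstract

    -- #𝒜, kept folded: normalising its decision procedure is expensive.
    count𝒜 : S → S → ℕ
    count𝒜 u ρ = #𝒜 u ρ

    count𝒜≡#𝒜 : ∀ u ρ → count𝒜 u ρ ≡ #𝒜 u ρ
    count𝒜≡#𝒜 u ρ = refl

    count𝒜-agreeˡ : ∀ {k u u′} ρ → W (toℕ k) ρ → Agree k u u′ → count𝒜 u ρ ≡ count𝒜 u′ ρ
    count𝒜-agreeˡ {k} {u} {u′} ρ ρ∈W a = count-cong (𝒜? u ρ) (𝒜? u′ ρ) (half u u′ a) (half u′ u (Agree-sym a))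
      where
      half : ∀ u u′ → Agree k u u′ → ∀ i → 𝒜 u ρ i → 𝒜 u′ ρ i
      half u u′ a i m = 𝒜-agreeˡ ρ a i (ℕ.≮⇒≥ λ i<k → W⇒¬𝒜 u ρ ρ∈W i i<k m) m

    count𝒜-cong : ∀ u u′ ρ ρ′ → u ≈ u′ → ρ ≈ ρ′ → count𝒜 u ρ ≡ count𝒜 u′ ρ′
    count𝒜-cong u u′ ρ ρ′ e f = count-cong (𝒜? u ρ) (𝒜? u′ ρ′) (half u u′ ρ ρ′ e f) (half u′ u ρ′ ρ (sym ∘ e) (sym ∘ f))
      where
      half : ∀ u u′ ρ ρ′ → u ≈ u′ → ρ ≈ ρ′ → ∀ i → 𝒜 u ρ i → 𝒜 u′ ρ′ i
      half u u′ ρ ρ′ e f i (nfix , j , eq , nfix′ , fix) =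
        NFix-cong ρ ρ′ f nfix , j , eq , NFix-cong ρ ρ′ f nfix′ , Fix-cong u u′ e fix

    count𝒜-none : ∀ u ρ → (∀ i → ¬ 𝒜 u ρ i) → count𝒜 u ρ ≡ 0
    count𝒜-none u ρ none = trans (count-tabulate (𝒜? u ρ) n (λ i → i))
      (trans (sum-cong-≗ λ i → indicator-false (𝒜? u ρ i) (none i)) (sum-replicate-zero n))

    count𝒜-refl : ∀ ρ → count𝒜 ρ ρ ≡ 0
    count𝒜-refl ρ = count𝒜-none ρ ρ λ i (_ , j , _ , (¬fix , _) , fix) → ¬fix fix

  module _ (k : Fin n) {u ρ y x : S} (ρ∈W : W (toℕ k) ρ) (x∈W : W⁺ k x)
           (a : Agree k u y) (b : Agree k ρ x) where

    private
      to : ∀ i → i ≢ k → 𝒜 u ρ i → 𝒜 y x i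
      to i i≢k m = 𝒜-agree a b i
        (Fin.≤∧≢⇒< (ℕ.≮⇒≥ λ i<k → W⇒¬𝒜 u ρ ρ∈W i i<k m) (≢-sym i≢k)) m

      from : ∀ i → 𝒜 y x i → 𝒜 u ρ i
      from i m = 𝒜-agree (Agree-sym a) (Agree-sym b) i (ℕ.≮⇒≥ λ i<k → W⇒¬𝒜 y x x∈W i i<k m) m

    abstract
      -- Neither side has elements below k, both have the same ones above k, and k is not in 𝒜 for
      -- x; so k alone decides whether the counts differ.
      count𝒜-same : ¬ 𝒜 u ρ k → count𝒜 u ρ ≡ count𝒜 y x
      count𝒜-same ¬m = count-cong (𝒜? u ρ) (𝒜? y x) (λ i m → to i (λ { refl → ¬m m }) m) from

      count𝒜-suc : 𝒜 u ρ k → count𝒜 u ρ ≡ suc (count𝒜 y x)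
      count𝒜-suc m = count-insert (𝒜? u ρ) (𝒜? y x) k m (W⇒¬𝒜 y x x∈W k ℕ.≤-refl) to (λ i _ → from i)

-- The closed form for s x, x s and s x s

module Candidate (n : ℕ) where

  open Lengths n
  open Bruhat n
  open Parabolic n
  open Hecke n
  open FixedIntervals n
  open A n
  open Group (symmetricGroup (suc n)) using (_∙_; _≈_)

  restrict : ∀ {p} {P : Set p} → Dec P → Poly → Poly
  restrict (yes _) p = p
  restrict (no _)  p = 0ₚ

  restrict-yes : ∀ {p} {P : Set p} (P? : Dec P) r → P → restrict P? r ≃ r
  restrict-yes (yes _) r p = ≃-refl
  restrict-yes (no ¬p) r p = contradiction p ¬p

  restrict-no : ∀ {p} {P : Set p} (P? : Dec P) r → ¬ P → restrict P? r ≃ 0ₚ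
  restrict-no (yes p) r ¬p = contradiction p ¬p
  restrict-no (no _)  r ¬p = ≃-refl

  abstract

    closedForm : S → S → Poly
    closedForm ρ u = restrict (u ≤? ρ) (1+q ^ₚ count𝒜 u ρ)

    closedForm-≤ : ∀ ρ u → u ≤ᴮ ρ → closedForm ρ u ≃ 1+q ^ₚ count𝒜 u ρ
    closedForm-≤ ρ u = restrict-yes (u ≤? ρ) (1+q ^ₚ count𝒜 u ρ)

    closedForm-≰ : ∀ ρ u → ¬ u ≤ᴮ ρ → closedForm ρ u ≃ 0ₚ
    closedForm-≰ ρ u = restrict-no (u ≤? ρ) (1+q ^ₚ count𝒜 u ρ)

  ≡⇒≃ : ∀ {p r} → p ≡ r → p ≃ r
  ≡⇒≃ refl = ≃-refl

  closedForm-transfer : ∀ ρ u x y → (u ≤ᴮ ρ → y ≤ᴮ x) → (y ≤ᴮ x → u ≤ᴮ ρ) →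
                        (y ≤ᴮ x → count𝒜 u ρ ≡ count𝒜 y x) → closedForm ρ u ≃ closedForm x y
  closedForm-transfer ρ u x y f g e with y ≤? x
  ... | yes y≤x = ≃-trans (closedForm-≤ ρ u (g y≤x))
                    (≃-trans (≡⇒≃ (cong (1+q ^ₚ_) (e y≤x))) (≃-sym (closedForm-≤ x y y≤x)))
  ... | no y≰x  = ≃-trans (closedForm-≰ ρ u (y≰x ∘ f)) (≃-sym (closedForm-≰ x y y≰x))

  closedForm-cong : ∀ ρ ρ′ u u′ → ρ ≈ ρ′ → u ≈ u′ → closedForm ρ u ≃ closedForm ρ′ u′
  closedForm-cong ρ ρ′ u u′ e f = closedForm-transfer ρ u ρ′ u′
    (λ p → ≤-respʳ ρ ρ′ e (≤-respˡ u u′ f p))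
    (λ p → ≤-respʳ ρ′ ρ (sym ∘ e) (≤-respˡ u′ u (sym ∘ f) p))
    (λ _ → count𝒜-cong u u′ ρ ρ′ f e)

  -- The candidate shares the familiar property P(u s, ρ) = P(u, ρ) for a descent s of ρ: the lower
  -- set of ρ is stable under s, and s changes nothing that 𝒜 reads.
  closedForm-∙s : ∀ k σ → Ascent σ k → W (toℕ k) (σ ∙ s k) → ∀ u →
                  closedForm (σ ∙ s k) (u ∙ s k) ≃ closedForm (σ ∙ s k) u
  closedForm-∙s k σ asc ρ∈W u = closedForm-transfer (σ ∙ s k) (u ∙ s k) (σ ∙ s k) u
    (λ p → case ≤∙s⇒ σ k p of λ
      { (inj₁ us≤σ)  → ⇒≤∙s σ k asc (inj₂ us≤σ)
      ; (inj₂ uss≤σ) → ⇒≤∙s σ k asc (inj₁ (≤-respˡ ((u ∙ s k) ∙ s k) u (cancelʳ u k) uss≤σ)) })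
    (λ p → case ≤∙s⇒ σ k p of λ
      { (inj₁ u≤σ)  → ⇒≤∙s σ k asc (inj₂ (≤-respˡ u ((u ∙ s k) ∙ s k) (sym ∘ cancelʳ u k) u≤σ))
      ; (inj₂ us≤σ) → ⇒≤∙s σ k asc (inj₁ us≤σ) })
    (λ _ → count𝒜-agreeˡ (σ ∙ s k) ρ∈W (Agree-∙s k u))

  W-s∙ : ∀ k x → W⁺ k x → W (toℕ k) (s k ∙ x)
  W-s∙ k x x∈W = W-∙ (s k) x (W-s k ℕ.≤-refl) (W-mono x x∈W)

  W-∙s : ∀ k x → W⁺ k x → W (toℕ k) (x ∙ s k)
  W-∙s k x x∈W = W-∙ x (s k) (W-mono x x∈W) (W-s k ℕ.≤-refl)

  -- If s x fixed k + 1, then x would take the value k at k + 1; but x fixes k. So a generator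
  -- occurring once is never counted.
  ¬NFix-s∙ : ∀ k x → W⁺ k x → ¬ NFix (s k ∙ x) k
  ¬NFix-s∙ k x x∈W (_ , e) = W⁺≢ k x x∈W (inject₁<suc k)
    (trans (sym (s-involutive k (x ⟨$⟩ʳ Fin.suc k))) (trans (cong (s k ⟨$⟩ʳ_) e) (s-ʳ k)))

  ¬NFix-∙s : ∀ k x → W⁺ k x → ¬ NFix (x ∙ s k) k
  ¬NFix-∙s k x x∈W (_ , e) = Fin.<⇒≢ (inject₁<suc k)
    (trans (sym (W⁺-fix k x x∈W)) (trans (cong (x ⟨$⟩ʳ_) (sym (s-ʳ k))) e))

  W⁺⁺ : Fin n → S → Set
  W⁺⁺ k = W (suc (suc (toℕ k)))

  W⁺⇒W⁺⁺ : ∀ k x → W⁺ k x → x ⟨$⟩ʳ Fin.suc k ≡ Fin.suc k → W⁺⁺ k x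
  W⁺⇒W⁺⁺ k x x∈W e i (s≤s i≤) with ℕ.m≤n⇒m<n∨m≡n i≤
  ... | inj₁ i< = x∈W i i<
  ... | inj₂ i≡ with Fin.toℕ-injective {i = i} {j = Fin.suc k} i≡
  ...   | refl = e

  -- k + 1 is fixed by s x s because k is fixed by x. If s k were absent from the product, the
  -- product would fix k, hence x would fix k + 1.
  NFix-s∙s : ∀ k x → W⁺ k x → ¬ x ⟨$⟩ʳ Fin.suc k ≡ Fin.suc k → NFix (s k ∙ (x ∙ s k)) k
  NFix-s∙s k x x∈W moves =
      (λ fix → moves (let ρ∈W⁺ = Fix⇒W (s k ∙ (x ∙ s k)) k (W-∙ (s k) (x ∙ s k) (W-s k ℕ.≤-refl) (W-∙s k x x∈W)) fix
                      in trans (cong (x ⟨$⟩ʳ_) (sym (s-ˡ k)))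
                           (trans (sym (s-involutive k _)) (trans (cong (s k ⟨$⟩ʳ_) (W⁺-fix k (s k ∙ (x ∙ s k)) ρ∈W⁺)) (s-ˡ k)))))
    , trans (cong (λ y → s k ⟨$⟩ʳ (x ⟨$⟩ʳ y)) (s-ʳ k)) (trans (cong (s k ⟨$⟩ʳ_) (W⁺-fix k x x∈W)) (s-ˡ k))

  module OneSided (k : Fin n) (x : S) (x∈W : W⁺ k x) where

    count𝒜-s∙ : ∀ u y → Agree k u y → count𝒜 u (s k ∙ x) ≡ count𝒜 y x
    count𝒜-s∙ u y a = count𝒜-same k (W-s∙ k x x∈W) x∈W a (Agree-s∙ k x) (¬NFix-s∙ k x x∈W ∘ proj₁)

    count𝒜-∙s : ∀ u y → Agree k u y → count𝒜 u (x ∙ s k) ≡ count𝒜 y x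
    count𝒜-∙s u y a = count𝒜-same k (W-∙s k x x∈W) x∈W a (Agree-∙s k x) (¬NFix-∙s k x x∈W ∘ proj₁)

    closedForm-s∙ : ∀ u → W⁺ k u → closedForm (s k ∙ x) u ≃ closedForm x u
    closedForm-s∙ u u∈W = closedForm-transfer (s k ∙ x) u x u
      (λ p → case proj₁ (≤s∙⇔ k x x∈W u) p of λ
        { (inj₁ u≤x) → u≤x ; (inj₂ su≤x) → contradiction (W-≤ su≤x x∈W) (s∙∉W⁺ k u u∈W) })
      (λ p → proj₂ (≤s∙⇔ k x x∈W u) (inj₁ p))
      (λ _ → count𝒜-s∙ u u (Agree-≈ u u (λ _ → refl)))

    closedForm-s∙′ : ∀ u → ¬ W⁺ k u → closedForm (s k ∙ x) u ≃ closedForm x (s k ∙ u)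
    closedForm-s∙′ u u∉W = closedForm-transfer (s k ∙ x) u x (s k ∙ u)
      (λ p → case proj₁ (≤s∙⇔ k x x∈W u) p of λ
        { (inj₁ u≤x) → contradiction (W-≤ u≤x x∈W) u∉W ; (inj₂ su≤x) → su≤x })
      (λ p → proj₂ (≤s∙⇔ k x x∈W u) (inj₂ p))
      (λ _ → count𝒜-s∙ u (s k ∙ u) (Agree-sym (Agree-s∙ k u)))

    -- Each u is y or s y for at most one y in `W⁺ k`, and 𝒜 gains nothing, so C_s C_x needs no
    -- correction.
    left-closedForm : ∀ u → left k (closedForm x) u ≃ closedForm (s k ∙ x) u
    left-closedForm u with W? (suc (toℕ k)) u
    ... | yes u∈W = ≃-sym (closedForm-s∙ u u∈W)
    ... | no u∉W  = ≃-sym (closedForm-s∙′ u u∉W)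

    closedForm-∉W : ∀ u → ¬ W⁺ k u → closedForm x u ≃ 0ₚ
    closedForm-∉W u u∉W = closedForm-≰ x u λ u≤x → u∉W (W-≤ u≤x x∈W)

    x-asc : Ascent x k
    x-asc = W⁺-ascent k x x∈W

    closedForm-xs : ∀ u → W⁺ k u → closedForm (x ∙ s k) u ≃ closedForm x u
    closedForm-xs u u∈W = closedForm-transfer (x ∙ s k) u x u
      (λ p → case ≤∙s⇒ x k p of λ
        { (inj₁ u≤x) → u≤x ; (inj₂ us≤x) → contradiction (W-≤ us≤x x∈W) (∙s∉W⁺ k u u∈W) })
      (λ p → ⇒≤∙s x k x-asc (inj₁ p))
      (λ _ → count𝒜-∙s u u (Agree-≈ u u (λ _ → refl)))

    closedForm-xs′ : ∀ u → ¬ W⁺ k u → closedForm (x ∙ s k) u ≃ closedForm x (u ∙ s k)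
    closedForm-xs′ u u∉W = closedForm-transfer (x ∙ s k) u x (u ∙ s k)
      (λ p → case ≤∙s⇒ x k p of λ
        { (inj₁ u≤x) → contradiction (W-≤ u≤x x∈W) u∉W ; (inj₂ us≤x) → us≤x })
      (λ p → ⇒≤∙s x k x-asc (inj₂ p))
      (λ _ → count𝒜-∙s u (u ∙ s k) (Agree-sym (Agree-∙s k u)))

    ascent⇒us∉W : ∀ u → Ascent u k → ¬ W⁺ k (u ∙ s k)
    ascent⇒us∉W u asc us∈W = Ascent⇒¬Ascent-∙s u k asc (W⁺-ascent k (u ∙ s k) us∈W)

    -- At most one of u and u s lies in `W⁺ k`, and then it is the shorter one; so the summand with
    -- the factor q always vanishes.
    right-closedForm : ∀ u → right k (closedForm x) u ≃ closedForm (x ∙ s k) u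
    right-closedForm u with ascent? u k
    ... | yes u-asc = ≃-trans
      (+-congˡ≃ (closedForm x u) (≃-trans (*-congˡ≃ q (closedForm-∉W (u ∙ s k) (ascent⇒us∉W u u-asc))) (*-zeroʳ≃ q)))
      (≃-trans (+-identityʳ≃ (closedForm x u)) (case W? (suc (toℕ k)) u of λ
        { (yes u∈W) → ≃-sym (closedForm-xs u u∈W)
        ; (no u∉W)  → ≃-trans (closedForm-∉W u u∉W)
                        (≃-sym (≃-trans (closedForm-xs′ u u∉W) (closedForm-∉W (u ∙ s k) (ascent⇒us∉W u u-asc)))) }))
    ... | no u-desc = ≃-trans
      (+-congˡ≃ (closedForm x (u ∙ s k)) (≃-trans (*-congˡ≃ q (closedForm-∉W u u∉W)) (*-zeroʳ≃ q)))
      (≃-trans (+-identityʳ≃ (closedForm x (u ∙ s k))) (≃-sym (closedForm-xs′ u u∉W)))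
      where
      u∉W : ¬ W⁺ k u
      u∉W u∈W = u-desc (W⁺-ascent k u u∈W)

  module TwoSided (k : Fin n) (x : S) (x∈W : W⁺ k x) (moves : ¬ x ⟨$⟩ʳ Fin.suc k ≡ Fin.suc k) where

    open OneSided k x x∈W

    σ ρ : S
    σ = s k ∙ x
    ρ = σ ∙ s k

    -- s y has the value k + 1 at k. At k + 1, y has a value above k + 1, which s leaves alone.
    s-desc : ∀ y → W⁺ k y → ¬ y ⟨$⟩ʳ Fin.suc k ≡ Fin.suc k → Ascent (s k ∙ y) k
    s-desc y y∈W y-moves = subst₂ _<_
      (sym (trans (cong (s k ⟨$⟩ʳ_) (W⁺-fix k y y∈W)) (s-ˡ k)))
      (sym (s-≢ k (W⁺≢ k y y∈W (inject₁<suc k)) y-moves))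
      (Fin.≤∧≢⇒< (W-≥ y y∈W ℕ.≤-refl) (y-moves ∘ sym))

    σ-asc : Ascent σ k
    σ-asc = s-desc x x∈W moves

    ρ∈W : W (toℕ k) ρ
    ρ∈W = W-∙ (s k) (x ∙ s k) (W-s k ℕ.≤-refl) (W-∙s k x x∈W)

    inv-ρ : inv ρ ≡ 2 + inv x
    inv-ρ = trans (inv-ascent σ k σ-asc) (cong suc (inv-s∙ k x x∈W))

    NFix-ρ : NFix ρ k
    NFix-ρ = NFix-cong (s k ∙ (x ∙ s k)) ρ (λ _ → refl) (NFix-s∙s k x x∈W moves)

    Agree-ρ : Agree k ρ x
    Agree-ρ = Agree-trans (Agree-∙s k σ) (Agree-s∙ k x)

    -- j is the index k + 1. The three conditions for k in 𝒜 hold: s k occurs twice in ρ, s j occurs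
    -- twice in x and hence counts for ρ, and s j is absent from y and hence from u.
    count𝒜-special : ∀ u y j → toℕ j ≡ suc (toℕ k) → NFix x j → Agree k u y → W⁺⁺ k y → count𝒜 u ρ ≡ suc (count𝒜 y x)
    count𝒜-special u y j j≡ nfix a y∈W⁺⁺ = count𝒜-suc k ρ∈W x∈W a Agree-ρ
      ( NFix-ρ , j , j≡ , NFix-agree (Agree-sym Agree-ρ) j k<j nfix
      , Agree.Fix-from a j k<j (W⇒Fix y j (subst (λ m → W (suc m) y) (sym j≡) y∈W⁺⁺)))
      where
      k<j : k < j
      k<j = ℕ.≤-reflexive (sym j≡)

    count𝒜-ordinary : ∀ u y → W⁺ k y → Agree k u y →
                  ¬ (W⁺⁺ k y × ∃[ j ] (toℕ j ≡ suc (toℕ k) × NFix x j)) → count𝒜 u ρ ≡ count𝒜 y x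
    count𝒜-ordinary u y y∈W a ¬special = count𝒜-same k ρ∈W x∈W a Agree-ρ
      λ (_ , j , j≡ , nfix , fix) → let k<j = ℕ.≤-reflexive (sym j≡) in ¬special
        ( subst (λ m → W (suc m) y) j≡
            (Fix⇒W y j (subst (λ m → W m y) (sym j≡) y∈W) (Agree.Fix-to a j k<j fix))
        , j , j≡ , NFix-agree Agree-ρ j k<j nfix )

    ∉W⁺⁺⇒moves : ∀ y → W⁺ k y → ¬ W⁺⁺ k y → ¬ y ⟨$⟩ʳ Fin.suc k ≡ Fin.suc k
    ∉W⁺⁺⇒moves y y∈W y∉W⁺⁺ e = y∉W⁺⁺ (W⁺⇒W⁺⁺ k y y∈W e)

    sys∈W⇒ : ∀ y → W⁺ k y → W⁺ k (s k ∙ (y ∙ s k)) → W⁺⁺ k y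
    sys∈W⇒ y y∈W sys∈W = W⁺⇒W⁺⁺ k y y∈W
      (trans (cong (y ⟨$⟩ʳ_) (sym (s-ˡ k))) (trans (sym (s-involutive k _))
        (trans (cong (s k ⟨$⟩ʳ_) (W⁺-fix k (s k ∙ (y ∙ s k)) sys∈W)) (s-ˡ k))))

    sys≈y : ∀ y → W⁺⁺ k y → s k ∙ (y ∙ s k) ≈ y
    sys≈y y y∈W⁺⁺ i = trans (cong (s k ⟨$⟩ʳ_) (sym (s∙-commute k y y∈W⁺⁺ i))) (s-involutive k _)

    ≤ρ⇒ : ∀ u → u ≤ᴮ ρ → (u ≤ᴮ x ⊎ s k ∙ u ≤ᴮ x) ⊎ (u ∙ s k ≤ᴮ x ⊎ s k ∙ (u ∙ s k) ≤ᴮ x)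
    ≤ρ⇒ u p = Sum.map (proj₁ (≤s∙⇔ k x x∈W u)) (proj₁ (≤s∙⇔ k x x∈W (u ∙ s k))) (≤∙s⇒ σ k p)

    ⇒≤ρ : ∀ u → (u ≤ᴮ x ⊎ s k ∙ u ≤ᴮ x) ⊎ (u ∙ s k ≤ᴮ x ⊎ s k ∙ (u ∙ s k) ≤ᴮ x) → u ≤ᴮ ρ
    ⇒≤ρ u p = ⇒≤∙s σ k σ-asc (Sum.map (proj₂ (≤s∙⇔ k x x∈W u)) (proj₂ (≤s∙⇔ k x x∈W (u ∙ s k))) p)

    -- Only y and s y s can lie in `W⁺ k`, and s y s does so only if y commutes with s, in which
    -- case it is y.
    ≤ρ⇒≤x : ∀ y → W⁺ k y → y ≤ᴮ ρ → y ≤ᴮ x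
    ≤ρ⇒≤x y y∈W p with ≤ρ⇒ y p
    ... | inj₁ (inj₁ y≤x)  = y≤x
    ... | inj₁ (inj₂ sy≤x) = contradiction (W-≤ sy≤x x∈W) (s∙∉W⁺ k y y∈W)
    ... | inj₂ (inj₁ ys≤x) = contradiction (W-≤ ys≤x x∈W) (∙s∉W⁺ k y y∈W)
    ... | inj₂ (inj₂ sys≤x) = ≤-respˡ (s k ∙ (y ∙ s k)) y (sys≈y y (sys∈W⇒ y y∈W (W-≤ sys≤x x∈W))) sys≤x

    closedForm-ordinary : ∀ y → W⁺ k y → ¬ (W⁺⁺ k y × ∃[ j ] (toℕ j ≡ suc (toℕ k) × NFix x j)) →
                          closedForm ρ y ≃ closedForm x y
    closedForm-ordinary y y∈W ¬special = closedForm-transfer ρ y x y (≤ρ⇒≤x y y∈W)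
      (λ y≤x → ⇒≤ρ y (inj₁ (inj₁ y≤x)))
      (λ _ → count𝒜-ordinary y y y∈W (Agree-≈ y y (λ _ → refl)) ¬special)

    closedForm-special : ∀ y j → toℕ j ≡ suc (toℕ k) → NFix x j → W⁺⁺ k y →
                         closedForm ρ y ≃ closedForm x y +ₚ q *ₚ closedForm x y
    closedForm-special y j j≡ nfix y∈W⁺⁺ with y ≤? x
    ... | yes y≤x = ≃-trans (≃-trans (closedForm-≤ ρ y (⇒≤ρ y (inj₁ (inj₁ y≤x))))
            (≃-trans (≡⇒≃ (cong (1+q ^ₚ_) (count𝒜-special y y j j≡ nfix (Agree-≈ y y (λ _ → refl)) y∈W⁺⁺)))
              (≃-trans (*-congʳ≃ (1+q ^ₚ count𝒜 y x) 1+q≃) (expand q (1+q ^ₚ count𝒜 y x)))))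
            (≃-sym (+-cong≃ (closedForm-≤ x y y≤x) (*-congˡ≃ q (closedForm-≤ x y y≤x))))
      where
      expand : ∀ (a p : Poly) → (1ₚ +ₚ a) *ₚ p ≃ p +ₚ a *ₚ p
      expand = solve-∀ polyACR
    ... | no y≰x = ≃-trans (closedForm-≰ ρ y (y≰x ∘ ≤ρ⇒≤x y (W-mono y y∈W⁺⁺))) 
            (≃-sym (+-cong≃ (closedForm-≰ x y y≰x) (≃-trans (*-congˡ≃ q (closedForm-≰ x y y≰x)) (*-zeroʳ≃ q))))

    closedForm-sρ : ∀ u → closedForm ρ (s k ∙ u) ≃ closedForm ρ u
    closedForm-sρ u = closedForm-transfer ρ (s k ∙ u) ρ u
      (λ p → ⇒≤ρ u (case ≤ρ⇒ (s k ∙ u) p of λ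
        { (inj₁ (inj₁ a)) → inj₁ (inj₂ a)
        ; (inj₁ (inj₂ a)) → inj₁ (inj₁ (≤-respˡ (s k ∙ (s k ∙ u)) u (cancelˡ k u) a))
        ; (inj₂ (inj₁ a)) → inj₂ (inj₂ (≤-respˡ ((s k ∙ u) ∙ s k) (s k ∙ (u ∙ s k)) (λ _ → refl) a))
        ; (inj₂ (inj₂ a)) → inj₂ (inj₁ (≤-respˡ (s k ∙ ((s k ∙ u) ∙ s k)) (u ∙ s k) (cancelˡ k (u ∙ s k)) a)) }))
      (λ p → ⇒≤ρ (s k ∙ u) (case ≤ρ⇒ u p of λ
        { (inj₁ (inj₁ a)) → inj₁ (inj₂ (≤-respˡ u (s k ∙ (s k ∙ u)) (sym ∘ cancelˡ k u) a))
        ; (inj₁ (inj₂ a)) → inj₁ (inj₁ a)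
        ; (inj₂ (inj₁ a)) → inj₂ (inj₂ (≤-respˡ (u ∙ s k) (s k ∙ ((s k ∙ u) ∙ s k)) (sym ∘ cancelˡ k (u ∙ s k)) a))
        ; (inj₂ (inj₂ a)) → inj₂ (inj₁ (≤-respˡ (s k ∙ (u ∙ s k)) ((s k ∙ u) ∙ s k) (λ _ → refl) a)) }))
      (λ _ → count𝒜-agreeˡ ρ ρ∈W (Agree-s∙ k u))

    -- Suppose y = s u s lies in `W⁺ k`. Either y commutes with s, and u = y would be in `W⁺⁺ k`; or
    -- s y = u s ascends at k, against the ascent of u.
    sus∉W : ∀ u → Ascent u k → ¬ W⁺⁺ k u → ¬ W⁺ k (s k ∙ (u ∙ s k))
    sus∉W u u-asc u∉W⁺⁺ sus∈W with W? (suc (suc (toℕ k))) (s k ∙ (u ∙ s k))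
    ... | yes y∈W⁺⁺ = u∉W⁺⁺ (W-cong y u (λ i → trans (sym (sys≈y y y∈W⁺⁺ i)) (u≈ i)) y∈W⁺⁺)
      where
      y : S
      y = s k ∙ (u ∙ s k)
      u≈ : s k ∙ (y ∙ s k) ≈ u
      u≈ i = trans (s-involutive k _) (cancelʳ u k i)
    ... | no y∉W⁺⁺ = Ascent⇒¬Ascent-∙s u k u-asc (Ascent-cong (s k ∙ (s k ∙ (u ∙ s k))) (u ∙ s k) k (cancelˡ k (u ∙ s k))
            (s-desc (s k ∙ (u ∙ s k)) sus∈W (∉W⁺⁺⇒moves (s k ∙ (u ∙ s k)) sus∈W y∉W⁺⁺)))

    ascent⇒su∉W⁺⁺ : ∀ u → Ascent u k → ¬ W⁺⁺ k (s k ∙ u)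
    ascent⇒su∉W⁺⁺ u u-asc su∈W⁺⁺ = ascent⇒us∉W u u-asc (W-cong (s k ∙ u) (u ∙ s k) eq (W-mono (s k ∙ u) su∈W⁺⁺))
      where
      eq : s k ∙ u ≈ u ∙ s k
      eq i = trans (sym (cancelʳ (s k ∙ u) k i))
        (trans (sym (s∙-commute k (s k ∙ u) su∈W⁺⁺ (s k ⟨$⟩ʳ i))) (s-involutive k (u ⟨$⟩ʳ (s k ⟨$⟩ʳ i))))

-- Products of C_s and bar invariance of the candidate

module Codes (n : ℕ) where

  open Lengths n
  open Bruhat n
  open Parabolic n
  open Hecke n
  open FixedIntervals n
  open Candidate n
  open A n
  open Group (symmetricGroup (suc n)) using (_∙_; _≈_; ε)

  module TwoSidedValues (k : Fin n) (x : S) (x∈W : W⁺ k x) (moves : ¬ x ⟨$⟩ʳ Fin.suc k ≡ Fin.suc k) where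

    open OneSided k x x∈W
    open TwoSided k x x∈W moves

    product : S → Poly
    product u = closedForm σ u +ₚ q *ₚ closedForm σ (u ∙ s k)

    -- Here u commutes with s, so T_s T_u T_s = T_u T_s² contributes to T_u as well, with
    -- coefficient q.
    product-W⁺⁺ : ∀ u → Ascent u k → W⁺⁺ k u → product u ≃ closedForm x u +ₚ q *ₚ closedForm x u
    product-W⁺⁺ u u-asc u∈W⁺⁺ = +-cong≃ (closedForm-s∙ u (W-mono u u∈W⁺⁺)) (*-congˡ≃ q (≃-trans
      (closedForm-s∙′ (u ∙ s k) (ascent⇒us∉W u u-asc))
      (closedForm-cong x x (s k ∙ (u ∙ s k)) u (λ _ → refl) (sys≈y u u∈W⁺⁺))))

    private
      product-drop : ∀ u → Ascent u k → ¬ W⁺⁺ k u → product u ≃ closedForm σ u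
      product-drop u u-asc u∉W⁺⁺ = ≃-trans
        (+-congˡ≃ (closedForm σ u) (≃-trans
          (*-congˡ≃ q (≃-trans (closedForm-s∙′ (u ∙ s k) (ascent⇒us∉W u u-asc))
                               (closedForm-∉W (s k ∙ (u ∙ s k)) (sus∉W u u-asc u∉W⁺⁺))))
          (*-zeroʳ≃ q)))
        (+-identityʳ≃ (closedForm σ u))

    product-W⁺ : ∀ u → Ascent u k → W⁺ k u → ¬ W⁺⁺ k u → product u ≃ closedForm x u
    product-W⁺ u u-asc u∈W u∉W⁺⁺ = ≃-trans (product-drop u u-asc u∉W⁺⁺) (closedForm-s∙ u u∈W)

    product-∉W⁺ : ∀ u → Ascent u k → ¬ W⁺ k u → product u ≃ closedForm ρ u
    product-∉W⁺ u u-asc u∉W = ≃-trans (product-drop u u-asc (u∉W ∘ W-mono u))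
      (≃-trans (closedForm-s∙′ u u∉W) (case W? (suc (toℕ k)) (s k ∙ u) of λ
        { (yes su∈W) → ≃-trans
            (≃-sym (closedForm-ordinary (s k ∙ u) su∈W (ascent⇒su∉W⁺⁺ u u-asc ∘ proj₁)))
            (closedForm-sρ u)
        ; (no su∉W)  → ≃-trans (closedForm-∉W (s k ∙ u) su∉W) (≃-sym (closedForm-≰ ρ u λ u≤ρ → case ≤ρ⇒ u u≤ρ of λ
            { (inj₁ (inj₁ a)) → u∉W (W-≤ a x∈W)
            ; (inj₁ (inj₂ a)) → su∉W (W-≤ a x∈W)
            ; (inj₂ (inj₁ a)) → ascent⇒us∉W u u-asc (W-≤ a x∈W)
            ; (inj₂ (inj₂ a)) → sus∉W u u-asc (u∉W ∘ W-mono u) (W-≤ a x∈W) })) }))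

    right-ascent : ∀ u → Ascent u k → right k (closedForm σ) u ≃ product u
    right-ascent u u-asc with ascent? u k
    ... | yes _     = ≃-refl
    ... | no u-desc = contradiction u-asc u-desc

    right-descent : ∀ u → ¬ Ascent u k → right k (closedForm σ) u ≃ product (u ∙ s k)
    right-descent u u-desc with ascent? u k
    ... | yes u-asc = contradiction u-asc u-desc
    ... | no _      = +-congˡ≃ (closedForm σ (u ∙ s k)) (*-congˡ≃ q
          (closedForm-cong σ σ u ((u ∙ s k) ∙ s k) (λ _ → refl) (sym ∘ cancelʳ u k)))

    module _ (j : Fin n) (j≡ : toℕ j ≡ suc (toℕ k)) (nfix : NFix x j) where

      private
        ascending : ∀ u → Ascent u k → product u ≃ closedForm ρ u
        ascending u u-asc = case W? (suc (suc (toℕ k))) u of λ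
          { (yes u∈W⁺⁺) → ≃-trans (product-W⁺⁺ u u-asc u∈W⁺⁺) (≃-sym (closedForm-special u j j≡ nfix u∈W⁺⁺))
          ; (no u∉W⁺⁺) → case W? (suc (toℕ k)) u of λ
            { (yes u∈W) → ≃-trans (product-W⁺ u u-asc u∈W u∉W⁺⁺) (≃-sym (closedForm-ordinary u u∈W (u∉W⁺⁺ ∘ proj₁)))
            ; (no u∉W)  → product-∉W⁺ u u-asc u∉W } }

      -- Both sides agree on u and u s, which reduces descents to ascents; there the extra q f_x(u)
      -- on `W⁺⁺ k` is precisely the new factor of the candidate.
      right-double : ∀ u → right k (closedForm σ) u ≃ closedForm ρ u
      right-double u = case ascent? u k of λ
        { (yes u-asc) → ≃-trans (right-ascent u u-asc) (ascending u u-asc)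
        ; (no u-desc) → ≃-trans (right-descent u u-desc)
            (≃-trans (ascending (u ∙ s k) (¬Ascent⇒Ascent-∙s u k u-desc)) (closedForm-∙s k σ σ-asc ρ∈W u)) }

    module _ (¬nfix : ∀ j → toℕ j ≡ suc (toℕ k) → ¬ NFix x j)
             (z : S) (z∈W : W⁺⁺ k z) (x~z : ∀ u → W⁺⁺ k u → closedForm x u ≃ closedForm z u) where

      private
        module Z = OneSided k z (W-mono z z∈W)

        τ : S
        τ = s k ∙ z

        τ-∙s : ∀ u → closedForm τ (u ∙ s k) ≃ closedForm τ u
        τ-∙s u = ≃-trans (closedForm-cong τ (z ∙ s k) (u ∙ s k) (u ∙ s k) (s∙-commute k z z∈W) (λ _ → refl))
          (≃-trans (closedForm-∙s k z Z.x-asc (W-∙s k z (W-mono z z∈W)) u)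
                   (closedForm-cong (z ∙ s k) τ u u (sym ∘ s∙-commute k z z∈W) (λ _ → refl)))

        z-vanish : ∀ u → ¬ W⁺⁺ k u → closedForm z u ≃ 0ₚ
        z-vanish u u∉W⁺⁺ = closedForm-≰ z u λ u≤z → u∉W⁺⁺ (W-≤ u≤z z∈W)

        cancel : ∀ (a p : Poly) → p +ₚ a *ₚ p +ₚ (-ₚ (a *ₚ p)) ≃ p
        cancel = solve-∀ polyACR

        no-correction : ∀ {p} r → p ≃ 0ₚ → r +ₚ (-ₚ (q *ₚ p)) ≃ r
        no-correction r e = ≃-trans (+-congˡ≃ r (neg-cong≃ (≃-trans (*-congˡ≃ q e) (*-zeroʳ≃ q)))) (+-identityʳ≃ r)

        -- The product exceeds the candidate only on `W⁺⁺ k`, by q f_x(u). By `x~z` this is q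
        -- f_z(u), the correction there; at all other ascents the correction is zero.
        ascending : ∀ u → Ascent u k → product u +ₚ (-ₚ (q *ₚ closedForm τ u)) ≃ closedForm ρ u
        ascending u u-asc = case W? (suc (suc (toℕ k))) u of λ
          { (yes u∈W⁺⁺) → ≃-trans
              (+-cong≃ (product-W⁺⁺ u u-asc u∈W⁺⁺) (neg-cong≃ (*-congˡ≃ q (≃-trans
                (Z.closedForm-s∙ u (W-mono u u∈W⁺⁺)) (≃-sym (x~z u u∈W⁺⁺))))))
              (≃-trans (cancel q (closedForm x u)) (≃-sym (closedForm-ordinary u (W-mono u u∈W⁺⁺)
                λ (_ , j , j≡ , nfix) → ¬nfix j j≡ nfix)))
          ; (no u∉W⁺⁺) → case W? (suc (toℕ k)) u of λ
            { (yes u∈W) → ≃-trans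
                (no-correction (product u) (≃-trans (Z.closedForm-s∙ u u∈W) (z-vanish u u∉W⁺⁺)))
                (≃-trans (product-W⁺ u u-asc u∈W u∉W⁺⁺) (≃-sym (closedForm-ordinary u u∈W (u∉W⁺⁺ ∘ proj₁))))
            ; (no u∉W)  → ≃-trans
                (no-correction (product u) (≃-trans (Z.closedForm-s∙′ u u∉W) (z-vanish (s k ∙ u) (ascent⇒su∉W⁺⁺ u u-asc))))
                (product-∉W⁺ u u-asc u∉W) } }

      right-single : ∀ u → right k (closedForm σ) u +ₚ (-ₚ (q *ₚ closedForm (s k ∙ z) u)) ≃ closedForm ρ u
      right-single u = case ascent? u k of λ
        { (yes u-asc) → ≃-trans (+-cong≃ (right-ascent u u-asc) ≃-refl) (ascending u u-asc)
        ; (no u-desc) → ≃-trans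
            (+-cong≃ (right-descent u u-desc) (neg-cong≃ (*-congˡ≃ q (≃-sym (τ-∙s u)))))
            (≃-trans (ascending (u ∙ s k) (¬Ascent⇒Ascent-∙s u k u-desc)) (closedForm-∙s k σ σ-asc ρ∈W u)) }

  -- The elements below the transposition (k , n), built from the innermost
  -- generator outwards: each s k occurs on the left, on the right, or on both sides
  -- of an element of the subgroup generated by the s j with j > k.
  data Code : ℕ → S → Set where
    one   : ∀ {k ρ} → ρ ≈ ε → Code k ρ
    skip  : ∀ {k ρ} → Code (suc k) ρ → Code k ρ
    onˡ   : ∀ {k ρ} j x → toℕ j ≡ k → Code (suc k) x → ρ ≈ s j ∙ x → Code k ρ
    onʳ   : ∀ {k ρ} j x → toℕ j ≡ k → Code (suc k) x → ρ ≈ x ∙ s j → Code k ρ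
    onˡʳ  : ∀ {k ρ} j x → toℕ j ≡ k → Code (suc k) x → ¬ x ⟨$⟩ʳ Fin.suc j ≡ Fin.suc j →
            ρ ≈ (s j ∙ x) ∙ s j → Code k ρ

  Code⇒W : ∀ {k ρ} → Code k ρ → W k ρ
  Code⇒W {k} {ρ} (one e)               = W-cong ε ρ (sym ∘ e) (λ _ _ → refl)
  Code⇒W {k} {ρ} (skip c)              = W-mono ρ (Code⇒W c)
  Code⇒W {k} {ρ} (onˡ j x refl c e)   = W-cong (s j ∙ x) ρ (sym ∘ e) (W-s∙ j x (Code⇒W c))
  Code⇒W {k} {ρ} (onʳ j x refl c e)  = W-cong (x ∙ s j) ρ (sym ∘ e) (W-∙s j x (Code⇒W c))
  Code⇒W {k} {ρ} (onˡʳ j x refl c m e) = W-cong ((s j ∙ x) ∙ s j) ρ (sym ∘ e)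
    (W-∙ (s j ∙ x) (s j) (W-s∙ j x (Code⇒W c)) (W-s j ℕ.≤-refl))

  -- x can move j + 1 only upwards, which leaves room for a further generator.
  successor : ∀ j x → W⁺ j x → ¬ x ⟨$⟩ʳ Fin.suc j ≡ Fin.suc j → ∃[ j′ ] toℕ j′ ≡ suc (toℕ j)
  successor j x x∈W moves = fromℕ< j+1<n , Fin.toℕ-fromℕ< j+1<n
    where
    j+1<n : suc (toℕ j) ℕ.< n
    j+1<n = ℕ.s<s⁻¹ (ℕ.≤-<-trans (Fin.≤∧≢⇒< (W-≥ x x∈W ℕ.≤-refl) (moves ∘ sym)) (Fin.toℕ<n _))

  module _ (R : S → S → Poly) (isR : IsRFamily R) where

    open RFamily R isR
    open SelfDuality R isR

    -- What `right-single` and `selfDual-minus` need of the z left after removing a single s k from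
    -- ρ: invariance, the length, and equal coefficients wherever s k does not occur.
    Single : ℕ → S → Set
    Single k ρ = ∃[ z ] (W (suc k) z × SelfDual (suc k) (inv z) (closedForm z) × inv ρ ≡ suc (inv z) ×
                         (∀ u → W (suc k) u → closedForm ρ u ≃ closedForm z u))

    -- If s j occurs in ρ, then it occurs either twice or once.
    Occurrence : ℕ → S → Set
    Occurrence k ρ = ∀ j → toℕ j ≡ k → ¬ ρ ⟨$⟩ʳ inject₁ j ≡ inject₁ j → NFix ρ j ⊎ (¬ NFix ρ j × Single k ρ)

    selfDual-≈ : ∀ {k} σ ρ → ρ ≈ σ → SelfDual k (inv σ) (closedForm σ) → SelfDual k (inv ρ) (closedForm ρ)
    selfDual-≈ {k} σ ρ e d = subst (λ L → SelfDual k L (closedForm ρ)) (inv-cong σ ρ (sym ∘ e))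
      (selfDual-cong (λ u → closedForm-cong σ ρ u u (sym ∘ e) (λ _ → refl)) d)

    fixes : ∀ {k ρ} j → toℕ j ≡ k → W (suc k) ρ → ρ ⟨$⟩ʳ inject₁ j ≡ inject₁ j
    fixes {ρ = ρ} j refl = W⁺-fix j ρ

    selfDual-s∙ : ∀ j x → W⁺ j x → SelfDual (suc (toℕ j)) (inv x) (closedForm x) →
                  SelfDual (toℕ j) (inv (s j ∙ x)) (closedForm (s j ∙ x))
    selfDual-s∙ j x x∈W d = subst (λ L → SelfDual (toℕ j) L (closedForm (s j ∙ x))) (sym (inv-s∙ j x x∈W))
      (selfDual-cong (OneSided.left-closedForm j x x∈W) (selfDual-left j d))

    selfDual-∙s : ∀ j x → W⁺ j x → SelfDual (suc (toℕ j)) (inv x) (closedForm x) →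
                  SelfDual (toℕ j) (inv (x ∙ s j)) (closedForm (x ∙ s j))
    selfDual-∙s j x x∈W d = subst (λ L → SelfDual (toℕ j) L (closedForm (x ∙ s j)))
      (sym (inv-ascent x j (W⁺-ascent j x x∈W)))
      (selfDual-cong (OneSided.right-closedForm j x x∈W) (selfDual-right j ℕ.≤-refl (selfDual-mono d)))

    selfDual-s∙s : ∀ j x → W⁺ j x → (moves : ¬ x ⟨$⟩ʳ Fin.suc j ≡ Fin.suc j) →
                   SelfDual (suc (toℕ j)) (inv x) (closedForm x) → Occurrence (suc (toℕ j)) x →
                   SelfDual (toℕ j) (inv ((s j ∙ x) ∙ s j)) (closedForm ((s j ∙ x) ∙ s j))
    selfDual-s∙s j x x∈W moves d occ with successor j x x∈W moves
    -- Position `Fin.suc j` is `inject₁ j′`, so `moves` says that s j′ occurs in x.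
    ... | j′ , j′≡ with occ j′ j′≡ (λ e → moves (subst (λ i → x ⟨$⟩ʳ i ≡ i)
                          (Fin.toℕ-injective (trans (Fin.toℕ-inject₁ j′) j′≡)) e))
    ... | inj₁ nfix = subst (λ L → SelfDual (toℕ j) L (closedForm ((s j ∙ x) ∙ s j)))
            (sym (inv-ascent σ j σ-asc))
            (selfDual-cong (right-double j′ j′≡ nfix) (selfDual-right j ℕ.≤-refl (selfDual-s∙ j x x∈W d)))
      where
      open TwoSided j x x∈W moves
      open TwoSidedValues j x x∈W moves
    ... | inj₂ (¬nfix , z , z∈W , z-dual , inv-x , x~z) =
            subst (λ L → SelfDual (toℕ j) L (closedForm ((s j ∙ x) ∙ s j))) L≡
              (selfDual-cong (right-single (λ i i≡ → ¬nfix ∘ subst (NFix x) (Fin.toℕ-injective (trans i≡ (sym j′≡)))) z z∈W x~z)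
                (selfDual-minus (subst (λ L → SelfDual (toℕ j) L (right j (closedForm σ))) L′≡
                              (selfDual-right j ℕ.≤-refl (selfDual-s∙ j x x∈W d)))
                            (selfDual-s∙ j z (W-mono z z∈W) (selfDual-mono z-dual))))
      where
      open TwoSided j x x∈W moves
      open TwoSidedValues j x x∈W moves
      -- x is longer than z by one and the right factor s j adds one more: the gap of 2 that
      -- `selfDual-minus` demands.
      L′≡ : suc (inv (s j ∙ x)) ≡ 2 + inv (s j ∙ z)
      L′≡ = cong suc (trans (inv-s∙ j x x∈W) (cong suc (trans inv-x (sym (inv-s∙ j z (W-mono z z∈W))))))
      L≡ : 2 + inv (s j ∙ z) ≡ inv ((s j ∙ x) ∙ s j)
      L≡ = trans (sym L′≡) (sym (inv-ascent σ j σ-asc))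

    code-selfDual : ∀ {k ρ} → Code k ρ → SelfDual k (inv ρ) (closedForm ρ) × Occurrence k ρ
    code-selfDual {k} {ρ} (one ρ≈ε) =
        selfDual-≈ ε ρ ρ≈ε (subst (λ L → SelfDual k L (closedForm ε)) (sym inv-ε) (selfDual-cong value-ε selfDual-ε))
      , λ j j≡ moves → contradiction (ρ≈ε (inject₁ j)) moves
      where
      value-ε : ∀ u → δ u ε ≃ closedForm ε u
      value-ε u = case u ≈? ε of λ
        { (yes u≈ε) → ≃-trans (δ-≈ u ε (sym ∘ u≈ε)) (≃-sym (≃-trans
            (closedForm-≤ ε u (done u≈ε))
            (≡⇒≃ (cong (1+q ^ₚ_) (trans (count𝒜-cong u ε ε ε u≈ε (λ _ → refl)) (count𝒜-refl ε))))))
        ; (no u≉ε) → ≃-trans (δ-≉ u ε λ e → u≉ε (sym ∘ e)) (≃-sym (closedForm-≰ ε u (u≉ε ∘ ≤ε⇒≈ε))) }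
    code-selfDual {k} {ρ} (skip c) =
        selfDual-mono (proj₁ (code-selfDual c))
      , λ j j≡ moves → contradiction (fixes {ρ = ρ} j j≡ (Code⇒W c)) moves
    code-selfDual {k} {ρ} (onˡ j x refl c e) with code-selfDual c
    ... | d , _ =
        selfDual-≈ (s j ∙ x) ρ e (selfDual-s∙ j x x∈W d)
      , λ i i≡ _ → inj₂
        ( (λ nfix → ¬NFix-s∙ j x x∈W (NFix-cong ρ (s j ∙ x) e (subst (NFix ρ) (Fin.toℕ-injective i≡) nfix)))
        , x , x∈W , d , trans (inv-cong ρ (s j ∙ x) e) (inv-s∙ j x x∈W)
        , λ u u∈W → ≃-trans (closedForm-cong ρ (s j ∙ x) u u e (λ _ → refl)) (OneSided.closedForm-s∙ j x x∈W u u∈W) )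
      where
      x∈W : W⁺ j x
      x∈W = Code⇒W c
    code-selfDual {k} {ρ} (onʳ j x refl c e) with code-selfDual c
    ... | d , _ =
        selfDual-≈ (x ∙ s j) ρ e (selfDual-∙s j x x∈W d)
      , λ i i≡ _ → inj₂
        ( (λ nfix → ¬NFix-∙s j x x∈W (NFix-cong ρ (x ∙ s j) e (subst (NFix ρ) (Fin.toℕ-injective i≡) nfix)))
        , x , x∈W , d , trans (inv-cong ρ (x ∙ s j) e) (inv-ascent x j (W⁺-ascent j x x∈W))
        , λ u u∈W → ≃-trans (closedForm-cong ρ (x ∙ s j) u u e (λ _ → refl)) (OneSided.closedForm-xs j x x∈W u u∈W) )
      where
      x∈W : W⁺ j x
      x∈W = Code⇒W c
    code-selfDual {k} {ρ} (onˡʳ j x refl c moves e) with code-selfDual c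
    ... | d , occ =
        selfDual-≈ ((s j ∙ x) ∙ s j) ρ e (selfDual-s∙s j x x∈W moves d occ)
      , λ i i≡ _ → inj₁ (subst (NFix ρ) (Fin.toℕ-injective (sym i≡))
          (NFix-cong ((s j ∙ x) ∙ s j) ρ (sym ∘ e) (TwoSided.NFix-ρ j x x∈W moves)))
      where
      x∈W : W⁺ j x
      x∈W = Code⇒W c

-- The degree bound

coeff-1+q^ : ∀ m i → m ℕ.< i → coeff (1+q ^ₚ m) i ≡ 0ℤ
coeff-1+q^ zero    (suc i) _         = refl
coeff-1+q^ (suc m) (suc i) (s≤s m<i) = trans
  (at (*-congʳ≃ (1+q ^ₚ m) 1+q≃) (suc i))
  (trans (at (*-distribʳ≃ (1+q ^ₚ m) 1ₚ q) (suc i))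
  (trans (coeff-+ (1ₚ *ₚ (1+q ^ₚ m)) (q *ₚ (1+q ^ₚ m)) (suc i))
  (cong₂ ℤ._+_
    (trans (at (*-identityˡ≃ (1+q ^ₚ m)) (suc i)) (coeff-1+q^ m (suc i) (ℕ.m<n⇒m<1+n m<i)))
    (trans (coeff-q*-suc (1+q ^ₚ m) i) (coeff-1+q^ m i m<i)))))

module Degree (n : ℕ) where

  open Lengths n
  open Bruhat n
  open Parabolic n
  open Hecke n
  open FixedIntervals n
  open Candidate n
  open Codes n
  open A n
  open Group (symmetricGroup (suc n)) using (_∙_; _≈_; ε)

  -- For (1+q)^c the degree bound reads 2c < ℓ(ρ) - ℓ(u), that is, `weight u ρ` is less than
  -- `inv ρ`.
  weight : S → S → ℕ
  weight u ρ = count𝒜 u ρ + count𝒜 u ρ + inv u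

  -- The second bound is the stronger one that the induction needs when ρ becomes the
  -- middle of s ρ s, in which case it contributes to 𝒜.
  Bounds : ℕ → S → S → Set
  Bounds k ρ u =
    (¬ u ≈ ρ → suc (weight u ρ) ℕ.≤ inv ρ) ×
    (∀ j → toℕ j ≡ k → NFix ρ j → Fix u j → 2 + weight u ρ ℕ.≤ inv ρ)

  weight-cong : ∀ u ρ σ → ρ ≈ σ → weight u ρ ≡ weight u σ
  weight-cong u ρ σ e = cong (λ c → c + c + inv u) (count𝒜-cong u u ρ σ (λ _ → refl) e)

  bounds-≈ : ∀ {k} σ ρ u → ρ ≈ σ → Bounds k σ u → Bounds k ρ u
  bounds-≈ σ ρ u e (strict , nfixed) =
      (λ u≉ρ → subst₂ (λ a b → suc a ℕ.≤ b) (sym (weight-cong u ρ σ e)) (sym (inv-cong ρ σ e))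
        (strict λ u≈σ → u≉ρ λ i → trans (u≈σ i) (sym (e i))))
    , (λ j j≡ nfix fix → subst₂ (λ a b → 2 + a ℕ.≤ b) (sym (weight-cong u ρ σ e)) (sym (inv-cong ρ σ e))
        (nfixed j j≡ (NFix-cong ρ σ e nfix) fix))

  bounds⇒≤ : ∀ {k} ρ u → Bounds k ρ u → weight u ρ ℕ.≤ inv ρ
  bounds⇒≤ ρ u (strict , _) with u ≈? ρ
  ... | no u≉ρ  = ℕ.<⇒≤ (strict u≉ρ)
  ... | yes u≈ρ = ℕ.≤-reflexive (trans
    (cong (λ c → c + c + inv u) (trans (count𝒜-cong u ρ ρ ρ u≈ρ (λ _ → refl)) (count𝒜-refl ρ)))
    (inv-cong u ρ u≈ρ))

  weight-suc : ∀ {u y ρ x} → count𝒜 u ρ ≡ count𝒜 y x → inv u ≡ suc (inv y) → weight u ρ ≡ suc (weight y x)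
  weight-suc {u} {y} {ρ} {x} c i = trans (cong₂ (λ a b → a + a + b) c i) (ℕ.+-suc (count𝒜 y x + count𝒜 y x) (inv y))

  weight-same : ∀ {u y ρ x} → count𝒜 u ρ ≡ count𝒜 y x → inv u ≡ inv y → weight u ρ ≡ weight y x
  weight-same c i = cong₂ (λ a b → a + a + b) c i

  inv-left : ∀ k u x → W⁺ k x → s k ∙ u ≤ᴮ x → inv u ≡ suc (inv (s k ∙ u))
  inv-left k u x x∈W su≤x = trans (inv-cong u (s k ∙ (s k ∙ u)) (sym ∘ cancelˡ k u)) (inv-s∙ k (s k ∙ u) (W-≤ su≤x x∈W))

  inv-right : ∀ k u x → W⁺ k x → u ∙ s k ≤ᴮ x → inv u ≡ suc (inv (u ∙ s k))
  inv-right k u x x∈W us≤x = trans (inv-cong u ((u ∙ s k) ∙ s k) (sym ∘ cancelʳ u k))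
    (inv-ascent (u ∙ s k) k (W⁺-ascent k (u ∙ s k) (W-≤ us≤x x∈W)))

  module _ (k : Fin n) (x : S) (x∈W : W⁺ k x) (bounds : ∀ u → u ≤ᴮ x → Bounds (suc (toℕ k)) x u) where

    open OneSided k x x∈W

    private
      vacuous : ∀ {ℓ} {A : Set ℓ} σ → ¬ NFix σ k → ∀ j → toℕ j ≡ toℕ k → NFix σ j → A
      vacuous σ ¬nfix j j≡ nfix = contradiction (subst (NFix σ) (Fin.toℕ-injective j≡) nfix) ¬nfix

    bounds-s∙ : ∀ u → u ≤ᴮ s k ∙ x → Bounds (toℕ k) (s k ∙ x) u
    bounds-s∙ u u≤ = lt , λ j j≡ nfix _ → vacuous (s k ∙ x) (¬NFix-s∙ k x x∈W) j j≡ nfix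
      where
      open ℕ.≤-Reasoning
      lt : ¬ u ≈ s k ∙ x → suc (weight u (s k ∙ x)) ℕ.≤ inv (s k ∙ x)
      lt u≉ with proj₁ (≤s∙⇔ k x x∈W u) u≤
      ... | inj₁ u≤x = begin
        suc (weight u (s k ∙ x))    ≡⟨ cong suc (weight-same {u} {u} {s k ∙ x} {x} (count𝒜-s∙ u u (Agree-≈ u u (λ _ → refl))) refl) ⟩
        suc (weight u x)            ≤⟨ s≤s (bounds⇒≤ x u (bounds u u≤x)) ⟩
        suc (inv x)                 ≡⟨ inv-s∙ k x x∈W ⟨
        inv (s k ∙ x)               ∎
      ... | inj₂ su≤x = begin
        suc (weight u (s k ∙ x))    ≡⟨ cong suc (weight-suc {u} {s k ∙ u} {s k ∙ x} {x} (count𝒜-s∙ u (s k ∙ u) (Agree-sym (Agree-s∙ k u))) (inv-left k u x x∈W su≤x)) ⟩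
        2 + weight (s k ∙ u) x      ≤⟨ s≤s (proj₁ (bounds (s k ∙ u) su≤x) λ su≈x → u≉ λ i →
                                         trans (sym (cancelˡ k u i)) (cong (s k ⟨$⟩ʳ_) (su≈x i))) ⟩
        suc (inv x)                 ≡⟨ inv-s∙ k x x∈W ⟨
        inv (s k ∙ x)               ∎

    bounds-∙s : ∀ u → u ≤ᴮ x ∙ s k → Bounds (toℕ k) (x ∙ s k) u
    bounds-∙s u u≤ = lt , λ j j≡ nfix _ → vacuous (x ∙ s k) (¬NFix-∙s k x x∈W) j j≡ nfix
      where
      open ℕ.≤-Reasoning
      lt : ¬ u ≈ x ∙ s k → suc (weight u (x ∙ s k)) ℕ.≤ inv (x ∙ s k)
      lt u≉ with ≤∙s⇒ x k u≤
      ... | inj₁ u≤x = begin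
        suc (weight u (x ∙ s k))    ≡⟨ cong suc (weight-same {u} {u} {x ∙ s k} {x} (count𝒜-∙s u u (Agree-≈ u u (λ _ → refl))) refl) ⟩
        suc (weight u x)            ≤⟨ s≤s (bounds⇒≤ x u (bounds u u≤x)) ⟩
        suc (inv x)                 ≡⟨ inv-ascent x k x-asc ⟨
        inv (x ∙ s k)               ∎
      ... | inj₂ us≤x = begin
        suc (weight u (x ∙ s k))    ≡⟨ cong suc (weight-suc {u} {u ∙ s k} {x ∙ s k} {x} (count𝒜-∙s u (u ∙ s k) (Agree-sym (Agree-∙s k u))) (inv-right k u x x∈W us≤x)) ⟩
        2 + weight (u ∙ s k) x      ≤⟨ s≤s (proj₁ (bounds (u ∙ s k) us≤x) λ us≈x → u≉ λ i →
                                         trans (sym (cancelʳ u k i)) (us≈x (s k ⟨$⟩ʳ i))) ⟩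
        suc (inv x)                 ≡⟨ inv-ascent x k x-asc ⟨
        inv (x ∙ s k)               ∎

    module _ (moves : ¬ x ⟨$⟩ʳ Fin.suc k ≡ Fin.suc k) where

      open TwoSided k x x∈W moves

      -- u arises from y ≤ x by multiplying with s on neither side, on one side or on
      -- both sides; the case s y s = y also counts as same.
      data Position (u y : S) : Set where
        same  : inv u ≡ inv y → Position u y
        once  : inv u ≡ suc (inv y) → ¬ W⁺ k u → Position u y
        twice : inv u ℕ.≤ 2 + inv y → ¬ W⁺ k u → ¬ W⁺⁺ k y → (¬ u ≈ ρ → ¬ y ≈ x) → Position u y

      position : ∀ u → u ≤ᴮ ρ → ∃[ y ] (y ≤ᴮ x × Agree k u y × Position u y)
      position u u≤ρ with ≤ρ⇒ u u≤ρ
      ... | inj₁ (inj₁ u≤x) = u , u≤x , Agree-≈ u u (λ _ → refl) , same refl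
      ... | inj₁ (inj₂ su≤x) = s k ∙ u , su≤x , Agree-sym (Agree-s∙ k u)
        , once (inv-left k u x x∈W su≤x) (λ u∈W → s∙∉W⁺ k u u∈W (W-≤ su≤x x∈W))
      ... | inj₂ (inj₁ us≤x) = u ∙ s k , us≤x , Agree-sym (Agree-∙s k u)
        , once (inv-right k u x x∈W us≤x) (λ u∈W → ∙s∉W⁺ k u u∈W (W-≤ us≤x x∈W))
      ... | inj₂ (inj₂ sus≤x) = y , sus≤x , Agree-sym (Agree-trans (Agree-s∙ k (u ∙ s k)) (Agree-∙s k u)) , pos
        where
        y : S
        y = s k ∙ (u ∙ s k)
        y∈W : W⁺ k y
        y∈W = W-≤ sus≤x x∈W
        u≈sys : s k ∙ (y ∙ s k) ≈ u
        u≈sys i = trans (s-involutive k _) (cancelʳ u k i)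
        pos : Position u y
        pos with W? (suc (suc (toℕ k))) y
        ... | yes y∈W⁺⁺ = same (inv-cong u y λ i → trans (sym (u≈sys i)) (sys≈y y y∈W⁺⁺ i))
        ... | no y∉W⁺⁺ = twice
          (ℕ.≤-trans (inv≤-∙s u k) (ℕ.≤-reflexive (cong suc (inv-left k (u ∙ s k) x x∈W sus≤x))))
          (λ u∈W → y∉W⁺⁺ (sys∈W⇒ y y∈W (W-cong u (s k ∙ (y ∙ s k)) (sym ∘ u≈sys) u∈W)))
          y∉W⁺⁺
          (λ u≉ρ y≈x → u≉ρ λ i → trans (sym (u≈sys i)) (cong (s k ⟨$⟩ʳ_) (y≈x (s k ⟨$⟩ʳ i))))

      private
        module _ (u y : S) (y≤x : y ≤ᴮ x) (a : Agree k u y) where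

          open ℕ.≤-Reasoning

          c : ℕ
          c = count𝒜 y x

          y∈W : W⁺ k y
          y∈W = W-≤ y≤x x∈W

          Fix-k⇒W⁺ : u ≤ᴮ ρ → ∀ j → toℕ j ≡ toℕ k → Fix u j → W⁺ k u
          Fix-k⇒W⁺ u≤ρ j j≡ fix = Fix⇒W u k (W-≤ u≤ρ ρ∈W) (subst (Fix u) (Fin.toℕ-injective j≡) fix)

          special-weight : 2 + (suc c + suc c + inv y) ≡ 2 + (2 + weight y x)
          special-weight = lemma c (inv y)
            where
            lemma : ∀ c i → 2 + (suc c + suc c + i) ≡ 2 + (2 + (c + c + i))
            lemma = solveℕ

          module _ (j : Fin n) (j≡ : toℕ j ≡ suc (toℕ k)) (nfix : NFix x j) (y∈W⁺⁺ : W⁺⁺ k y) where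

            private
              weight-u : weight u ρ ≡ suc c + suc c + inv u
              weight-u = cong (λ m → m + m + inv u) (count𝒜-special u y j j≡ nfix a y∈W⁺⁺)

              y-bound : 2 + weight y x ℕ.≤ inv x
              y-bound = proj₂ (bounds y y≤x) j j≡ nfix (W⇒Fix y j (subst (λ m → W (suc m) y) (sym j≡) y∈W⁺⁺))

              special-same : inv u ≡ inv y → 2 + weight u ρ ℕ.≤ inv ρ
              special-same i = begin
                2 + weight u ρ                 ≡⟨ cong (2 +_) (trans weight-u (cong (suc c + suc c +_) i)) ⟩
                2 + (suc c + suc c + inv y)    ≡⟨ special-weight ⟩
                2 + (2 + weight y x)           ≤⟨ ℕ.+-monoʳ-≤ 2 y-bound ⟩
                2 + inv x                      ≡⟨ inv-ρ ⟨
                inv ρ                          ∎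

            -- The new element of 𝒜 raises the weight by 2, which the stronger bound for y pays for:
            -- s j occurs twice in x and is absent from y. If u is longer than y, then s k occurs in
            -- u and only the strict bound remains to be shown.
            bounds-special : Position u y → u ≤ᴮ ρ → Bounds (toℕ k) ρ u
            bounds-special (same i) u≤ρ =
              (λ _ → ℕ.<⇒≤ (special-same i)) , (λ _ _ _ _ → special-same i)
            bounds-special (once i u∉W) u≤ρ =
                (λ _ → begin
                  suc (weight u ρ)                     ≡⟨ cong suc (trans weight-u (trans (cong (suc c + suc c +_) i) (ℕ.+-suc (suc c + suc c) (inv y)))) ⟩
                  2 + (suc c + suc c + inv y)          ≡⟨ special-weight ⟩
                  2 + (2 + weight y x)                 ≤⟨ ℕ.+-monoʳ-≤ 2 y-bound ⟩
                  2 + inv x                            ≡⟨ inv-ρ ⟨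
                  inv ρ                                ∎)
              , (λ i i≡ _ fix → contradiction (Fix-k⇒W⁺ u≤ρ i i≡ fix) u∉W)
            bounds-special (twice _ _ y∉W⁺⁺ _) u≤ρ = contradiction y∈W⁺⁺ y∉W⁺⁺

          -- The counts of u and y agree, and the two extra letters of ρ make up for the added
          -- length. They yield the stronger bound when u and y are equally long; when u may be
          -- longer by 2, the strict bound for y ≠ x is used up.
          bounds-ordinary : ¬ (W⁺⁺ k y × ∃[ j ] (toℕ j ≡ suc (toℕ k) × NFix x j)) →
                            Position u y → u ≤ᴮ ρ → Bounds (toℕ k) ρ u
          bounds-ordinary ¬special pos u≤ρ = go pos
            where
            c≡ : count𝒜 u ρ ≡ count𝒜 y x
            c≡ = count𝒜-ordinary u y y∈W a ¬special

            y-bound : weight y x ℕ.≤ inv x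
            y-bound = bounds⇒≤ x y (bounds y y≤x)

            go : Position u y → Bounds (toℕ k) ρ u
            go (same i) = (λ _ → ℕ.<⇒≤ le) , (λ _ _ _ _ → le)
              where
              le : 2 + weight u ρ ℕ.≤ inv ρ
              le = begin
                2 + weight u ρ    ≡⟨ cong (2 +_) (weight-same {u} {y} {ρ} {x} c≡ i) ⟩
                2 + weight y x    ≤⟨ ℕ.+-monoʳ-≤ 2 y-bound ⟩
                2 + inv x         ≡⟨ inv-ρ ⟨
                inv ρ             ∎
            go (once i u∉W) =
                (λ _ → begin
                  suc (weight u ρ)    ≡⟨ cong suc (weight-suc {u} {y} {ρ} {x} c≡ i) ⟩
                  2 + weight y x      ≤⟨ ℕ.+-monoʳ-≤ 2 y-bound ⟩
                  2 + inv x           ≡⟨ inv-ρ ⟨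
                  inv ρ               ∎)
              , (λ i i≡ _ fix → contradiction (Fix-k⇒W⁺ u≤ρ i i≡ fix) u∉W)
            go (twice i u∉W _ ≉) =
                (λ u≉ρ → begin
                  suc (weight u ρ)             ≡⟨ cong (λ m → suc (m + m + inv u)) c≡ ⟩
                  suc (c + c + inv u)          ≤⟨ s≤s (ℕ.+-monoʳ-≤ (c + c) i) ⟩
                  suc (c + c + (2 + inv y))    ≡⟨ lemma c (inv y) ⟩
                  2 + suc (weight y x)         ≤⟨ ℕ.+-monoʳ-≤ 2 (proj₁ (bounds y y≤x) (≉ u≉ρ)) ⟩
                  2 + inv x                    ≡⟨ inv-ρ ⟨
                  inv ρ                        ∎)
              , (λ i i≡ _ fix → contradiction (Fix-k⇒W⁺ u≤ρ i i≡ fix) u∉W)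
              where
              lemma : ∀ c i → suc (c + c + (2 + i)) ≡ 2 + suc (c + c + i)
              lemma = solveℕ

      bounds-s∙s : ∀ u → u ≤ᴮ ρ → Bounds (toℕ k) ρ u
      bounds-s∙s u u≤ρ with position u u≤ρ | successor k x x∈W moves
      ... | y , y≤x , a , pos | j , j≡ with W? (suc (suc (toℕ k))) y ×-dec nFix? x j
      ...   | yes (y∈W⁺⁺ , nfix) = bounds-special u y y≤x a j j≡ nfix y∈W⁺⁺ pos u≤ρ
      ...   | no ¬special = bounds-ordinary u y y≤x a
        (λ (y∈W⁺⁺ , i , i≡ , nfix) → ¬special
          (y∈W⁺⁺ , subst (NFix x) (Fin.toℕ-injective (trans i≡ (sym j≡))) nfix)) pos u≤ρ

  code-bounds : ∀ {k ρ} → Code k ρ → ∀ u → u ≤ᴮ ρ → Bounds k ρ u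
  code-bounds {k} {ρ} (one e) u u≤ρ =
      (λ u≉ρ → contradiction (λ i → trans (≤ε⇒≈ε (≤-respʳ ρ ε e u≤ρ) i) (sym (e i))) u≉ρ)
    , (λ j _ nfix _ → contradiction (W⇒Fix ρ j (λ x _ → e x)) (proj₁ nfix))
  code-bounds {k} {ρ} (skip c) u u≤ρ =
      proj₁ (code-bounds c u u≤ρ)
    , (λ { j refl nfix _ → contradiction (W⇒Fix ρ j (Code⇒W c)) (proj₁ nfix) })
  code-bounds {k} {ρ} (onˡ j x refl c e) u u≤ρ =
    bounds-≈ (s j ∙ x) ρ u e (bounds-s∙ j x (Code⇒W c) (code-bounds c) u (≤-respʳ ρ (s j ∙ x) e u≤ρ))
  code-bounds {k} {ρ} (onʳ j x refl c e) u u≤ρ =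
    bounds-≈ (x ∙ s j) ρ u e (bounds-∙s j x (Code⇒W c) (code-bounds c) u (≤-respʳ ρ (x ∙ s j) e u≤ρ))
  code-bounds {k} {ρ} (onˡʳ j x refl c moves e) u u≤ρ =
    bounds-≈ ((s j ∙ x) ∙ s j) ρ u e
      (bounds-s∙s j x (Code⇒W c) (code-bounds c) moves u (≤-respʳ ρ ((s j ∙ x) ∙ s j) e u≤ρ))

  -- Codes for reflections and the elements below them

  -- Conjugation by s k turns (k+1, b) into (k, b), so the transposition is a nest of two-sided
  -- factors around s (b-1); m = b - k - 1 is the number of these factors.
  code-transpose : ∀ m k b → toℕ b ≡ suc (toℕ k) + m → ∀ τ → τ ≈ transpose (inject₁ k) b → Code (toℕ k) τ
  code-transpose zero k b b≡ τ e with Fin.toℕ-injective {i = b} {j = Fin.suc k} (trans b≡ (ℕ.+-identityʳ _))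
  ... | refl = onˡ k ε refl (one λ _ → refl) e
  code-transpose (suc m) k b b≡ τ e = onˡʳ k x refl
    (subst (λ l → Code l x) k′≡ (code-transpose m k′ b
      (trans b≡ (trans (ℕ.+-suc (suc (toℕ k)) m) (cong (λ l → suc l + m) (sym k′≡)))) x
      (λ i → cong (λ y → transpose y b ⟨$⟩ʳ i) (sym k′-inject))))
    (λ p → b≢k+1 (trans (sym (transpose-ˡ (Fin.suc k) b)) p))
    (λ i → trans (e i) (sym (trans
      (cong (λ y → s k ⟨$⟩ʳ (x ⟨$⟩ʳ y)) (transpose-comm (inject₁ k) (Fin.suc k) i))
      (trans (conjugate-transpose (s k) (Fin.suc k) b i)
             (cong₂ (λ y z → transpose y z ⟨$⟩ʳ i) (s-ʳ k) (s-≢ k b≢k b≢k+1))))))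
    where
    k+1<b : suc (toℕ k) ℕ.< toℕ b
    k+1<b = ℕ.<-≤-trans (ℕ.m<m+n (suc (toℕ k)) (s≤s z≤n)) (ℕ.≤-reflexive (sym b≡))
    k+1<n : suc (toℕ k) ℕ.< n
    k+1<n = ℕ.<-≤-trans k+1<b (ℕ.s≤s⁻¹ (Fin.toℕ<n b))
    k′ : Fin n
    k′ = fromℕ< k+1<n
    k′≡ : toℕ k′ ≡ suc (toℕ k)
    k′≡ = Fin.toℕ-fromℕ< k+1<n
    k′-inject : inject₁ k′ ≡ Fin.suc k
    k′-inject = Fin.toℕ-injective (trans (Fin.toℕ-inject₁ k′) k′≡)
    x : S
    x = transpose (Fin.suc k) b
    b≢k+1 : b ≢ Fin.suc k
    b≢k+1 p = ℕ.<⇒≢ k+1<b (sym (cong toℕ p))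
    b≢k : b ≢ inject₁ k
    b≢k p = ℕ.<⇒≢ (ℕ.<-trans (ℕ.n<1+n _) k+1<b) (sym (trans (cong toℕ p) (Fin.toℕ-inject₁ k)))

  skips : ∀ k {ρ} → Code k ρ → Code 0 ρ
  skips zero    c = c
  skips (suc k) c = skips k (skip c)

  code-reflection : ∀ t → Reflection t → Code 0 t
  code-reflection t r with reflection⇒transpose t r
  ... | a , b , a<b , t≈ = skips (toℕ k) (code-transpose (toℕ b ℕ.∸ suc (toℕ k)) k b
      (sym (ℕ.m+[n∸m]≡n (subst (λ l → suc l ℕ.≤ toℕ b) (sym k≡) a<b))) t
      (λ i → trans (t≈ i) (cong (λ y → transpose y b ⟨$⟩ʳ i) (sym k-inject))))
    where
    a<n : toℕ a ℕ.< n
    a<n = ℕ.<-≤-trans a<b (ℕ.s≤s⁻¹ (Fin.toℕ<n b))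
    k : Fin n
    k = fromℕ< a<n
    k≡ : toℕ k ≡ toℕ a
    k≡ = Fin.toℕ-fromℕ< a<n
    k-inject : inject₁ k ≡ a
    k-inject = Fin.toℕ-injective (trans (Fin.toℕ-inject₁ k) k≡)

  -- By the lifting properties, an element below s x s arises from some y ≤ x by keeping any of the
  -- two outer factors, so the shape of a code survives.
  code-≤ : ∀ {k ρ} → Code k ρ → ∀ u → u ≤ᴮ ρ → Code k u
  code-≤ {ρ = ρ} (one e) u u≤ρ = one (≤ε⇒≈ε (≤-respʳ ρ ε e u≤ρ))
  code-≤ (skip c) u u≤ρ = skip (code-≤ c u u≤ρ)
  code-≤ {ρ = ρ} (onˡ j x refl c e) u u≤ρ with proj₁ (≤s∙⇔ j x (Code⇒W c) u) (≤-respʳ ρ (s j ∙ x) e u≤ρ)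
  ... | inj₁ u≤x  = skip (code-≤ c u u≤x)
  ... | inj₂ su≤x = onˡ j (s j ∙ u) refl (code-≤ c (s j ∙ u) su≤x) (sym ∘ cancelˡ j u)
  code-≤ {ρ = ρ} (onʳ j x refl c e) u u≤ρ with ≤∙s⇒ x j (≤-respʳ ρ (x ∙ s j) e u≤ρ)
  ... | inj₁ u≤x  = skip (code-≤ c u u≤x)
  ... | inj₂ us≤x = onʳ j (u ∙ s j) refl (code-≤ c (u ∙ s j) us≤x) (sym ∘ cancelʳ u j)
  code-≤ {ρ = ρ} (onˡʳ j x refl c moves e) u u≤ρ
    with TwoSided.≤ρ⇒ j x (Code⇒W c) moves u (≤-respʳ ρ ((s j ∙ x) ∙ s j) e u≤ρ)
  ... | inj₁ (inj₁ u≤x)   = skip (code-≤ c u u≤x)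
  ... | inj₁ (inj₂ su≤x)  = onˡ j (s j ∙ u) refl (code-≤ c (s j ∙ u) su≤x) (sym ∘ cancelˡ j u)
  ... | inj₂ (inj₁ us≤x)  = onʳ j (u ∙ s j) refl (code-≤ c (u ∙ s j) us≤x) (sym ∘ cancelʳ u j)
  ... | inj₂ (inj₂ sus≤x) with (s j ∙ (u ∙ s j)) ⟨$⟩ʳ Fin.suc j Fin.≟ Fin.suc j
  ...   | no y-moves = onˡʳ j (s j ∙ (u ∙ s j)) refl (code-≤ c (s j ∙ (u ∙ s j)) sus≤x) y-moves
          (λ i → sym (trans (s-involutive j _) (cancelʳ u j i)))
  -- s u s fixes k + 1, hence commutes with s and equals u; both outer factors cancel.
  ...   | yes y-fixes = skip (code-≤ c u (≤-respˡ y u y≈u sus≤x))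
    where
    y : S
    y = s j ∙ (u ∙ s j)
    y≈u : y ≈ u
    y≈u i = trans (sym (TwoSided.sys≈y j x (Code⇒W c) moves y (W⁺⇒W⁺⁺ j y (W-≤ sus≤x (Code⇒W c)) y-fixes) i))
                  (trans (s-involutive j _) (cancelʳ u j i))

corollary6 : (n : ℕ) → 1 ≤ n →
    let open A n in
    (P : Permutation′ (suc n) → Permutation′ (suc n) → Poly) → IsKLFamily P →
    (π ρ : Permutation′ (suc n)) → Boolean π → Boolean ρ → π ≤ᴮ ρ →
    P π ρ ≋ 1+q ^ₚ #𝒜 π ρ
corollary6 n _ P isKL π ρ _ (t , (t-reflection , _) , ρ≤t) π≤ρ = at (≃-trans
  (KL-unique ρ (closedForm ρ) (proj₁ (code-selfDual R isRFamily code)) (closedForm-≰ ρ) at-ρ degree π π≤ρ)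
  (≃-trans (closedForm-≤ ρ π π≤ρ) (≡⇒≃ (cong (1+q ^ₚ_) (count𝒜≡#𝒜 π ρ)))))
  where
  open A n
  open Lengths n
  open Bruhat n
  open Hecke n
  open FixedIntervals n
  open Candidate n
  open Codes n
  open Degree n
  open KazhdanLusztig n
  open Uniqueness P isKL
  open IsKLFamily isKL
  open Group (symmetricGroup (suc n)) using (_≈_)

  code : Code 0 ρ
  code = code-≤ (code-reflection t t-reflection) ρ ρ≤t

  at-ρ : closedForm ρ ρ ≃ 1ₚ
  at-ρ = ≃-trans (closedForm-≤ ρ ρ (≤-refl ρ)) (≡⇒≃ (cong (1+q ^ₚ_) (count𝒜-refl ρ)))

  degree : ∀ u → u ≤ᴮ ρ → ¬ u ≈ ρ → ∀ i → inv ρ ℕ.≤ inv u + (i + i) → coeff (closedForm ρ u) i ≡ 0ℤ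
  -- If i were at most the exponent c, then `bound` would give `inv ρ` at most `weight u ρ`, against
  -- `code-bounds`.
  degree u u≤ρ u≉ρ i bound = trans (at (closedForm-≤ ρ u u≤ρ) i) (coeff-1+q^ c i (ℕ.≰⇒> λ i≤c → ℕ.<-irrefl refl (begin-strict
      inv ρ             ≤⟨ bound ⟩
      inv u + (i + i)   ≤⟨ ℕ.+-monoʳ-≤ (inv u) (ℕ.+-mono-≤ i≤c i≤c) ⟩
      inv u + (c + c)   ≡⟨ ℕ.+-comm (inv u) (c + c) ⟩
      c + c + inv u     <⟨ proj₁ (code-bounds code u u≤ρ) u≉ρ ⟩
      inv ρ             ∎)))
    where
    open ℕ.≤-Reasoning
    c : ℕ
    c = count𝒜 u ρ
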